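{- Every $3$-connected $3$-regular planar graph with $n$ vertices has at least $\frac{3}{2}n$ and at most $2n-1$ inequivalent embeddings on the projective-plane.
   Context: All graphs are finite, simple and undirected. Embeddings on surfaces are cellular (every face homeomorphic to an open $2$-cell). Two embeddings $f_1,f_2\colon G\to F^2$ are equivalent if there is a homeomorphism $h\colon F^2\to F^2$ with $hf_1=f_2$. -}

module Defs where

open import Data.Nat using (ℕ; zero; suc; _+_; _*_; _≤_; _<_)
open import Data.Nat.Base using (_<ᵇ_)
open import Data.Fin using (Fin; toℕ)
open import Data.Bool using (Bool; true; false; not; _∧_; _xor_; if_then_else_)
open import Data.Product using (Σ; ∃; _×_; _,_; proj₁)
open import Relation.Binary.PropositionalEquality using (_≡_; _≢_)
open import Relation.Binary.Construct.Closure.Equivalence using (EqClosure)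
open import Function.Bundles using (_⇔_)

record Graph (n : ℕ) : Set where
  field
    adj   : Fin n → Fin n → Bool
    sym   : ∀ u v → adj u v ≡ adj v u
    irrefl : ∀ v → adj v v ≡ false
open Graph public

countFin : {n : ℕ} → (Fin n → Bool) → ℕ
countFin {zero}  P = 0
countFin {suc n} P = (if P Fin.zero then 1 else 0) + countFin (λ i → P (Fin.suc i))
  where import Data.Fin as Fin

sumFin : {n : ℕ} → (Fin n → ℕ) → ℕ
sumFin {zero}  f = 0
sumFin {suc n} f = f Fin.zero + sumFin (λ i → f (Fin.suc i))
  where import Data.Fin as Fin

degree : {n : ℕ} → Graph n → Fin n → ℕ
degree G v = countFin (adj G v)

edgeCount : {n : ℕ} → Graph n → ℕ
edgeCount G = sumFin (λ u → countFin (λ v → adj G u v ∧ (toℕ u <ᵇ toℕ v)))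

Cubic : {n : ℕ} → Graph n → Set
Cubic G = ∀ v → degree G v ≡ 3

data WalkAvoiding {n : ℕ} (G : Graph n) (X : Fin n → Bool) : Fin n → Fin n → Set where
  here : ∀ {u} → WalkAvoiding G X u u
  step : ∀ {u v w} → adj G u v ≡ true → X v ≡ false →
         WalkAvoiding G X v w → WalkAvoiding G X u w

KConnected : ℕ → {n : ℕ} → Graph n → Set
KConnected k {n} G =
  (k < n) ×
  (∀ (X : Fin n → Bool) → countFin X < k →
     ∀ u w → X u ≡ false → X w ≡ false → WalkAvoiding G X u w)

-- Embedding schemes (rotation system + edge signature), the standard
-- combinatorial description of 2-cell embeddings (Mohar–Thomassen §3.3).

iter : {A : Set} → (A → A) → ℕ → A → A
iter f zero    x = x
iter f (suc k) x = f (iter f k x)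

record Scheme {n : ℕ} (G : Graph n) : Set where
  field
    rot     : Fin n → Fin n → Fin n
    rot-adj : ∀ v u → adj G v u ≡ true → adj G v (rot v u) ≡ true
    rot-inj : ∀ v u w → adj G v u ≡ true → adj G v w ≡ true →
              rot v u ≡ rot v w → u ≡ w
    rot-cyc : ∀ v u w → adj G v u ≡ true → adj G v w ≡ true →
              ∃ λ k → iter (rot v) k u ≡ w
    -- edge signature: true = twisted edge (signature -1)
    sig     : Fin n → Fin n → Bool
    sig-sym : ∀ u v → sig u v ≡ sig v u
open Scheme public

-- Flags (v , u , s): the corner at v on side s of the edge vu;
-- s = true is the side between u and rot v u.
record Flag {n : ℕ} (G : Graph n) : Set where
  constructor flag
  field
    fv   : Fin n
    fu   : Fin n
    side : Bool
    isEdge : adj G fv fu ≡ true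
open Flag public

-- the two generating flag moves (their symmetric closure gives the
-- involutions τ₁ (change edge at a vertex) and τ₀ (change end of edge))
data FlagStep {n : ℕ} {G : Graph n} (σ : Scheme G) : Flag G → Flag G → Set where
  τ₁ : ∀ {x y} → fv y ≡ fv x → side x ≡ true → side y ≡ false →
       fu y ≡ rot σ (fv x) (fu x) → FlagStep σ x y
  τ₀ : ∀ {x y} → fv y ≡ fu x → fu y ≡ fv x →
       side y ≡ (if sig σ (fv x) (fu x) then side x else not (side x)) →
       FlagStep σ x y

SameFace : {n : ℕ} {G : Graph n} → Scheme G → Flag G → Flag G → Set
SameFace σ = EqClosure (FlagStep σ)

HasFaces : {n : ℕ} {G : Graph n} → Scheme G → ℕ → Set
HasFaces {G = G} σ F =
  Σ (Flag G → Fin F) λ c →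
    (∀ x y → (c x ≡ c y) ⇔ SameFace σ x y) ×
    (∀ i → ∃ λ x → c x ≡ i)

-- embedding in the projective plane: Euler characteristic V - E + F = 1
-- (Euler characteristic 1 occurs only for the projective plane)
IsProjective : {n : ℕ} {G : Graph n} → Scheme G → Set
IsProjective {n} {G} σ = ∃ λ F → HasFaces σ F × (n + F ≡ edgeCount G + 1)

ProjEmbedding : {n : ℕ} → Graph n → Set
ProjEmbedding G = Σ (Scheme G) IsProjective

-- planar: admits an orientable (all signatures positive) scheme with
-- Euler characteristic 2
Planar : {n : ℕ} → Graph n → Set
Planar {n} G = Σ (Scheme G) λ σ →
  (∀ u v → adj G u v ≡ true → sig σ u v ≡ false) ×
  (∃ λ F → HasFaces σ F × (n + F ≡ edgeCount G + 2))

-- equivalence of embedding schemes: related by local switches at a set S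
-- of vertices (reverse rotation at v ∈ S, toggle signature of each edge
-- once per switched end). Only values on edges/neighbourhoods matter.
Equivalent : {n : ℕ} {G : Graph n} → Scheme G → Scheme G → Set
Equivalent {n} {G} σ τ = Σ (Fin n → Bool) λ S →
  (∀ v u → adj G v u ≡ true →
     (if S v then rot τ v (rot σ v u) ≡ u else rot τ v u ≡ rot σ v u)) ×
  (∀ u v → adj G u v ≡ true → sig τ u v ≡ (sig σ u v xor S u) xor S v)

EquivalentEmb : {n : ℕ} {G : Graph n} → ProjEmbedding G → ProjEmbedding G → Set
EquivalentEmb e f = Equivalent (proj₁ e) (proj₁ f)

{-# OPTIONS --safe #-}

-- In a cubic graph every scheme can be switched to the rotations of the given plane embedding σ₀, so up to
-- equivalence embeddings are the sets A of twisted edges, and distinct sets are inequivalent.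
--
-- Twisting one edge merges the two distinct faces beside it, which gives the 3n/2 embeddings of the lower bound.
--
-- For the upper bound work over F₂. By Euler's formula every cycle is a sum of face boundaries, so every edge set
-- meeting each face boundary evenly is a cut; hence, by 3-connectivity, an edge has two distinct faces and is
-- determined by them. The faces of the embedding given by A correspond to the sets of plane faces whose boundary
-- meets A in a cut. If their number is one less than in the plane, these sets have codimension one, and this
-- forces A to consist of the edges between the members of a clique X of the dual graph, with |X| even.
-- Planarity excludes K₅, so |X| is 2 or 4. For |X| = 4 fix a vertex r of G: exactly as in a plane drawing, some
-- member of X, the apex, is separated from r by the triangle of the other three, and it determines X. The apex
-- is never one of the three faces at r, so with E edges and F₀ faces there are at most E + F₀ − 3 = 2n − 1 sets A.

module Submission where

open import Defs
open import Data.Nat as ℕ using (ℕ; zero; suc; _+_; _*_; _^_; _≤_; _<_; z≤n; s≤s)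
import Data.Nat.Properties as ℕ
open import Data.Fin as Fin using (Fin; zero; suc; toℕ; splitAt; _↑ˡ_; _↑ʳ_; _≟_)
open import Data.Fin.Properties as Fin using (any?; pigeonhole; 2↔Bool; finToFun-funToFin; funToFin-finToFin)
open import Data.Bool using (Bool; true; false; not; _∧_; _∨_; _xor_; if_then_else_; T)
open import Data.Bool.Properties using (xor-∧-commutativeRing; xor-same; xor-comm; xor-assoc; xor-identityʳ; ∧-distribˡ-xor; ∧-distribʳ-xor; ∧-zeroʳ; ¬-not; not-injective)
import Data.Bool.Properties as Bool
open import Data.Product as Prod using (Σ; ∃; ∃₂; _×_; _,_; proj₁; proj₂)
open import Data.Sum as Sum using (_⊎_; inj₁; inj₂)
open import Data.Empty using (⊥; ⊥-elim)
open import Function using (_∘_)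
open import Function.Bundles using (Inverse; Equivalence; mk⇔)
open import Algebra.Bundles using (CommutativeRing)
open import Relation.Nullary using (¬_; ¬?; Dec; yes; no; does; contradiction)
open import Relation.Nullary.Decidable using (dec-true; dec-false; _×-dec_; _⊎-dec_)
open import Relation.Binary.PropositionalEquality as ≡ using (_≡_; _≢_; _≗_; refl; cong; cong₂; trans; subst; module ≡-Reasoning) renaming (sym to ≡-sym)
open import Algebra.Properties.Semiring.Sum (CommutativeRing.semiring xor-∧-commutativeRing)
  using (sum; sum-cong-≗; ∑-distrib-+; ∑-comm; *-distribˡ-sum; sum-replicate-zero)
import Algebra.Properties.CommutativeMonoid.Sum ℕ.+-0-commutativeMonoid as ℕΣ
open import Relation.Binary.Definitions using (tri<; tri≈; tri>)
open import Data.List using (List; []; _∷_)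
open import Data.List.Relation.Unary.All using (All; []; _∷_)
import Relation.Binary.Construct.Closure.Equivalence as EqC
open import Relation.Binary.PropositionalEquality.WithK using (≡-irrelevant)
open import Data.Bool.Solver using (module xor-∧-Solver)
open import Relation.Binary.Construct.Closure.ReflexiveTransitive using (ε; _◅_)
open import Relation.Binary.Construct.Closure.Symmetric using (fwd; bwd)

-- All dimension arguments rest on one pigeonhole count, `kernel`, applied in
-- `boundary-combination`. Euler's formula only makes that count strict: with one extra cycle in the
-- plane, so that every cycle bounds, and with two in a twisted embedding, which gives the
-- codimension. The clique comes from a parity principle: a cut meets the boundary of a face evenly,
-- so a cut edge on a face has a companion there, with a different face across. Call a face twisted
-- if it borders an edge of A. The A-part of one twisted face boundary is never a cut, so for two
-- twisted faces f and g the A-part of the sum of their boundaries is one. If h is across a twisted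
-- edge of f, the companion on h of this edge must border g; this spreads adjacency to all pairs.
-- The companion on f leads to a fourth face, so |X| = 3 cannot occur. No Jordan curve theorem is
-- used. The edges between three mutually adjacent faces form a cut S, which is constant along every
-- other face; normalising S to vanish at r gives the triangle an outside. This is all the plane
-- geometry behind the exclusion of K₅ and the choice of an apex.

-- Bits, sums over F₂ and pigeonhole

true≢false : true ≢ false
true≢false ()

xor-interchange : ∀ a b c d → (a xor b) xor (c xor d) ≡ (a xor c) xor (b xor d)
xor-interchange true  true  c d = ≡-sym (Bool.xor-annihilates-not c d)
xor-interchange true  false true  d = Bool.not-involutive d
xor-interchange true  false false d = refl
xor-interchange false true  true  d = refl
xor-interchange false true  false d = refl
xor-interchange false false c d = refl

xor-cancelʳ : ∀ a b → (a xor b) xor b ≡ a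
xor-cancelʳ a b = trans (xor-assoc a b b) (trans (cong (a xor_) (xor-same b)) (xor-identityʳ a))

xor≡false⇒≡ : ∀ {a b} → a xor b ≡ false → a ≡ b
xor≡false⇒≡ {true}  {true}  _ = refl
xor≡false⇒≡ {false} {false} _ = refl

≡⇒xor≡false : ∀ {a b} → a ≡ b → a xor b ≡ false
≡⇒xor≡false {a} refl = xor-same a

xor≡true⇒≢ : ∀ {a b} → a xor b ≡ true → a ≢ b
xor≡true⇒≢ {a} e refl = contradiction (trans (≡-sym e) (xor-same a)) true≢false

≢⇒xor≡true : ∀ {a b} → a ≢ b → a xor b ≡ true
≢⇒xor≡true {true}  {true}  p = contradiction refl p
≢⇒xor≡true {true}  {false} p = refl
≢⇒xor≡true {false} {true}  p = refl
≢⇒xor≡true {false} {false} p = contradiction refl p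

xor-true : ∀ {a b} → a xor b ≡ true → a ≡ true ⊎ b ≡ true
xor-true {true} _ = inj₁ refl
xor-true {false} e = inj₂ e

∧≡true : ∀ {a b} → a ∧ b ≡ true → a ≡ true × b ≡ true
∧≡true {true} {true} _ = refl , refl

∧-cong-when : ∀ {a b c} → (a ≡ true → b ≡ c) → a ∧ b ≡ a ∧ c
∧-cong-when {true} e = e refl
∧-cong-when {false} e = refl

<⇒<ᵇ≡true : ∀ {m n} → m < n → (m ℕ.<ᵇ n) ≡ true
<⇒<ᵇ≡true m<n = Equivalence.to Bool.T-≡ (ℕ.<⇒<ᵇ m<n)

≮⇒<ᵇ≡false : ∀ {m n} → ¬ m < n → (m ℕ.<ᵇ n) ≡ false
≮⇒<ᵇ≡false {m} m≮n = ¬-not (m≮n ∘ ℕ.<ᵇ⇒< m _ ∘ Equivalence.from Bool.T-≡)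

_==_ : ∀ {m} → Fin m → Fin m → Bool
i == j = does (i ≟ j)

==-refl : ∀ {m} (i : Fin m) → (i == i) ≡ true
==-refl i = dec-true (i ≟ i) refl

==-≢ : ∀ {m} {i j : Fin m} → i ≢ j → (i == j) ≡ false
==-≢ {i = i} {j} = dec-false (i ≟ j)

==-≡ : ∀ {m} {i j : Fin m} → i ≡ j → (i == j) ≡ true
==-≡ {i = i} {j} = dec-true (i ≟ j)

==⇒≡ : ∀ {m} {i j : Fin m} → (i == j) ≡ true → i ≡ j
==⇒≡ {i = i} {j} e with i ≟ j
... | yes p = p

==⇒≢ : ∀ {m} {i j : Fin m} → (i == j) ≡ false → i ≢ j
==⇒≢ {i = i} e refl = true≢false (trans (≡-sym (==-refl i)) e)

==-sym : ∀ {m} (i j : Fin m) → (i == j) ≡ (j == i)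
==-sym i j with i ≟ j
... | yes p = ≡-sym (==-≡ (≡-sym p))
... | no p = ≡-sym (==-≢ (p ∘ ≡-sym))

sum-false : ∀ {m} {f : Fin m → Bool} → (∀ i → f i ≡ false) → sum f ≡ false
sum-false {m} e = trans (sum-cong-≗ e) (sum-replicate-zero m)

sum-== : ∀ {m} (j : Fin m) (h : Fin m → Bool) → sum (λ i → h i ∧ (i == j)) ≡ h j
sum-== zero h = begin
  (h zero ∧ true) xor sum (λ i → h (suc i) ∧ false)
    ≡⟨ cong₂ _xor_ (Bool.∧-identityʳ (h zero)) (sum-false (λ i → ∧-zeroʳ (h (suc i)))) ⟩
  h zero xor false  ≡⟨ xor-identityʳ (h zero) ⟩
  h zero            ∎
  where open ≡-Reasoning
sum-== (suc j) h = cong₂ _xor_ (∧-zeroʳ (h zero)) (trans (sum-cong-≗ step′) (sum-== j (h ∘ suc)))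
  where
  step′ : ∀ i → h (suc i) ∧ (suc i == suc j) ≡ h (suc i) ∧ (i == j)
  step′ i with i ≟ j
  ... | yes _ = refl
  ... | no _ = refl

sum-even-other : ∀ {m} (h : Fin m → Bool) → sum h ≡ false →
                 ∀ i → h i ≡ true → ∃ λ j → j ≢ i × h j ≡ true
sum-even-other h even i hi with any? (λ j → h j ∧ not (j == i) Bool.≟ true)
... | yes (j , e) = let hj , j≠i = ∧≡true {h j} e in
                    j , (λ { refl → true≢false (trans (≡-sym j≠i) (cong not (==-refl j))) }) , hj
... | no none = contradiction (trans (≡-sym hi) (trans (≡-sym (sum-== i h)) (trans (sum-cong-≗ only) even))) true≢false
  where
  only : ∀ j → h j ∧ (j == i) ≡ h j
  only j with h j in hj | j ≟ i
  ... | false | _ = refl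
  ... | true  | yes _ = refl
  ... | true  | no j≢i = contradiction (j , cong₂ _∧_ hj (cong not (==-≢ j≢i))) none

-- If row `i` is even, the companion lies in that row; if it is odd, some other row is odd too and
-- therefore has a true entry.
sum²-even-other : ∀ {m k} (h : Fin m → Fin k → Bool) → sum (λ i → sum (h i)) ≡ false →
                  ∀ i j → h i j ≡ true → ∃₂ λ i′ j′ → ¬ (i′ ≡ i × j′ ≡ j) × h i′ j′ ≡ true
sum²-even-other h even i j hij with sum (h i) in row
... | false = let j′ , j′≢j , e = sum-even-other (h i) row j hij in i , j′ , j′≢j ∘ proj₂ , e
... | true with sum-even-other (λ i → sum (h i)) even i row
...   | i′ , i′≢i , row′ with any? (λ j′ → h i′ j′ Bool.≟ true)
...     | yes (j′ , e) = i′ , j′ , i′≢i ∘ proj₁ , e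
...     | no none = contradiction (trans (≡-sym row′) (sum-false (λ j′ → ¬-not (λ e → none (j′ , e))))) true≢false

-- Pigeonhole: 2ᵇ < 2ᵃ.
kernel : ∀ {a b} (f : (Fin a → Bool) → Fin b → Bool) →
         (∀ x y k → f (λ i → x i xor y i) k ≡ f x k xor f y k) → b < a →
         ∃ λ x → (∃ λ i → x i ≡ true) × ∀ k → f x k ≡ false
kernel {a} {b} f add b<a = diff (pigeonhole (ℕ.^-monoʳ-< 2 (s≤s (s≤s z≤n)) b<a) (encode ∘ f ∘ decode))
  where
  toBool : Fin 2 → Bool
  toBool = Inverse.to 2↔Bool
  decode : ∀ {m} → Fin (2 ^ m) → Fin m → Bool
  decode k i = toBool (Fin.finToFun k i)
  encode : ∀ {m} → (Fin m → Bool) → Fin (2 ^ m)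
  encode g = Fin.funToFin (Inverse.from 2↔Bool ∘ g)
  decode-encode : ∀ {m} (g : Fin m → Bool) → decode (encode g) ≗ g
  decode-encode g i = trans (cong toBool (finToFun-funToFin (Inverse.from 2↔Bool ∘ g) i))
                            (Inverse.strictlyInverseˡ 2↔Bool (g i))
  funToFin-cong : ∀ {m k} {g h : Fin m → Fin k} → g ≗ h → Fin.funToFin g ≡ Fin.funToFin h
  funToFin-cong {zero} e = refl
  funToFin-cong {suc m} e = cong₂ Fin.combine (e zero) (funToFin-cong (e ∘ suc))
  decode-injective : ∀ {m} {k l : Fin (2 ^ m)} → decode k ≗ decode l → k ≡ l
  decode-injective {m} {k} {l} e = begin
    k                                   ≡⟨ funToFin-finToFin {m} k ⟨
    Fin.funToFin (Fin.finToFun {2} {m} k)  ≡⟨ funToFin-cong {m} (λ i → bits (e i)) ⟩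
    Fin.funToFin (Fin.finToFun {2} {m} l)  ≡⟨ funToFin-finToFin {m} l ⟩
    l ∎
    where
    open ≡-Reasoning
    bits : ∀ {p q} → toBool p ≡ toBool q → p ≡ q
    bits {zero} {zero} _ = refl
    bits {suc zero} {suc zero} _ = refl
    bits {zero} {suc zero} ()
  diff : (∃₂ λ i j → i Fin.< j × encode (f (decode i)) ≡ encode (f (decode j))) →
         ∃ λ x → (∃ λ i → x i ≡ true) × ∀ k → f x k ≡ false
  diff (i , j , i<j , same) with any? (λ l → decode i l xor decode j l Bool.≟ true)
  ... | yes nonzero = (λ l → decode i l xor decode j l) , nonzero , λ k → trans (add _ _ k) (≡⇒xor≡false (begin
    f (decode i) k                            ≡⟨ decode-encode (f (decode i)) k ⟨
    decode (encode (f (decode i))) k          ≡⟨ cong (λ c → decode c k) same ⟩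
    decode (encode (f (decode j))) k          ≡⟨ decode-encode (f (decode j)) k ⟩
    f (decode j) k                            ∎))
    where open ≡-Reasoning
  ... | no zero′ = contradiction (decode-injective (λ l → xor≡false⇒≡ (¬-not (λ e → zero′ (l , e))))) (Fin.<⇒≢ i<j)

four-in-three : {i j k : Fin 3} → i ≢ j → i ≢ k → j ≢ k → ∀ l → l ≡ i ⊎ l ≡ j ⊎ l ≡ k
four-in-three {i} {j} {k} i≢j i≢k j≢k l with l ≟ i | l ≟ j | l ≟ k
... | yes p | _ | _ = inj₁ p
... | _ | yes p | _ = inj₂ (inj₁ p)
... | _ | _ | yes p = inj₂ (inj₂ p)
... | no l≢i | no l≢j | no l≢k = ⊥-elim (collide (pigeonhole (ℕ.n<1+n 3) pick))
  where
  pick : Fin 4 → Fin 3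
  pick zero = i
  pick (suc zero) = j
  pick (suc (suc zero)) = k
  pick (suc (suc (suc zero))) = l
  collide : ¬ ∃₂ λ x y → x Fin.< y × pick x ≡ pick y
  collide (zero , suc zero , _ , e) = i≢j e
  collide (zero , suc (suc zero) , _ , e) = i≢k e
  collide (zero , suc (suc (suc zero)) , _ , e) = l≢i (≡-sym e)
  collide (suc zero , suc (suc zero) , _ , e) = j≢k e
  collide (suc zero , suc (suc (suc zero)) , _ , e) = l≢j (≡-sym e)
  collide (suc (suc zero) , suc (suc (suc zero)) , _ , e) = l≢k (≡-sym e)
  collide (suc zero , suc zero , s≤s () , _)
  collide (suc (suc zero) , suc zero , s≤s () , _)
  collide (suc (suc zero) , suc (suc zero) , s≤s (s≤s ()) , _)
  collide (suc (suc (suc zero)) , suc zero , s≤s () , _)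
  collide (suc (suc (suc zero)) , suc (suc zero) , s≤s (s≤s ()) , _)
  collide (suc (suc (suc zero)) , suc (suc (suc zero)) , s≤s (s≤s (s≤s ())) , _)

-- Enumerating subsets and disjoint unions of finite index sets

rank : ∀ {m} (P : Fin m → Bool) i → P i ≡ true → Fin (countFin P)
rank P zero p with P zero
rank P zero refl | true = zero
rank P (suc i) p = (if P zero then 1 else 0) ↑ʳ rank (P ∘ suc) i p

element : ∀ {m} (P : Fin m → Bool) → Fin (countFin P) → Fin m
element {suc m} P k with P zero
element {suc m} P zero | true = zero
element {suc m} P (suc k) | true = suc (element (P ∘ suc) k)
element {suc m} P k | false = suc (element (P ∘ suc) k)

element-sat : ∀ {m} (P : Fin m → Bool) k → P (element P k) ≡ true
element-sat {suc m} P k with P zero in eq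
element-sat {suc m} P zero | true = eq
element-sat {suc m} P (suc k) | true = element-sat (P ∘ suc) k
element-sat {suc m} P k | false = element-sat (P ∘ suc) k

element-rank : ∀ {m} (P : Fin m → Bool) i p → element P (rank P i p) ≡ i
element-rank P zero p with P zero
element-rank P zero refl | true = refl
element-rank P (suc i) p with P zero
... | true = cong suc (element-rank (P ∘ suc) i p)
... | false = cong suc (element-rank (P ∘ suc) i p)

element-injective : ∀ {m} (P : Fin m → Bool) {k l} → element P k ≡ element P l → k ≡ l
element-injective {suc m} P {k} {l} e with P zero
element-injective {suc m} P {zero} {zero} e | true = refl
element-injective {suc m} P {suc k} {suc l} e | true = cong suc (element-injective (P ∘ suc) (Fin.suc-injective e))
element-injective {suc m} P {k} {l} e | false = element-injective (P ∘ suc) (Fin.suc-injective e)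

pair-rank : ∀ {m} (f : Fin m → ℕ) i → Fin (f i) → Fin (sumFin f)
pair-rank f zero k = k ↑ˡ _
pair-rank f (suc i) k = f zero ↑ʳ pair-rank (f ∘ suc) i k

pair-element : ∀ {m} (f : Fin m → ℕ) → Fin (sumFin f) → Σ (Fin m) (Fin ∘ f)
pair-element {suc m} f k with splitAt (f zero) k
... | inj₁ x = zero , x
... | inj₂ y = let i , x = pair-element (f ∘ suc) y in suc i , x

pair-element-rank : ∀ {m} (f : Fin m → ℕ) i k → pair-element f (pair-rank f i k) ≡ (i , k)
pair-element-rank {suc m} f zero k rewrite Fin.splitAt-↑ˡ (f zero) k (sumFin (f ∘ suc)) = refl
pair-element-rank {suc m} f (suc i) k
  rewrite Fin.splitAt-↑ʳ (f zero) (sumFin (f ∘ suc)) (pair-rank (f ∘ suc) i k)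
        | pair-element-rank (f ∘ suc) i k = refl

pair-element-injective : ∀ {m} (f : Fin m → ℕ) {k l} → pair-element f k ≡ pair-element f l → k ≡ l
pair-element-injective f {k} {l} e = trans (≡-sym (rank-element f k)) (trans (cong (λ p → pair-rank f (proj₁ p) (proj₂ p)) e) (rank-element f l))
  where
  rank-element : ∀ {m} (f : Fin m → ℕ) k → pair-rank f (proj₁ (pair-element f k)) (proj₂ (pair-element f k)) ≡ k
  rank-element {suc m} f k with splitAt (f zero) k in eq
  ... | inj₁ x = Fin.splitAt⁻¹-↑ˡ eq
  ... | inj₂ y = trans (cong (f zero ↑ʳ_) (rank-element (f ∘ suc) y)) (Fin.splitAt⁻¹-↑ʳ eq)

sumFin≡sum : ∀ {m} (f : Fin m → ℕ) → sumFin f ≡ ℕΣ.sum f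
sumFin≡sum {zero} f = refl
sumFin≡sum {suc m} f = cong (f zero +_) (sumFin≡sum (f ∘ suc))

countFin≡sum : ∀ {m} (P : Fin m → Bool) → countFin P ≡ ℕΣ.sum (λ i → if P i then 1 else 0)
countFin≡sum {zero} P = refl
countFin≡sum {suc m} P = cong ((if P zero then 1 else 0) +_) (countFin≡sum (P ∘ suc))

countFin-none : ∀ {m} {P : Fin m → Bool} → (∀ i → P i ≡ false) → countFin P ≡ 0
countFin-none {zero} none = refl
countFin-none {suc m} {P} none rewrite none zero = countFin-none (none ∘ suc)

countFin-≤ : ∀ {m k} (P : Fin m → Bool) (g : Fin m → Fin k) →
             (∀ i j → P i ≡ true → P j ≡ true → g i ≡ g j → i ≡ j) → countFin P ≤ k
countFin-≤ P g inj = Fin.injective⇒≤ {f = g ∘ element P}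
  (λ e → element-injective P (inj _ _ (element-sat P _) (element-sat P _) e))

-- `punchOut` removes `g` and renumbers the rest; `g` then shares the image of `f`, the only
-- nontrivial fibre. Applied to the two faces beside a twisted edge, this numbers the faces of the
-- new embedding.
merge : ∀ {N F} → N ≡ suc F → {f g : Fin N} → f ≢ g →
        ∃ λ (m : Fin N → Fin F) → m f ≡ m g ×
          (∀ i j → m i ≡ m j → i ≡ j ⊎ (i ≡ f × j ≡ g) ⊎ (i ≡ g × j ≡ f)) × (∀ k → ∃ λ i → m i ≡ k)
merge {F = F} refl {f} {g} f≢g = m , merged , fibres , onto′
  where
  g≢f : g ≢ f
  g≢f = f≢g ∘ ≡-sym
  value : ∀ i → Dec (g ≡ i) → Fin F
  value i (yes _) = Fin.punchOut g≢f
  value i (no g≢i) = Fin.punchOut g≢i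
  m : Fin (suc F) → Fin F
  m i = value i (g ≟ i)
  value-other : ∀ {i} (x : Dec (g ≡ i)) (g≢i : g ≢ i) → value i x ≡ Fin.punchOut g≢i
  value-other (yes e) g≢i = contradiction e g≢i
  value-other (no _) g≢i = Fin.punchOut-cong g refl
  value-g : (x : Dec (g ≡ g)) → value g x ≡ Fin.punchOut g≢f
  value-g (yes _) = refl
  value-g (no ne) = contradiction refl ne
  merged : m f ≡ m g
  merged = trans (value-other (g ≟ f) g≢f) (≡-sym (value-g (g ≟ g)))
  fibres : ∀ i j → m i ≡ m j → i ≡ j ⊎ (i ≡ f × j ≡ g) ⊎ (i ≡ g × j ≡ f)
  fibres i j e = go (g ≟ i) (g ≟ j) e
    where
    go : (x : Dec (g ≡ i)) (y : Dec (g ≡ j)) → value i x ≡ value j y → i ≡ j ⊎ (i ≡ f × j ≡ g) ⊎ (i ≡ g × j ≡ f)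
    go (yes p) (yes q) _ = inj₁ (trans (≡-sym p) q)
    go (yes p) (no q) e = inj₂ (inj₂ (≡-sym p , ≡-sym (Fin.punchOut-injective g≢f q e)))
    go (no p) (yes q) e = inj₂ (inj₁ (Fin.punchOut-injective p g≢f e , ≡-sym q))
    go (no p) (no q) e = inj₁ (Fin.punchOut-injective p q e)
  onto′ : ∀ k → ∃ λ i → m i ≡ k
  onto′ k = Fin.punchIn g k , trans (value-other (g ≟ Fin.punchIn g k) (Fin.punchInᵢ≢i g k ∘ ≡-sym)) (Fin.punchOut-punchIn g)

-- Enumerating the edges, and the handshake identity

-- The summand of `edgeCount`: it selects the increasing orientation of each edge, so that
-- `Fin (edgeCount G)` indexes edges without repetition.
below : ∀ {n} → Graph n → Fin n → Fin n → Bool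
below G u v = adj G u v ∧ (toℕ u ℕ.<ᵇ toℕ v)

module _ {n} (G : Graph n) where

  below-sound : ∀ {u v} → below G u v ≡ true → adj G u v ≡ true × u Fin.< v
  below-sound {u} {v} e = let a , l = ∧≡true e in a , ℕ.<ᵇ⇒< (toℕ u) (toℕ v) (subst T (≡-sym l) _)

  below-total : ∀ {u v} → adj G u v ≡ true → below G u v ≡ true ⊎ below G v u ≡ true
  below-total {u} {v} a with ℕ.<-cmp (toℕ u) (toℕ v)
  ... | tri< u<v _ _ = inj₁ (cong₂ _∧_ a (<⇒<ᵇ≡true u<v))
  ... | tri> _ _ v<u = inj₂ (cong₂ _∧_ (trans (sym G v u) a) (<⇒<ᵇ≡true v<u))
  ... | tri≈ _ u≡v _ rewrite Fin.toℕ-injective u≡v = contradiction (trans (≡-sym a) (irrefl G v)) true≢false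

  edge : Fin (edgeCount G) → Fin n × Fin n
  edge k = let u , j = pair-element (λ u → countFin (below G u)) k in u , element (below G u) j

  edge-below : ∀ k → below G (proj₁ (edge k)) (proj₂ (edge k)) ≡ true
  edge-below k = element-sat (below G _) _

  edge-onto : ∀ u v → below G u v ≡ true → ∃ λ k → edge k ≡ (u , v)
  edge-onto u v e = pair-rank (λ u → countFin (below G u)) u (rank (below G u) v e) ,
    trans (cong (λ p → proj₁ p , element (below G (proj₁ p)) (proj₂ p))
                (pair-element-rank (λ u → countFin (below G u)) u (rank (below G u) v e)))
          (cong (u ,_) (element-rank (below G u) v e))

  edge-injective : ∀ {k l} → edge k ≡ edge l → k ≡ l
  edge-injective {k} {l} e = pair-element-injective (λ u → countFin (below G u)) (slots _ _ e)
    where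
    slots : (p q : Σ (Fin n) λ u → Fin (countFin (below G u))) →
            (proj₁ p , element (below G (proj₁ p)) (proj₂ p)) ≡ (proj₁ q , element (below G (proj₁ q)) (proj₂ q)) → p ≡ q
    slots (u , i) (u′ , j) e with cong proj₁ e
    ... | refl = cong (u ,_) (element-injective (below G u) (cong proj₂ e))

  handshake : sumFin (degree G) ≡ edgeCount G + edgeCount G
  handshake = begin
    sumFin (degree G)
      ≡⟨ sum² (adj G) ⟩
    ℕΣ.sum (λ u → ℕΣ.sum λ v → ⟦ adj G u v ⟧)
      ≡⟨ ℕΣ.sum-cong-≗ (λ u → ℕΣ.sum-cong-≗ (split u)) ⟩
    ℕΣ.sum (λ u → ℕΣ.sum λ v → ⟦ below G u v ⟧ + ⟦ below G v u ⟧)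
      ≡⟨ ℕΣ.sum-cong-≗ (λ u → ℕΣ.∑-distrib-+ _ (λ v → ⟦ below G v u ⟧)) ⟩
    ℕΣ.sum (λ u → ℕΣ.sum (λ v → ⟦ below G u v ⟧) + ℕΣ.sum (λ v → ⟦ below G v u ⟧))
      ≡⟨ ℕΣ.∑-distrib-+ (λ u → ℕΣ.sum (λ v → ⟦ below G u v ⟧)) _ ⟩
    ℕΣ.sum (λ u → ℕΣ.sum λ v → ⟦ below G u v ⟧) + ℕΣ.sum (λ u → ℕΣ.sum λ v → ⟦ below G v u ⟧)
      ≡⟨ cong₂ _+_ refl (ℕΣ.∑-comm (λ u v → ⟦ below G v u ⟧)) ⟩
    ℕΣ.sum (λ u → ℕΣ.sum λ v → ⟦ below G u v ⟧) + ℕΣ.sum (λ v → ℕΣ.sum λ u → ⟦ below G v u ⟧)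
      ≡⟨ cong₂ _+_ (sum² (below G)) (sum² (below G)) ⟨
    edgeCount G + edgeCount G ∎
    where
    open ≡-Reasoning
    ⟦_⟧ : Bool → ℕ
    ⟦ b ⟧ = if b then 1 else 0
    sum² : (P : Fin n → Fin n → Bool) → sumFin (λ u → countFin (P u)) ≡ ℕΣ.sum (λ u → ℕΣ.sum λ v → ⟦ P u v ⟧)
    sum² P = trans (sumFin≡sum (λ u → countFin (P u))) (ℕΣ.sum-cong-≗ (λ u → countFin≡sum (P u)))
    split : ∀ u v → ⟦ adj G u v ⟧ ≡ ⟦ below G u v ⟧ + ⟦ below G v u ⟧
    split u v with ℕ.<-cmp (toℕ u) (toℕ v)
    ... | tri< u<v _ v≮u rewrite <⇒<ᵇ≡true u<v | ≮⇒<ᵇ≡false v≮u | ∧-zeroʳ (adj G v u) | Bool.∧-identityʳ (adj G u v) =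
      ≡-sym (ℕ.+-identityʳ _)
    ... | tri> u≮v _ v<u rewrite <⇒<ᵇ≡true v<u | ≮⇒<ᵇ≡false u≮v | ∧-zeroʳ (adj G u v) | Bool.∧-identityʳ (adj G v u) =
      cong ⟦_⟧ (sym G u v)
    ... | tri≈ u≮v u≡v v≮u rewrite ≮⇒<ᵇ≡false u≮v | ≮⇒<ᵇ≡false v≮u | ∧-zeroʳ (adj G u v) | ∧-zeroʳ (adj G v u) | Fin.toℕ-injective u≡v =
      cong ⟦_⟧ (irrefl G v)

  cubic-edgeCount : Cubic G → edgeCount G + edgeCount G ≡ 3 * n
  cubic-edgeCount cubic = trans (≡-sym handshake) (trans (constant cubic) (ℕ.*-comm n 3))
    where
    constant : ∀ {m} {f : Fin m → ℕ} → (∀ i → f i ≡ 3) → sumFin f ≡ m * 3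
    constant {zero} e = refl
    constant {suc m} e = cong₂ _+_ (e zero) (constant (e ∘ suc))

  SameEdge : Fin n → Fin n → Fin n → Fin n → Set
  SameEdge p q u v = (p ≡ u × q ≡ v) ⊎ (p ≡ v × q ≡ u)

  SameEdge-sym : ∀ {p q u v} → SameEdge p q u v → SameEdge u v p q
  SameEdge-sym (inj₁ (refl , refl)) = inj₁ (refl , refl)
  SameEdge-sym (inj₂ (refl , refl)) = inj₂ (refl , refl)

  SameEdge-flip : ∀ {p q u v} → SameEdge p q u v → SameEdge q p u v
  SameEdge-flip (inj₁ (refl , refl)) = inj₂ (refl , refl)
  SameEdge-flip (inj₂ (refl , refl)) = inj₁ (refl , refl)

  SameEdge-flipʳ : ∀ {p q u v} → SameEdge p q u v → SameEdge p q v u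
  SameEdge-flipʳ (inj₁ (refl , refl)) = inj₂ (refl , refl)
  SameEdge-flipʳ (inj₂ (refl , refl)) = inj₁ (refl , refl)

  SameEdge? : ∀ p q u v → Dec (SameEdge p q u v)
  SameEdge? p q u v = (p ≟ u ×-dec q ≟ v) ⊎-dec (p ≟ v ×-dec q ≟ u)

-- Cyclic orders of three neighbours

module Rotation {n} {G : Graph n} (cubic : Cubic G) where

  slot : ∀ v u → adj G v u ≡ true → Fin 3
  slot v u p = subst Fin (cubic v) (rank (adj G v) u p)

  nbr : Fin n → Fin 3 → Fin n
  nbr v i = element (adj G v) (subst Fin (≡-sym (cubic v)) i)

  nbr-adj : ∀ v i → adj G v (nbr v i) ≡ true
  nbr-adj v i = element-sat (adj G v) _

  nbr-slot : ∀ v u p → nbr v (slot v u p) ≡ u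
  nbr-slot v u p = trans (cong (element (adj G v)) (≡.subst-sym-subst (cubic v))) (element-rank (adj G v) u p)

  nbr-injective : ∀ v {i j} → nbr v i ≡ nbr v j → i ≡ j
  nbr-injective v e = trans (≡-sym (≡.subst-subst-sym (cubic v)))
    (trans (cong (subst Fin (cubic v)) (element-injective (adj G v) e)) (≡.subst-subst-sym (cubic v)))

  slot-injective : ∀ {v u w p q} → slot v u p ≡ slot v w q → u ≡ w
  slot-injective {v} {u} {w} {p} {q} e = trans (≡-sym (nbr-slot v u p)) (trans (cong (nbr v) e) (nbr-slot v w q))

  module _ (σ : Scheme G) {v u} (vu : adj G v u ≡ true) where
    private
      r = rot σ v
      vr : adj G v (r u) ≡ true
      vr = rot-adj σ v u vu
      vrr : adj G v (r (r u)) ≡ true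
      vrr = rot-adj σ v (r u) vr

    rot-≢ : r u ≢ u
    rot-≢ fixed = contradiction (nbr-injective v {zero} {suc zero} (trans (all zero) (≡-sym (all (suc zero))))) λ ()
      where
      iter-fixed : ∀ k → iter r k u ≡ u
      iter-fixed zero = refl
      iter-fixed (suc k) = trans (cong r (iter-fixed k)) fixed
      all : ∀ i → nbr v i ≡ u
      all i = let k , e = rot-cyc σ v u (nbr v i) vu (nbr-adj v i) in trans (≡-sym e) (iter-fixed k)

    -- Otherwise the orbit of `u` would have at most two elements, whereas `rot-cyc` makes it reach
    -- all three neighbours. This is also why reversing a rotation always changes it.
    rot²-≢ : r (r u) ≢ u
    rot²-≢ fixed = pick (all zero) (all (suc zero)) (all (suc (suc zero)))
      where
      iter-fixed : ∀ k → iter r k u ≡ u ⊎ iter r k u ≡ r u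
      iter-fixed zero = inj₁ refl
      iter-fixed (suc k) with iter-fixed k
      ... | inj₁ e = inj₂ (cong r e)
      ... | inj₂ e = inj₁ (trans (cong r e) fixed)
      all : ∀ i → nbr v i ≡ u ⊎ nbr v i ≡ r u
      all i with rot-cyc σ v u (nbr v i) vu (nbr-adj v i)
      ... | k , e with iter-fixed k
      ...   | inj₁ f = inj₁ (trans (≡-sym e) f)
      ...   | inj₂ f = inj₂ (trans (≡-sym e) f)
      clash : ∀ {i j x} → i ≢ j → nbr v i ≡ x → nbr v j ≡ x → ⊥
      clash i≢j e f = i≢j (nbr-injective v (trans e (≡-sym f)))
      pick : ∀ {x y} → nbr v zero ≡ x ⊎ nbr v zero ≡ y → nbr v (suc zero) ≡ x ⊎ nbr v (suc zero) ≡ y →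
             nbr v (suc (suc zero)) ≡ x ⊎ nbr v (suc (suc zero)) ≡ y → ⊥
      pick (inj₁ e) (inj₁ f) _ = clash (λ ()) e f
      pick (inj₂ e) (inj₂ f) _ = clash (λ ()) e f
      pick (inj₁ e) (inj₂ f) (inj₁ g) = clash (λ ()) e g
      pick (inj₁ e) (inj₂ f) (inj₂ g) = clash (λ ()) f g
      pick (inj₂ e) (inj₁ f) (inj₁ g) = clash (λ ()) f g
      pick (inj₂ e) (inj₁ f) (inj₂ g) = clash (λ ()) e g

    rot-rot-≢ : r (r u) ≢ r u
    rot-rot-≢ e = rot-≢ (rot-inj σ v (r u) u vr vu e)

    rot-cover : ∀ {w} → adj G v w ≡ true → w ≡ u ⊎ w ≡ r u ⊎ w ≡ r (r u)
    rot-cover {w} vw with four-in-three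
      {slot v u vu} {slot v (r u) vr} {slot v (r (r u)) vrr}
      (λ e → rot-≢ (≡-sym (slot-injective {p = vu} {vr} e)))
      (λ e → rot²-≢ (≡-sym (slot-injective {p = vu} {vrr} e)))
      (λ e → rot-rot-≢ (≡-sym (slot-injective {p = vr} {vrr} e)))
      (slot v w vw)
    ... | inj₁ e = inj₁ (slot-injective {p = vw} {vu} e)
    ... | inj₂ (inj₁ e) = inj₂ (inj₁ (slot-injective {p = vw} {vr} e))
    ... | inj₂ (inj₂ e) = inj₂ (inj₂ (slot-injective {p = vw} {vrr} e))

  module _ (σ : Scheme G) {v u} (vu : adj G v u ≡ true) where
    private
      r = rot σ v
      vr : adj G v (r u) ≡ true
      vr = rot-adj σ v u vu
      vrr : adj G v (r (r u)) ≡ true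
      vrr = rot-adj σ v (r u) vr

    rot³ : r (r (r u)) ≡ u
    rot³ with rot-cover σ vu (rot-adj σ v (r (r u)) vrr)
    ... | inj₁ e = e
    ... | inj₂ (inj₁ e) = contradiction e (rot²-≢ σ vr)
    ... | inj₂ (inj₂ e) = contradiction e (rot-≢ σ vrr)

  -- Three neighbours admit only two cyclic orders.
  module _ (σ τ : Scheme G) {v u} (vu : adj G v u ≡ true) where

    rot-agree : rot σ v u ≡ rot τ v u → ∀ {w} → adj G v w ≡ true → rot σ v w ≡ rot τ v w
    rot-agree e vw with rot-cover σ vu vw
    ... | inj₁ refl = e
    ... | inj₂ (inj₁ refl) = agree²
      where
      τe : rot τ v (rot σ v u) ≡ rot τ v (rot τ v u)
      τe = cong (rot τ v) e
      agree² : rot σ v (rot σ v u) ≡ rot τ v (rot σ v u)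
      agree² with rot-cover τ vu (rot-adj σ v _ (rot-adj σ v u vu))
      ... | inj₁ f = contradiction f (rot²-≢ σ vu)
      ... | inj₂ (inj₁ f) = contradiction (trans f (≡-sym e)) (rot-rot-≢ σ vu)
      ... | inj₂ (inj₂ f) = trans f (≡-sym τe)
    ... | inj₂ (inj₂ refl) = agree³
      where
      agree³ : rot σ v (rot σ v (rot σ v u)) ≡ rot τ v (rot σ v (rot σ v u))
      agree³ with rot-cover τ vu (rot-adj σ v _ (rot-adj σ v u vu))
      ... | inj₁ f = contradiction f (rot²-≢ σ vu)
      ... | inj₂ (inj₁ f) = contradiction (trans f (≡-sym e)) (rot-rot-≢ σ vu)
      ... | inj₂ (inj₂ f) = trans (rot³ σ vu) (trans (≡-sym (rot³ τ vu)) (cong (rot τ v) (≡-sym f)))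

    rot-reverse : rot σ v u ≢ rot τ v u → ∀ {w} → adj G v w ≡ true → rot τ v (rot σ v w) ≡ w
    rot-reverse d vw with rot-cover τ vu (rot-adj σ v u vu)
    ... | inj₁ f = contradiction f (rot-≢ σ vu)
    ... | inj₂ (inj₁ f) = contradiction f d
    ... | inj₂ (inj₂ f) = back vw
      where
      τσu : rot τ v (rot σ v u) ≡ u
      τσu = trans (cong (rot τ v) f) (rot³ τ vu)
      σσu : rot σ v (rot σ v u) ≡ rot τ v u
      σσu with rot-cover τ vu (rot-adj σ v _ (rot-adj σ v u vu))
      ... | inj₁ g = contradiction g (rot²-≢ σ vu)
      ... | inj₂ (inj₁ g) = g
      ... | inj₂ (inj₂ g) = contradiction (trans g (≡-sym f)) (rot-rot-≢ σ vu)
      back : ∀ {w} → adj G v w ≡ true → rot τ v (rot σ v w) ≡ w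
      back vw with rot-cover σ vu vw
      ... | inj₁ refl = τσu
      ... | inj₂ (inj₁ refl) = trans (cong (rot τ v) σσu) (≡-sym f)
      ... | inj₂ (inj₂ refl) = trans (cong (rot τ v) (rot³ σ vu)) (≡-sym σσu)

-- Edge cuts in a 3-connected cubic graph

module Connectivity {n} {G : Graph n} (conn : KConnected 3 G) (cubic : Cubic G) (σ : Scheme G) where
  open Rotation {G = G} cubic

  walk : ∀ u w → WalkAvoiding G (λ _ → false) u w
  walk u w = proj₂ conn (λ _ → false) (subst (_< 3) (≡-sym (countFin-none {n} (λ _ → refl))) (s≤s z≤n)) u w refl refl

  constant : (ψ : Fin n → Bool) → (∀ u v → adj G u v ≡ true → ψ u ≡ ψ v) → ∀ u w → ψ u ≡ ψ w
  constant ψ flat u w = along (walk u w)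
    where
    along : ∀ {X u w} → WalkAvoiding G X u w → ψ u ≡ ψ w
    along here = refl
    along (step {u} {v} a _ rest) = trans (flat u v a) (along rest)

  change : (ψ : Fin n → Bool) → ∀ {u w} → ψ u ≢ ψ w → ∃₂ λ p q → adj G p q ≡ true × ψ p ≢ ψ q
  change ψ {u} {w} = along (walk u w)
    where
    along : ∀ {X u w} → WalkAvoiding G X u w → ψ u ≢ ψ w → ∃₂ λ p q → adj G p q ≡ true × ψ p ≢ ψ q
    along here d = contradiction refl d
    along (step {u} {v} a _ rest) d with ψ u Bool.≟ ψ v
    ... | yes e = along rest (d ∘ trans e)
    ... | no ne = u , v , a , ne

  other-nbr : ∀ {w u} → adj G w u ≡ true → ∀ z → ∃ λ t → adj G w t ≡ true × t ≢ u × t ≢ z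
  other-nbr {w} {u} wu z with rot σ w u ≟ z
  ... | no ne = _ , rot-adj σ w u wu , rot-≢ σ wu , ne
  ... | yes e = _ , rot-adj σ w _ (rot-adj σ w u wu) , rot²-≢ σ wu , λ f → rot-rot-≢ σ wu (trans f (≡-sym e))

  private
    -- Deleting the ends w and w′ of the two cut edges leaves a vertex on each side.
    no-cut : (ψ : Fin n → Bool) → ∀ {u w u′ w′} → adj G u w ≡ true →
             ψ u ≡ false → ψ w ≡ true → ψ u′ ≡ false → ψ w′ ≡ true →
             (∀ a b → adj G a b ≡ true → ψ a ≢ ψ b → SameEdge G a b u w ⊎ SameEdge G a b u′ w′) → ⊥
    no-cut ψ {u} {w} {u′} {w′} uw ψu ψw ψu′ ψw′ only = absurd
      where
      wu : adj G w u ≡ true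
      wu = trans (sym G w u) uw
      clash : ∀ {x} → ψ x ≡ false → ψ x ≡ true → ⊥
      clash e f = true≢false (trans (≡-sym f) e)
      X : Fin n → Bool
      X x = (x == w) ∨ (x == w′)
      X-here : ∀ {x} → x ≡ w ⊎ x ≡ w′ → X x ≡ true
      X-here {x} (inj₁ e) rewrite ==-≡ e = refl
      X-here {x} (inj₂ e) rewrite ==-≡ e = Bool.∨-zeroʳ _
      X-away : ∀ {x} → x ≢ w → x ≢ w′ → X x ≡ false
      X-away p q rewrite ==-≢ p | ==-≢ q = refl
      small : countFin X < 3
      small = s≤s (countFin-≤ X g inj)
        where
        g : Fin n → Fin 2
        g x = if x == w then zero else suc zero
        inj : ∀ i j → X i ≡ true → X j ≡ true → g i ≡ g j → i ≡ j
        inj i j Xi Xj e with i ≟ w | j ≟ w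
        ... | yes refl | yes refl = refl
        ... | no _ | no _ = trans (==⇒≡ Xi) (≡-sym (==⇒≡ Xj))
        inj i j Xi Xj () | yes _ | no _
        inj i j Xi Xj () | no _ | yes _
      -- A third vertex `t` adjacent to `w` must lie on the side of `w` and outside `X`. If `w′`
      -- differs from `w`, it has to avoid `w′`; if they coincide, both cut edges end at `w` and it
      -- has to avoid `u′`. In either case degree 3 leaves a neighbour of `w` other than `u` and
      -- `z`.
      z : Fin n
      z = if w == w′ then u′ else w′
      goal : ∃ λ t → adj G w t ≡ true × t ≢ u × t ≢ z
      goal = other-nbr wu z
      t = proj₁ goal
      wt = proj₁ (proj₂ goal)
      t≢u = proj₁ (proj₂ (proj₂ goal))
      t≢z = proj₂ (proj₂ (proj₂ goal))
      t≢w : t ≢ w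
      t≢w t≡w = true≢false (trans (≡-sym wt) (trans (cong (adj G w) t≡w) (irrefl G w)))
      z-equal : w ≡ w′ → z ≡ u′
      z-equal e rewrite ==-≡ e = refl
      z-distinct : w ≢ w′ → z ≡ w′
      z-distinct ne rewrite ==-≢ ne = refl
      t≢w′ : t ≢ w′
      t≢w′ e = t≢z (trans e (≡-sym (z-distinct (λ w≡w′ → t≢w (trans e (≡-sym w≡w′))))))
      t≢u′ : w ≡ w′ → t ≢ u′
      t≢u′ e f = t≢z (trans f (≡-sym (z-equal e)))
      ψt : ψ t ≡ true
      ψt with ψ t in eq
      ... | true = refl
      ... | false with only w t wt (λ e → clash eq (trans (≡-sym e) ψw))
      ...   | inj₁ (inj₁ (e , _)) = ⊥-elim (clash ψu (trans (cong ψ (≡-sym e)) ψw))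
      ...   | inj₁ (inj₂ (_ , e)) = ⊥-elim (t≢u e)
      ...   | inj₂ (inj₁ (e , _)) = ⊥-elim (clash ψu′ (trans (cong ψ (≡-sym e)) ψw))
      ...   | inj₂ (inj₂ (e , f)) = ⊥-elim (t≢u′ e f)
      -- Every cut edge has its true end in `X`, so a walk avoiding `X` cannot leave the side of
      -- `u`.
      stay : ∀ {a b} → X a ≡ false → ψ a ≡ false → WalkAvoiding G X a b → ψ b ≡ false
      stay _ ψa here = ψa
      stay {a} Xa ψa (step {v = v} av Xv rest) with ψ v in eq
      ... | false = stay Xv eq rest
      ... | true = ⊥-elim (true≢false (trans (≡-sym hit) (cong₂ _∨_ Xa Xv)))
        where
        hit : X a ∨ X v ≡ true
        hit with only a v av (λ e → clash ψa (trans e eq))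
        ... | inj₁ (inj₁ (_ , e)) = trans (cong (X a ∨_) (X-here (inj₁ e))) (Bool.∨-zeroʳ _)
        ... | inj₁ (inj₂ (e , _)) = cong (_∨ X v) (X-here (inj₁ e))
        ... | inj₂ (inj₁ (_ , e)) = trans (cong (X a ∨_) (X-here (inj₂ e))) (Bool.∨-zeroʳ _)
        ... | inj₂ (inj₂ (e , _)) = cong (_∨ X v) (X-here (inj₂ e))
      absurd : ⊥
      absurd = clash (stay u-away ψu (proj₂ conn X small u t u-away (X-away t≢w t≢w′))) ψt
        where
        u-away : X u ≡ false
        u-away = X-away (λ e → clash ψu (trans (cong ψ e) ψw)) (λ e → clash ψu (trans (cong ψ e) ψw′))

  -- The two edges may coincide, so bridges are excluded together with cuts of two edges. The cases
  -- merely orient both edges from the false side to the true side.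
  no-small-cut : (ψ : Fin n → Bool) → ∀ {u w u′ w′} → adj G u w ≡ true → ψ u ≢ ψ w → ψ u′ ≢ ψ w′ →
                 (∀ a b → adj G a b ≡ true → ψ a ≢ ψ b → SameEdge G a b u w ⊎ SameEdge G a b u′ w′) → ⊥
  no-small-cut ψ {u} {w} {u′} {w′} uw d d′ only with ψ u in e₁ | ψ w in e₂ | ψ u′ in e₃ | ψ w′ in e₄
  ... | true | true | _ | _ = d refl
  ... | false | false | _ | _ = d refl
  ... | _ | _ | true | true = d′ refl
  ... | _ | _ | false | false = d′ refl
  ... | false | true | false | true = no-cut ψ uw e₁ e₂ e₃ e₄ only
  ... | false | true | true | false = no-cut ψ uw e₁ e₂ e₄ e₃ λ a b ab ne → Sum.map₂ (SameEdge-flipʳ G) (only a b ab ne)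
  ... | true | false | false | true = no-cut ψ (trans (sym G w u) uw) e₂ e₁ e₃ e₄ λ a b ab ne → Sum.map₁ (SameEdge-flipʳ G) (only a b ab ne)
  ... | true | false | true | false = no-cut ψ (trans (sym G w u) uw) e₂ e₁ e₄ e₃ λ a b ab ne → Sum.map (SameEdge-flipʳ G) (SameEdge-flipʳ G) (only a b ab ne)

-- Chains over F₂, face colourings and their boundaries

sum-∧ : ∀ {m} b (f : Fin m → Bool) → sum (λ i → b ∧ f i) ≡ b ∧ sum f
sum-∧ b f = ≡-sym (*-distribˡ-sum b f)

∧-exchange : ∀ a b c → a ∧ (b ∧ c) ≡ b ∧ (a ∧ c)
∧-exchange true b c = refl
∧-exchange false b c = ≡-sym (∧-zeroʳ b)

module Chains {n} {G : Graph n} (conn : KConnected 3 G) (cubic : Cubic G) (σ₀ : Scheme G) where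
  open Rotation {G = G} cubic public
  open Connectivity {G = G} conn cubic σ₀ public

  -- Edge sets as functions of ordered pairs. Only values at adjacent pairs carry meaning, which is
  -- why `∂` masks with `adj` and `Cycle` asks for symmetry on edges only.
  EdgeFn : Set
  EdgeFn = Fin n → Fin n → Bool

  root : Fin n
  root = Fin.fromℕ< (ℕ.≤-<-trans z≤n (proj₁ conn))

  _⊕_ : EdgeFn → EdgeFn → EdgeFn
  (y ⊕ z) u v = y u v xor z u v

  d : (Fin n → Bool) → EdgeFn
  d ψ u v = ψ u xor ψ v

  ∂ : EdgeFn → Fin n → Bool
  ∂ z w = sum λ u → adj G w u ∧ z w u

  record Cycle (z : EdgeFn) : Set where
    constructor cycle
    field
      balanced : ∀ w → ∂ z w ≡ false
      even : ∀ u v → adj G u v ≡ true → z u v ≡ z v u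
  open Cycle public

  adj-flip : ∀ {u v} → adj G u v ≡ true → adj G v u ≡ true
  adj-flip {u} {v} a = trans (sym G v u) a

  ∂-⊕ : ∀ y z w → ∂ (y ⊕ z) w ≡ ∂ y w xor ∂ z w
  ∂-⊕ y z w = trans (sum-cong-≗ (λ u → ∧-distribˡ-xor (adj G w u) (y w u) (z w u)))
                    (∑-distrib-+ (λ u → adj G w u ∧ y w u) (λ u → adj G w u ∧ z w u))

  ∂-sum : ∀ {m} (t : Fin m → Bool) (D : Fin m → EdgeFn) w →
          ∂ (λ u v → sum λ j → t j ∧ D j u v) w ≡ sum λ j → t j ∧ ∂ (D j) w
  ∂-sum t D w = begin
    (sum λ u → adj G w u ∧ sum λ j → t j ∧ D j w u)
      ≡⟨ sum-cong-≗ (λ u → ≡-sym (sum-∧ (adj G w u) (λ j → t j ∧ D j w u))) ⟩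
    (sum λ u → sum λ j → adj G w u ∧ (t j ∧ D j w u))
      ≡⟨ ∑-comm (λ u j → adj G w u ∧ (t j ∧ D j w u)) ⟩
    (sum λ j → sum λ u → adj G w u ∧ (t j ∧ D j w u))
      ≡⟨ sum-cong-≗ (λ j → trans (sum-cong-≗ (λ u → ∧-exchange (adj G w u) (t j) (D j w u))) (sum-∧ (t j) (λ u → adj G w u ∧ D j w u))) ⟩
    (sum λ j → t j ∧ ∂ (D j) w) ∎
    where open ≡-Reasoning

  δ : Fin n → Fin n → EdgeFn
  δ p q u v = ((p == u) ∧ (v == q)) xor ((q == u) ∧ (v == p))

  δ-even : ∀ p q u v → δ p q u v ≡ δ p q v u
  δ-even p q u v rewrite ==-sym p v | ==-sym q v | ==-sym u q | ==-sym u p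
                       | Bool.∧-comm (v == p) (q == u) | Bool.∧-comm (v == q) (p == u) = xor-comm ((p == u) ∧ (v == q)) _

  ∂-δ : ∀ {p q} → adj G p q ≡ true → ∀ w → ∂ (δ p q) w ≡ (p == w) xor (q == w)
  ∂-δ {p} {q} pq w = begin
    sum (λ u → adj G w u ∧ (((p == w) ∧ (u == q)) xor ((q == w) ∧ (u == p))))
      ≡⟨ sum-cong-≗ (λ u → trans (∧-distribˡ-xor (adj G w u) ((p == w) ∧ (u == q)) ((q == w) ∧ (u == p)))
            (cong₂ _xor_ (∧-exchange (adj G w u) (p == w) (u == q)) (∧-exchange (adj G w u) (q == w) (u == p)))) ⟩
    sum (λ u → ((p == w) ∧ (adj G w u ∧ (u == q))) xor ((q == w) ∧ (adj G w u ∧ (u == p))))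
      ≡⟨ ∑-distrib-+ (λ u → (p == w) ∧ (adj G w u ∧ (u == q))) _ ⟩
    sum (λ u → (p == w) ∧ (adj G w u ∧ (u == q))) xor sum (λ u → (q == w) ∧ (adj G w u ∧ (u == p)))
      ≡⟨ cong₂ _xor_ (end p q pq) (end q p (adj-flip pq)) ⟩
    (p == w) xor (q == w) ∎
    where
    open ≡-Reasoning
    end : ∀ p q → adj G p q ≡ true → sum (λ u → (p == w) ∧ (adj G w u ∧ (u == q))) ≡ (p == w)
    end p q pq = trans (trans (sum-∧ (p == w) (λ u → adj G w u ∧ (u == q))) (cong ((p == w) ∧_) (sum-== q (adj G w)))) at
      where
      at : (p == w) ∧ adj G w q ≡ (p == w)
      at with p ≟ w
      ... | yes refl = pq
      ... | no _ = refl

  δ-sound : ∀ {p q u v} → δ p q u v ≡ true → SameEdge G u v p q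
  δ-sound {p} {q} {u} {v} e with p ≟ u | v ≟ q
  ... | yes p≡u | yes v≡q = inj₁ (≡-sym p≡u , v≡q)
  ... | yes p≡u | no _ = inj₂ (let a , b = ∧≡true {q == u} e in ≡-sym (==⇒≡ a) , ==⇒≡ b)
  ... | no _ | _ = inj₂ (let a , b = ∧≡true {q == u} e in ≡-sym (==⇒≡ a) , ==⇒≡ b)

  adj-≢ : ∀ {u v} → adj G u v ≡ true → u ≢ v
  adj-≢ {u} a refl = true≢false (trans (≡-sym a) (irrefl G u))

  δ-complete : ∀ {p q u v} → adj G u v ≡ true → SameEdge G u v p q → δ p q u v ≡ true
  δ-complete {p} {q} pq (inj₁ (refl , refl)) rewrite ==-refl p | ==-refl q | ==-≢ {i = q} {p} (adj-≢ pq ∘ ≡-sym) = refl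
  δ-complete {p} {q} qp (inj₂ (refl , refl)) rewrite ==-refl p | ==-refl q | ==-≢ {i = p} {q} (adj-≢ qp ∘ ≡-sym) = refl

  δ-miss : ∀ {p q u v} → ¬ SameEdge G u v p q → δ p q u v ≡ false
  δ-miss ne = ¬-not (ne ∘ δ-sound)

  path : ∀ {X u w} → WalkAvoiding G X u w → EdgeFn
  path here = λ _ _ → false
  path (step {u} {v} _ _ rest) = δ u v ⊕ path rest

  ∂-path : ∀ {X u w} (p : WalkAvoiding G X u w) x → ∂ (path p) x ≡ (u == x) xor (w == x)
  ∂-path (here {u}) x = trans (sum-false (λ y → ∧-zeroʳ (adj G x y))) (≡-sym (xor-same (u == x)))
  ∂-path (step {u} {v} {w} uv _ rest) x = begin
    ∂ (δ u v ⊕ path rest) x                              ≡⟨ ∂-⊕ (δ u v) (path rest) x ⟩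
    ∂ (δ u v) x xor ∂ (path rest) x                      ≡⟨ cong₂ _xor_ (∂-δ uv x) (∂-path rest x) ⟩
    ((u == x) xor (v == x)) xor ((v == x) xor (w == x))  ≡⟨ telescope (u == x) (v == x) (w == x) ⟩
    (u == x) xor (w == x)                                ∎
    where
    open ≡-Reasoning
    telescope : ∀ a b c → (a xor b) xor (b xor c) ≡ a xor c
    telescope a b c = trans (xor-assoc a b (b xor c)) (cong (a xor_) (trans (≡-sym (xor-assoc b b c)) (cong (_xor c) (xor-same b))))

  path-even : ∀ {X u w} (p : WalkAvoiding G X u w) x y → path p x y ≡ path p y x
  path-even here x y = refl
  path-even (step {u} {v} _ _ rest) x y = cong₂ _xor_ (δ-even u v x y) (path-even rest x y)

  -- A chain with boundary `root` + `v`. Away from the root these boundaries are independent, so the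
  -- chains span a complement of the cycle space.
  π : Fin n → EdgeFn
  π v = path (walk root v)

  sum-nbrs : ∀ {v u} → adj G v u ≡ true → (h : Fin n → Bool) →
             sum (λ w → adj G v w ∧ h w) ≡ h u xor (h (rot σ₀ v u) xor h (rot σ₀ v (rot σ₀ v u)))
  sum-nbrs {v} {u} vu h = begin
    sum (λ w → adj G v w ∧ h w)
      ≡⟨ sum-cong-≗ split ⟩
    sum (λ w → (h w ∧ (w == u)) xor ((h w ∧ (w == u₁)) xor (h w ∧ (w == u₂))))
      ≡⟨ ∑-distrib-+ (λ w → h w ∧ (w == u)) _ ⟩
    sum (λ w → h w ∧ (w == u)) xor sum (λ w → (h w ∧ (w == u₁)) xor (h w ∧ (w == u₂)))
      ≡⟨ cong₂ _xor_ (sum-== u h) (trans (∑-distrib-+ (λ w → h w ∧ (w == u₁)) _) (cong₂ _xor_ (sum-== u₁ h) (sum-== u₂ h))) ⟩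
    h u xor (h u₁ xor h u₂) ∎
    where
    open ≡-Reasoning
    u₁ = rot σ₀ v u
    u₂ = rot σ₀ v u₁
    vu₁ : adj G v u₁ ≡ true
    vu₁ = rot-adj σ₀ v u vu
    vu₂ : adj G v u₂ ≡ true
    vu₂ = rot-adj σ₀ v u₁ vu₁
    split : ∀ w → adj G v w ∧ h w ≡ (h w ∧ (w == u)) xor ((h w ∧ (w == u₁)) xor (h w ∧ (w == u₂)))
    split w with adj G v w in a
    ... | false rewrite ==-≢ {i = w} {u} (λ { refl → true≢false (trans (≡-sym vu) a) })
                      | ==-≢ {i = w} {u₁} (λ { refl → true≢false (trans (≡-sym vu₁) a) })
                      | ==-≢ {i = w} {u₂} (λ { refl → true≢false (trans (≡-sym vu₂) a) })
                      | ∧-zeroʳ (h w) = refl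
    ... | true with rot-cover σ₀ vu a
    ...   | inj₁ refl rewrite ==-refl w | ==-≢ {i = w} {u₁} (rot-≢ σ₀ vu ∘ ≡-sym) | ==-≢ {i = w} {u₂} (rot²-≢ σ₀ vu ∘ ≡-sym)
                            | ∧-zeroʳ (h w) | Bool.∧-identityʳ (h w) = ≡-sym (xor-identityʳ (h w))
    ...   | inj₂ (inj₁ refl) rewrite ==-refl w | ==-≢ {i = w} {u} (rot-≢ σ₀ vu) | ==-≢ {i = w} {u₂} (rot-rot-≢ σ₀ vu ∘ ≡-sym)
                            | ∧-zeroʳ (h w) | Bool.∧-identityʳ (h w) = ≡-sym (xor-identityʳ (h w))
    ...   | inj₂ (inj₂ refl) rewrite ==-refl w | ==-≢ {i = w} {u} (rot²-≢ σ₀ vu) | ==-≢ {i = w} {u₁} (rot-rot-≢ σ₀ vu)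
                            | ∧-zeroʳ (h w) | Bool.∧-identityʳ (h w) = refl

  -- Face classes of the embedding with the rotations of σ₀ and twisted edge set A.
  record Colouring (A : EdgeFn) (F : ℕ) : Set where
    field
      col : Fin n → Fin n → Bool → Fin F
      corner : ∀ v u → adj G v u ≡ true → col v u true ≡ col v (rot σ₀ v u) false
      cross : ∀ v u s → adj G v u ≡ true → col u v (if A v u then s else not s) ≡ col v u s
      onto : ∀ i → ∃ λ v → ∃ λ u → ∃ λ s → adj G v u ≡ true × col v u s ≡ i
  open Colouring public

  -- The corner and edge conditions link the six flags at a cubic vertex into one ring, so `ω`
  -- descends to a function of vertices.
  potential : (ω : Fin n → Fin n → Bool → Bool) →
              (∀ v u → adj G v u ≡ true → ω v u true ≡ ω v (rot σ₀ v u) false) →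
              (∀ v u → adj G v u ≡ true → ω v u true ≡ ω v u false) →
              ∃ λ ψ → ∀ v u s → adj G v u ≡ true → ω v u s ≡ ψ v
  potential ω turn level = (λ v → ω v (nbr v zero) true) , same
    where
    next : ∀ {v u} → adj G v u ≡ true → ω v (rot σ₀ v u) true ≡ ω v u true
    next {v} {u} vu = trans (level v _ (rot-adj σ₀ v u vu)) (≡-sym (turn v u vu))
    from : ∀ {v a u} → adj G v a ≡ true → adj G v u ≡ true → ω v u true ≡ ω v a true
    from {v} {a} va vu with rot-cover σ₀ va vu
    ... | inj₁ refl = refl
    ... | inj₂ (inj₁ refl) = next va
    ... | inj₂ (inj₂ refl) = trans (next (rot-adj σ₀ v a va)) (next va)
    same : ∀ v u s → adj G v u ≡ true → ω v u s ≡ ω v (nbr v zero) true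
    same v u true vu = from (nbr-adj v zero) vu
    same v u false vu = trans (≡-sym (level v u vu)) (from (nbr-adj v zero) vu)

  module _ {A F} (c : Colouring A F) where

    jump : (Fin F → Bool) → EdgeFn
    jump Φ u v = Φ (col c u v true) xor Φ (col c u v false)

    jump-even : ∀ Φ u v → adj G u v ≡ true → jump Φ u v ≡ jump Φ v u
    jump-even Φ u v uv with A u v | cross c u v true uv | cross c u v false uv
    ... | true | e | f = cong₂ (λ i j → Φ i xor Φ j) (≡-sym e) (≡-sym f)
    ... | false | e | f = trans (cong₂ (λ i j → Φ i xor Φ j) (≡-sym e) (≡-sym f)) (xor-comm (Φ (col c v u false)) (Φ (col c v u true)))

    -- The six edge sides around a vertex pair up at its three corners, where the colours agree, so
    -- they cancel.
    jump-cycle : ∀ Φ → Cycle (jump Φ)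
    jump-cycle Φ = cycle zero-sum (jump-even Φ)
      where
      zero-sum : ∀ w → ∂ (jump Φ) w ≡ false
      zero-sum w = trans (sum-nbrs wu (jump Φ w)) (around _ _ _ _ _ _ turn₁ turn₂ turn₃)
        where
        u = nbr w zero
        wu = nbr-adj w zero
        r = rot σ₀ w
        turn₁ : Φ (col c w u true) ≡ Φ (col c w (r u) false)
        turn₁ = cong Φ (corner c w u wu)
        turn₂ : Φ (col c w (r u) true) ≡ Φ (col c w (r (r u)) false)
        turn₂ = cong Φ (corner c w (r u) (rot-adj σ₀ w u wu))
        turn₃ : Φ (col c w (r (r u)) true) ≡ Φ (col c w u false)
        turn₃ = cong Φ (trans (corner c w (r (r u)) (rot-adj σ₀ w _ (rot-adj σ₀ w u wu))) (cong (λ x → col c w x false) (rot³ σ₀ wu)))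
        around : ∀ a₁ b₁ a₂ b₂ a₃ b₃ → a₁ ≡ b₂ → a₂ ≡ b₃ → a₃ ≡ b₁ → (a₁ xor b₁) xor ((a₂ xor b₂) xor (a₃ xor b₃)) ≡ false
        around true true true .true .true true refl refl refl = refl
        around true true false .true .true false refl refl refl = refl
        around true false true .true .false true refl refl refl = refl
        around true false false .true .false false refl refl refl = refl
        around false true true .false .true true refl refl refl = refl
        around false true false .false .true false refl refl refl = refl
        around false false true .false .false true refl refl refl = refl
        around false false false .false .false false refl refl refl = refl

    base : Fin F
    base = col c root (nbr root zero) true

    -- With no jump, `Φ` depends only on the vertex by `potential`, and `cross` makes it equal at
    -- adjacent vertices. Connectivity leaves only the constant sets, and the value at `base`
    -- selects the empty one.
    jump-kernel : ∀ Φ → (∀ u v → adj G u v ≡ true → jump Φ u v ≡ false) → Φ base ≡ false → ∀ i → Φ i ≡ false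
    jump-kernel Φ flat at-base i
      with ψ , same ← potential (λ v u s → Φ (col c v u s)) (λ v u vu → cong Φ (corner c v u vu)) (λ v u vu → xor≡false⇒≡ (flat v u vu))
         | v , u , s , vu , refl ← onto c i
      = trans (same v u s vu) (trans (constant ψ agree v root) (trans (≡-sym (same root (nbr root zero) true (nbr-adj root zero))) at-base))
      where
      agree : ∀ u v → adj G u v ≡ true → ψ u ≡ ψ v
      agree u v uv = trans (≡-sym (same u v true uv)) (trans (cong Φ (≡-sym (cross c u v true uv))) (same v u _ (adj-flip uv)))

    -- Each subset Φ of faces contributes the boundary jump Φ, each vertex w a path π w from the root, and these
    -- are independent up to the normalisations at the base face and the root; so with enough extra
    -- cycles D j, some combination of the latter is a boundary.
    boundary-combination : ∀ {m} (D : Fin m → EdgeFn) → (∀ j → Cycle (D j)) → edgeCount G + 2 < F + (m + n) →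
      ∃₂ λ t Φ → (∃ λ j → t j ≡ true) × ∀ u v → adj G u v ≡ true → jump Φ u v ≡ sum λ j → t j ∧ D j u v
    boundary-combination {m} D D-cycle small = conclude (kernel f f-add small)
      where
      Vec : Set
      Vec = Fin (F + (m + n)) → Bool
      Φ : Vec → Fin F → Bool
      Φ x i = x (i ↑ˡ (m + n))
      t : Vec → Fin m → Bool
      t x j = x (F ↑ʳ (j ↑ˡ n))
      ψ : Vec → Fin n → Bool
      ψ x v = x (F ↑ʳ (m ↑ʳ v))
      extra paths total : Vec → EdgeFn
      extra x u v = sum λ j → t x j ∧ D j u v
      paths x u v = sum λ w → ψ x w ∧ π w u v
      total x = jump (Φ x) ⊕ (extra x ⊕ paths x)
      -- The source of the 2 in `edgeCount G + 2`: the set of all faces has no jump, and `π root`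
      -- has no boundary, so these two directions are fixed by hand.
      norm : Vec → Fin 2 → Bool
      norm x zero = Φ x base
      norm x (suc _) = ψ x root
      f : Vec → Fin (edgeCount G + 2) → Bool
      f x k = Sum.[ (λ e → total x (proj₁ (edge G e)) (proj₂ (edge G e))) , norm x ]′ (splitAt (edgeCount G) k)
      combination-add : ∀ {k} (s s′ : Fin k → Bool) (B : Fin k → Bool) →
                        (sum λ j → (s j xor s′ j) ∧ B j) ≡ (sum λ j → s j ∧ B j) xor (sum λ j → s′ j ∧ B j)
      combination-add s s′ B = trans (sum-cong-≗ (λ j → ∧-distribʳ-xor (B j) (s j) (s′ j))) (∑-distrib-+ (λ j → s j ∧ B j) _)
      total-add : ∀ x y u v → total (λ i → x i xor y i) u v ≡ total x u v xor total y u v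
      total-add x y u v = trans
        (cong₂ _xor_ (xor-interchange (Φ x _) (Φ y _) (Φ x _) (Φ y _))
          (trans (cong₂ _xor_ (combination-add (t x) (t y) (λ j → D j u v)) (combination-add (ψ x) (ψ y) (λ w → π w u v)))
                 (xor-interchange (extra x u v) (extra y u v) (paths x u v) (paths y u v))))
        (xor-interchange (jump (Φ x) u v) (jump (Φ y) u v) (extra x u v xor paths x u v) (extra y u v xor paths y u v))
      f-add : ∀ x y k → f (λ i → x i xor y i) k ≡ f x k xor f y k
      f-add x y k with splitAt (edgeCount G) k
      ... | inj₁ e = total-add x y _ _
      ... | inj₂ zero = refl
      ... | inj₂ (suc _) = refl
      conclude : (∃ λ x → (∃ λ i → x i ≡ true) × ∀ k → f x k ≡ false) →
                 ∃₂ λ t Φ → (∃ λ j → t j ≡ true) × ∀ u v → adj G u v ≡ true → jump Φ u v ≡ sum λ j → t j ∧ D j u v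
      conclude (x , (i , xi) , vanish) = answer
        where
        norm≡false : ∀ k → norm x k ≡ false
        norm≡false k = trans (≡-sym (cong Sum.[ (λ e → total x (proj₁ (edge G e)) (proj₂ (edge G e))) , norm x ]′
                                       (Fin.splitAt-↑ʳ (edgeCount G) 2 k))) (vanish (edgeCount G ↑ʳ k))
        on-edge : ∀ k → total x (proj₁ (edge G k)) (proj₂ (edge G k)) ≡ false
        on-edge k = trans (≡-sym (cong Sum.[ (λ e → total x (proj₁ (edge G e)) (proj₂ (edge G e))) , norm x ]′
                                    (Fin.splitAt-↑ˡ (edgeCount G) k 2))) (vanish (k ↑ˡ 2))
        extra-even : ∀ u v → adj G u v ≡ true → extra x u v ≡ extra x v u
        extra-even u v uv = sum-cong-≗ (λ j → cong (t x j ∧_) (even (D-cycle j) u v uv))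
        paths-even : ∀ u v → paths x u v ≡ paths x v u
        paths-even u v = sum-cong-≗ (λ w → cong (ψ x w ∧_) (path-even (walk root w) u v))
        total-even : ∀ u v → adj G u v ≡ true → total x u v ≡ total x v u
        total-even u v uv = cong₂ _xor_ (jump-even (Φ x) u v uv) (cong₂ _xor_ (extra-even u v uv) (paths-even u v))
        on-below : ∀ u v → below G u v ≡ true → total x u v ≡ false
        on-below u v b = let k , e = edge-onto G u v b in
                         trans (≡-sym (cong (λ p → total x (proj₁ p) (proj₂ p)) e)) (on-edge k)
        total≡false : ∀ u v → adj G u v ≡ true → total x u v ≡ false
        total≡false u v uv with below-total G uv
        ... | inj₁ b = on-below u v b
        ... | inj₂ b = trans (total-even u v uv) (on-below v u b)
        -- Jumps and the extra cycles have zero boundary, so away from the root only the path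
        -- coefficient of `w` survives. A vanishing total thus kills all path coefficients.
        ∂-total : ∀ w → ∂ (total x) w ≡ (sum λ v → ψ x v ∧ (root == w)) xor ψ x w
        ∂-total w = begin
          ∂ (total x) w
            ≡⟨ ∂-⊕ (jump (Φ x)) (extra x ⊕ paths x) w ⟩
          ∂ (jump (Φ x)) w xor ∂ (extra x ⊕ paths x) w
            ≡⟨ cong₂ _xor_ (balanced (jump-cycle (Φ x)) w) (∂-⊕ (extra x) (paths x) w) ⟩
          ∂ (extra x) w xor ∂ (paths x) w
            ≡⟨ cong₂ _xor_ (trans (∂-sum (t x) D w) (sum-false (λ j → trans (cong (t x j ∧_) (balanced (D-cycle j) w)) (∧-zeroʳ (t x j)))))
                           (∂-sum (ψ x) π w) ⟩
          (sum λ v → ψ x v ∧ ∂ (π v) w)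
            ≡⟨ sum-cong-≗ (λ v → trans (cong (ψ x v ∧_) (∂-path (walk root v) w)) (∧-distribˡ-xor (ψ x v) (root == w) (v == w))) ⟩
          (sum λ v → (ψ x v ∧ (root == w)) xor (ψ x v ∧ (v == w)))
            ≡⟨ ∑-distrib-+ (λ v → ψ x v ∧ (root == w)) _ ⟩
          (sum λ v → ψ x v ∧ (root == w)) xor (sum λ v → ψ x v ∧ (v == w))
            ≡⟨ cong ((sum λ v → ψ x v ∧ (root == w)) xor_) (sum-== w (ψ x)) ⟩
          (sum λ v → ψ x v ∧ (root == w)) xor ψ x w ∎
          where open ≡-Reasoning
        ∂-total≡false : ∀ w → ∂ (total x) w ≡ false
        ∂-total≡false w = sum-false λ u → trans (∧-cong-when (total≡false w u)) (∧-zeroʳ (adj G w u))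
        ψ≡false : ∀ w → ψ x w ≡ false
        ψ≡false w with root ≟ w
        ... | yes refl = norm≡false (suc zero)
        ... | no root≢w = trans (≡-sym (cong (_xor ψ x w) (sum-false (λ v → trans (cong (ψ x v ∧_) (==-≢ root≢w)) (∧-zeroʳ (ψ x v))))))
                                (trans (≡-sym (∂-total w)) (∂-total≡false w))
        paths≡false : ∀ u v → paths x u v ≡ false
        paths≡false u v = sum-false (λ w → cong (_∧ π w u v) (ψ≡false w))
        jump≡extra : ∀ u v → adj G u v ≡ true → jump (Φ x) u v ≡ extra x u v
        jump≡extra u v uv = xor≡false⇒≡ (trans (cong (jump (Φ x) u v xor_) (≡-sym
          (trans (cong (extra x u v xor_) (paths≡false u v)) (xor-identityʳ (extra x u v))))) (total≡false u v uv))
        locate : (∀ j → t x j ≡ false) → (∀ i → Φ x i ≡ false) → x i ≡ false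
        locate t≡false Φ≡false = at (Fin.join-splitAt F (m + n) i)
          where
          at : Fin.join F (m + n) (splitAt F i) ≡ i → x i ≡ false
          at e with splitAt F i
          at refl | inj₁ k = Φ≡false k
          at e | inj₂ k = at′ (Fin.join-splitAt m n k) e
            where
            at′ : Fin.join m n (splitAt m k) ≡ k → F ↑ʳ k ≡ i → x i ≡ false
            at′ e e′ with splitAt m k
            at′ refl refl | inj₁ j = t≡false j
            at′ refl refl | inj₂ w = ψ≡false w
        answer : ∃₂ λ t Φ → (∃ λ j → t j ≡ true) × ∀ u v → adj G u v ≡ true → jump Φ u v ≡ sum λ j → t j ∧ D j u v
        answer with any? (λ j → t x j Bool.≟ true)
        ... | yes some = t x , Φ x , some , jump≡extra
        ... | no none = contradiction (trans (≡-sym xi) (locate t≡false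
                (jump-kernel (Φ x) (λ u v uv → trans (jump≡extra u v uv) (sum-false (λ j → cong (_∧ D j u v) (t≡false j)))) (norm≡false zero)))) true≢false
          where
          t≡false : ∀ j → t x j ≡ false
          t≡false j = ¬-not (λ e → none (j , e))

  -- A cut and a cycle meet in an even number of edges: summation by parts turns the sum of `d ψ`
  -- times `z` over the edges into the sum of `ψ` times `∂ z` over the vertices, which is zero.
  other-edge : ∀ ψ {z} → Cycle z → ∀ {p q} → adj G p q ≡ true → d ψ p q ≡ true → z p q ≡ true →
               ∃₂ λ u v → adj G u v ≡ true × ¬ SameEdge G u v p q × d ψ u v ≡ true × z u v ≡ true
  other-edge ψ {z} cz {p} {q} pq dpq zpq = pick (below-total G pq)
    where
    term : Fin n → Fin n → Bool
    term u v = below G u v ∧ (d ψ u v ∧ z u v)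
    adj-split : ∀ v u → adj G v u ≡ below G v u xor below G u v
    adj-split v u with ℕ.<-cmp (toℕ v) (toℕ u)
    ... | tri< v<u _ u≮v rewrite <⇒<ᵇ≡true v<u | ≮⇒<ᵇ≡false u≮v | ∧-zeroʳ (adj G u v) | Bool.∧-identityʳ (adj G v u) =
      ≡-sym (xor-identityʳ _)
    ... | tri> v≮u _ u<v rewrite <⇒<ᵇ≡true u<v | ≮⇒<ᵇ≡false v≮u | ∧-zeroʳ (adj G v u) | Bool.∧-identityʳ (adj G u v) = sym G v u
    ... | tri≈ v≮u v≡u u≮v rewrite ≮⇒<ᵇ≡false u≮v | ≮⇒<ᵇ≡false v≮u | ∧-zeroʳ (adj G u v) | ∧-zeroʳ (adj G v u)
                                 | Fin.toℕ-injective v≡u = irrefl G u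
    -- The contribution of the end `v` to the edge `vu`, according to whether `v` is its lower or
    -- upper end. Pairing the two ends of an edge gives `term`; collecting at `v` gives `ψ v` times
    -- the boundary there.
    down up : Fin n → Fin n → Bool
    down v u = below G v u ∧ (ψ v ∧ z v u)
    up v u = below G u v ∧ (ψ v ∧ z v u)
    combine : ∀ u v → down u v xor up v u ≡ term u v
    combine u v with below G u v in b
    ... | false = refl
    ... | true = trans (cong (λ x → (ψ u ∧ z u v) xor (ψ v ∧ x)) (≡-sym (even cz u v (proj₁ (below-sound G b)))))
                       (≡-sym (∧-distribʳ-xor (z u v) (ψ u) (ψ v)))
    total : sum (λ u → sum (term u)) ≡ false
    total = begin
      sum (λ u → sum (term u))
        ≡⟨ sum-cong-≗ (λ u → sum-cong-≗ (λ v → ≡-sym (combine u v))) ⟩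
      sum (λ u → sum (λ v → down u v xor up v u))
        ≡⟨ sum-cong-≗ (λ u → ∑-distrib-+ (down u) (λ v → up v u)) ⟩
      sum (λ u → sum (down u) xor sum (λ v → up v u))
        ≡⟨ ∑-distrib-+ (λ u → sum (down u)) (λ u → sum (λ v → up v u)) ⟩
      sum (λ u → sum (down u)) xor sum (λ u → sum (λ v → up v u))
        ≡⟨ cong (sum (λ u → sum (down u)) xor_) (∑-comm (λ u v → up v u)) ⟩
      sum (λ u → sum (down u)) xor sum (λ v → sum (up v))
        ≡⟨ ∑-distrib-+ (λ u → sum (down u)) (λ u → sum (up u)) ⟨
      sum (λ v → sum (down v) xor sum (up v))
        ≡⟨ sum-cong-≗ (λ v → ∑-distrib-+ (down v) (up v)) ⟨
      sum (λ v → sum (λ u → down v u xor up v u))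
        ≡⟨ sum-cong-≗ (λ v → sum-cong-≗ (λ u → at v u)) ⟩
      sum (λ v → sum (λ u → ψ v ∧ (adj G v u ∧ z v u)))
        ≡⟨ sum-false (λ v → trans (sum-∧ (ψ v) (λ u → adj G v u ∧ z v u)) (trans (cong (ψ v ∧_) (balanced cz v)) (∧-zeroʳ (ψ v)))) ⟩
      false ∎
      where
      open ≡-Reasoning
      at : ∀ v u → down v u xor up v u ≡ ψ v ∧ (adj G v u ∧ z v u)
      at v u = trans (≡-sym (∧-distribʳ-xor (ψ v ∧ z v u) (below G v u) (below G u v)))
        (trans (cong (_∧ (ψ v ∧ z v u)) (≡-sym (adj-split v u))) (∧-exchange (adj G v u) (ψ v) (z v u)))
    search : ∀ {p q} → below G p q ≡ true → d ψ p q ≡ true → z p q ≡ true →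
             ∃₂ λ u v → adj G u v ≡ true × ¬ SameEdge G u v p q × d ψ u v ≡ true × z u v ≡ true
    search {p} {q} b dpq zpq with sum²-even-other term total p q (cong₂ _∧_ b (cong₂ _∧_ dpq zpq))
    ... | u , v , ne , e with ∧≡true {below G u v} e
    ...   | b′ , e′ with ∧≡true {d ψ u v} e′
    ...     | duv , zuv = u , v , proj₁ (below-sound G b′) , different , duv , zuv
      where
      different : ¬ SameEdge G u v p q
      different (inj₁ same) = ne same
      different (inj₂ (refl , refl)) = ℕ.<-asym (proj₂ (below-sound G b)) (proj₂ (below-sound G b′))
    pick : below G p q ≡ true ⊎ below G q p ≡ true →
           ∃₂ λ u v → adj G u v ≡ true × ¬ SameEdge G u v p q × d ψ u v ≡ true × z u v ≡ true
    pick (inj₁ b) = search b dpq zpq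
    pick (inj₂ b) with search b (trans (xor-comm (ψ q) (ψ p)) dpq) (trans (≡-sym (even cz p q pq)) zpq)
    ... | u , v , uv , ne , duv , zuv = u , v , uv , (λ s → ne (SameEdge-flipʳ G s)) , duv , zuv

  -- Switching a scheme to the plane rotations

  baseFlag : Flag G
  baseFlag = flag root (nbr root zero) true (nbr-adj root zero)

  flag-cong : ∀ {v u s t} {p q : adj G v u ≡ true} → s ≡ t → flag {G = G} v u s p ≡ flag v u t q
  flag-cong {p = p} {q} refl = cong (flag _ _ _) (≡-irrelevant p q)

  -- Colourings are total in the two vertices, while faces colour flags only; pairs that are not
  -- edges receive the default `baseFlag`.
  flagAt : Fin n → Fin n → Bool → Flag G
  flagAt v u s with adj G v u Bool.≟ true
  ... | yes vu = flag v u s vu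
  ... | no _ = baseFlag

  flagAt-≡ : ∀ {v u s} (vu : adj G v u ≡ true) → flagAt v u s ≡ flag v u s vu
  flagAt-≡ {v} {u} vu with adj G v u Bool.≟ true
  ... | yes _ = flag-cong refl
  ... | no no-edge = contradiction vu no-edge

  -- Switching σ at the vertices where `at` holds turns its rotations into those of σ₀ and its signature into A.
  record Switch (A : EdgeFn) (σ : Scheme G) : Set where
    field
      at : Fin n → Bool
      same-rot : ∀ v u → adj G v u ≡ true → at v ≡ false → rot σ v u ≡ rot σ₀ v u
      reversed-rot : ∀ v u → adj G v u ≡ true → at v ≡ true → rot σ v (rot σ₀ v u) ≡ u
      signature : ∀ v u → adj G v u ≡ true → A v u ≡ (sig σ v u xor at v) xor at u
  open Switch public

  module _ {A σ} (w : Switch A σ) where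

    -- Reversing the rotation at a vertex exchanges the two sides of its edges, so a side `s` is
    -- read there as `s xor at w v`. In these coordinates the crossing rule for `A` is the rule `τ₀`
    -- for `sig σ`.
    switched-side : ∀ v u s → adj G v u ≡ true →
                    (if A v u then s else not s) xor at w u ≡ (if sig σ v u then s xor at w v else not (s xor at w v))
    switched-side v u s vu rewrite signature w v u vu = law (sig σ v u) (at w v) (at w u) s
      where
      law : ∀ g a b s → (if (g xor a) xor b then s else not s) xor b ≡ (if g then s xor a else not (s xor a))
      law true true true true = refl
      law true true true false = refl
      law true true false true = refl
      law true true false false = refl
      law true false true true = refl
      law true false true false = refl
      law true false false true = refl
      law true false false false = refl
      law false true true true = refl
      law false true true false = refl
      law false true false true = refl
      law false true false false = refl
      law false false true true = refl
      law false false true false = refl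
      law false false false true = refl
      law false false false false = refl

    switched-colouring : ∀ {F} → HasFaces σ F → Colouring A F
    switched-colouring {F} (c , same , onto′) = record
      { col = λ v u s → c (flagAt v u (s xor at w v))
      ; corner = turn
      ; cross = across
      ; onto = reach }
      where
      join : ∀ {v u s v′ u′ s′} (p : adj G v u ≡ true) (q : adj G v′ u′ ≡ true) →
             SameFace σ (flag v u s p) (flag v′ u′ s′ q) → c (flagAt v u s) ≡ c (flagAt v′ u′ s′)
      join p q e = trans (cong c (flagAt-≡ p)) (trans (Equivalence.from (same _ _) e) (cong c (≡-sym (flagAt-≡ q))))
      turn : ∀ v u → adj G v u ≡ true → c (flagAt v u (true xor at w v)) ≡ c (flagAt v (rot σ₀ v u) (false xor at w v))
      turn v u vu with at w v in e
      ... | false = join vu (rot-adj σ₀ v u vu) (EqC.return (τ₁ refl refl refl (≡-sym (same-rot w v u vu e))))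
      ... | true = join vu (rot-adj σ₀ v u vu)
        (EqC.symmetric _ (EqC.return (τ₁ refl refl refl (≡-sym (reversed-rot w v u vu e)))))
      across : ∀ v u s → adj G v u ≡ true →
               c (flagAt u v ((if A v u then s else not s) xor at w u)) ≡ c (flagAt v u (s xor at w v))
      across v u s vu = ≡-sym (join vu (adj-flip vu) (EqC.return (τ₀ refl refl (switched-side v u s vu))))
      reach : ∀ i → ∃ λ v → ∃ λ u → ∃ λ s → adj G v u ≡ true × c (flagAt v u (s xor at w v)) ≡ i
      reach i with onto′ i
      ... | flag v u s vu , e = v , u , s xor at w v , vu ,
        trans (cong c (trans (flagAt-≡ vu) (flag-cong (xor-cancelʳ s (at w v))))) e

    colour-invariant : ∀ {F} (k : Colouring A F) {x y} → SameFace σ x y →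
                       col k (fv x) (fu x) (side x xor at w (fv x)) ≡ col k (fv y) (fu y) (side y xor at w (fv y))
    colour-invariant k = EqC.gfold ≡.isEquivalence _ step-invariant
      where
      step-invariant : ∀ {x y} → FlagStep σ x y →
        col k (fv x) (fu x) (side x xor at w (fv x)) ≡ col k (fv y) (fu y) (side y xor at w (fv y))
      step-invariant {flag v u true vu} {flag .v _ .false _} (τ₁ refl refl refl refl) with at w v in e
      ... | false = trans (corner k v u vu) (cong (λ x → col k v x false) (≡-sym (same-rot w v u vu e)))
      ... | true = ≡-sym (trans (corner k v _ (rot-adj σ v u vu)) (cong (λ x → col k v x false) undo))
        where
        undo : rot σ₀ v (rot σ v u) ≡ u
        undo = rot-inj σ v _ u (rot-adj σ₀ v _ (rot-adj σ v u vu)) vu (reversed-rot w v _ (rot-adj σ v u vu) e)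
      step-invariant {flag v u s vu} {flag .u .v _ _} (τ₀ refl refl refl) = begin
        col k v u (s xor at w v)
          ≡⟨ cross k v u (s xor at w v) vu ⟨
        col k u v (if A v u then s xor at w v else not (s xor at w v))
          ≡⟨ cong (col k u v) (trans (≡-sym (xor-cancelʳ _ (at w u))) (cong (_xor at w u) (trans (switched-side v u (s xor at w v) vu)
               (cong (λ x → if sig σ v u then x else not x) (xor-cancelʳ s (at w v)))))) ⟩
        col k u v ((if sig σ v u then s else not s) xor at w u) ∎
        where
        open ≡-Reasoning

-- Duality for the plane embedding

module Plane {n} {G : Graph n} (conn : KConnected 3 G) (cubic : Cubic G) (σ₀ : Scheme G)
             (flat : ∀ u v → adj G u v ≡ true → sig σ₀ u v ≡ false)
             {F₀ : ℕ} (faces : HasFaces σ₀ F₀) (euler : n + F₀ ≡ edgeCount G + 2) where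
  open Chains {G = G} conn cubic σ₀ public

  untwisted : Switch (λ _ _ → false) σ₀
  untwisted = record
    { at = λ _ → false
    ; same-rot = λ _ _ _ _ → refl
    ; reversed-rot = λ _ _ _ ()
    ; signature = λ v u vu → ≡-sym (trans (xor-identityʳ _) (trans (xor-identityʳ _) (flat v u vu)))
    }

  abstract
    c₀ : Colouring (λ _ _ → false) F₀
    c₀ = switched-colouring untwisted faces

    c₀-flag : ∀ x → col c₀ (fv x) (fu x) (side x) ≡ proj₁ faces x
    c₀-flag (flag v u s vu) = cong (proj₁ faces) (trans (flagAt-≡ vu) (flag-cong (xor-identityʳ s)))

  -- The face to the left of the dart (v , u), i.e. the one containing the flag (v , u , true).
  ℓ : Fin n → Fin n → Fin F₀
  ℓ v u = col c₀ v u true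

  ℓ-right : ∀ {v u} → adj G v u ≡ true → col c₀ v u false ≡ ℓ u v
  ℓ-right {v} {u} vu = ≡-sym (cross c₀ v u false vu)

  ℓ-corner : ∀ {v u} → adj G v u ≡ true → ℓ v u ≡ ℓ (rot σ₀ v u) v
  ℓ-corner {v} {u} vu = trans (corner c₀ v u vu) (ℓ-right (rot-adj σ₀ v u vu))

  bd : (Fin F₀ → Bool) → EdgeFn
  bd y u v = y (ℓ u v) xor y (ℓ v u)

  jump≡bd : ∀ y {u v} → adj G u v ≡ true → jump c₀ y u v ≡ bd y u v
  jump≡bd y {u} {v} uv = cong (λ f → y (ℓ u v) xor y f) (ℓ-right uv)

  bd-cycle : ∀ y → Cycle (bd y)
  bd-cycle y = cycle (λ w → trans (sum-cong-≗ (agree w)) (balanced (jump-cycle c₀ y) w)) (λ u v _ → xor-comm (y (ℓ u v)) (y (ℓ v u)))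
    where
    agree : ∀ w u → adj G w u ∧ bd y w u ≡ adj G w u ∧ jump c₀ y w u
    agree w u = ∧-cong-when (λ wu → ≡-sym (jump≡bd y wu))

  -- By Euler's formula a single extra cycle already makes the count strict. Its coefficient is the
  -- only one available, so it is 1 and `z` itself is a boundary.
  cycle-bounds : ∀ {z} → Cycle z → ∃ λ y → ∀ u v → adj G u v ≡ true → z u v ≡ bd y u v
  cycle-bounds {z} cz with boundary-combination c₀ {1} (λ _ → z) (λ _ → cz) bound
    where
    bound : edgeCount G + 2 < F₀ + suc n
    bound = ℕ.≤-reflexive (trans (cong suc (trans (≡-sym euler) (ℕ.+-comm n F₀))) (≡-sym (ℕ.+-suc F₀ n)))
  ... | t , Φ , (zero , t0) , e = Φ , λ u v uv → ≡-sym (trans (≡-sym (jump≡bd Φ uv)) (trans (e u v uv)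
          (trans (cong (λ b → (b ∧ z u v) xor false) t0) (xor-identityʳ (z u v)))))

  Darts : Set
  Darts = List (Fin n × Fin n)

  -- The F₂ pairing of a chain with the edge set listed in `L`.
  ev : Darts → EdgeFn → Bool
  ev [] z = false
  ev ((p , q) ∷ L) z = z p q xor ev L z

  ev-⊕ : ∀ L y z → ev L (y ⊕ z) ≡ ev L y xor ev L z
  ev-⊕ [] y z = refl
  ev-⊕ ((p , q) ∷ L) y z = trans (cong ((y p q xor z p q) xor_) (ev-⊕ L y z)) (xor-interchange (y p q) (z p q) (ev L y) (ev L z))

  IsDart : Fin n × Fin n → Set
  IsDart (p , q) = adj G p q ≡ true

  ev-cong : ∀ {L y z} → All IsDart L → (∀ u v → adj G u v ≡ true → y u v ≡ z u v) → ev L y ≡ ev L z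
  ev-cong [] e = refl
  ev-cong (pq ∷ rest) e = cong₂ _xor_ (e _ _ pq) (ev-cong rest e)

  -- Plane duality: an edge set meeting every face boundary evenly is a cut. Its potential is the parity
  -- of crossings along a path, well defined since every cycle bounds.
  abstract
    cut : ∀ L → All IsDart L → (∀ y → ev L (bd y) ≡ false) → ∀ r →
          ∃ λ ψ → ψ r ≡ false × ∀ u v → adj G u v ≡ true → d ψ u v ≡ ev L (δ u v)
    cut L darts null r = (λ v → ev L (π v) xor ev L (π r)) , xor-same (ev L (π r)) , coboundary
      where
      loop-cycle : ∀ {u v} → adj G u v ≡ true → Cycle (δ u v ⊕ (π u ⊕ π v))
      loop-cycle {u} {v} uv = cycle
        (λ w → trans (∂-⊕ (δ u v) (π u ⊕ π v) w) (trans (cong₂ _xor_ (∂-δ uv w)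
          (trans (∂-⊕ (π u) (π v) w) (trans (cong₂ _xor_ (∂-path (walk root u) w) (∂-path (walk root v) w))
            (cancel (root == w) (u == w) (v == w))))) (xor-same ((u == w) xor (v == w)))))
        (λ x y _ → cong₂ _xor_ (δ-even u v x y) (cong₂ _xor_ (path-even (walk root u) x y) (path-even (walk root v) x y)))
        where
        cancel : ∀ a b c → (a xor b) xor (a xor c) ≡ b xor c
        cancel a b c = trans (xor-interchange a b a c) (cong (_xor (b xor c)) (xor-same a))
      loop-null : ∀ {u v} → adj G u v ≡ true → ev L (δ u v ⊕ (π u ⊕ π v)) ≡ false
      loop-null uv = let y , e = cycle-bounds (loop-cycle uv) in trans (ev-cong darts e) (null y)
      coboundary : ∀ u v → adj G u v ≡ true → (ev L (π u) xor ev L (π r)) xor (ev L (π v) xor ev L (π r)) ≡ ev L (δ u v)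
      coboundary u v uv = trans (xor-interchange (ev L (π u)) (ev L (π r)) (ev L (π v)) (ev L (π r)))
        (trans (cong ((ev L (π u) xor ev L (π v)) xor_) (xor-same (ev L (π r)))) (trans (xor-identityʳ _) (≡-sym (xor≡false⇒≡
          (trans (cong (ev L (δ u v) xor_) (≡-sym (ev-⊕ L (π u) (π v)))) (trans (≡-sym (ev-⊕ L (δ u v) (π u ⊕ π v))) (loop-null uv)))))))

  δ-self : ∀ {p q} → adj G p q ≡ true → δ p q p q ≡ true
  δ-self pq = δ-complete pq (inj₁ (refl , refl))

  private
    Separates : Fin n → Fin n → Fin n → Fin n → Set
    Separates p q p′ q′ = ∃ λ ψ → ψ p ≢ ψ q × ψ p′ ≢ ψ q′ × (∀ a b → adj G a b ≡ true → d ψ a b ≡ true → SameEdge G a b p q ⊎ SameEdge G a b p′ q′)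

    no-separation : ∀ {p q p′ q′} → adj G p q ≡ true → ¬ Separates p q p′ q′
    no-separation pq (ψ , cuts , cuts′ , only) = no-small-cut ψ pq cuts cuts′ (λ a b ab ne → only a b ab (≢⇒xor≡true ne))

  -- If both sides were one face, every face boundary would vanish on `pq`; by `cut` this edge alone
  -- would be a cut, that is, a bridge.
  two-sided : ∀ {p q} → adj G p q ≡ true → ℓ p q ≢ ℓ q p
  two-sided {p} {q} pq e = no-separation pq (from-cut (cut L (pq ∷ []) null root))
    where
    L : Darts
    L = (p , q) ∷ []
    null : ∀ y → ev L (bd y) ≡ false
    null y = trans (xor-identityʳ (bd y p q)) (≡⇒xor≡false (cong y e))
    from-cut : (∃ λ ψ → ψ root ≡ false × ∀ u v → adj G u v ≡ true → d ψ u v ≡ ev L (δ u v)) → Separates p q p q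
    from-cut (ψ , _ , dψ) = ψ , cuts , cuts , only
      where
      dψ′ : ∀ u v → adj G u v ≡ true → d ψ u v ≡ δ u v p q
      dψ′ u v uv = trans (dψ u v uv) (xor-identityʳ (δ u v p q))
      cuts : ψ p ≢ ψ q
      cuts = xor≡true⇒≢ (trans (dψ′ p q pq) (δ-self pq))
      only : ∀ a b → adj G a b ≡ true → d ψ a b ≡ true → SameEdge G a b p q ⊎ SameEdge G a b p q
      only a b ab cutting = inj₁ (SameEdge-sym G (δ-sound (trans (≡-sym (dψ′ a b ab)) cutting)))

  -- Two different edges between the same two faces meet every boundary evenly and would form a cut
  -- of two edges. For the same edge, `two-sided` excludes the opposite direction.
  ℓ-unique : ∀ {p q p′ q′} → adj G p q ≡ true → adj G p′ q′ ≡ true → ℓ p q ≡ ℓ p′ q′ → ℓ q p ≡ ℓ q′ p′ → p ≡ p′ × q ≡ q′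
  ℓ-unique {p} {q} {p′} {q′} pq pq′ e f = decide (SameEdge? G p q p′ q′)
    where
    L : Darts
    L = (p , q) ∷ (p′ , q′) ∷ []
    null : ∀ y → ev L (bd y) ≡ false
    null y = trans (cong (bd y p q xor_) (xor-identityʳ (bd y p′ q′))) (≡⇒xor≡false (cong₂ (λ i j → y i xor y j) e f))
    from-cut : ¬ SameEdge G p q p′ q′ →
               (∃ λ ψ → ψ root ≡ false × ∀ u v → adj G u v ≡ true → d ψ u v ≡ ev L (δ u v)) → Separates p q p′ q′
    from-cut different (ψ , _ , dψ) = ψ , cuts , cuts′ , only
      where
      dψ′ : ∀ u v → adj G u v ≡ true → d ψ u v ≡ δ u v p q xor δ u v p′ q′
      dψ′ u v uv = trans (dψ u v uv) (cong (δ u v p q xor_) (xor-identityʳ (δ u v p′ q′)))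
      cuts : ψ p ≢ ψ q
      cuts = xor≡true⇒≢ (trans (dψ′ p q pq) (cong₂ _xor_ (δ-self pq) (δ-miss (different ∘ SameEdge-sym G))))
      cuts′ : ψ p′ ≢ ψ q′
      cuts′ = xor≡true⇒≢ (trans (dψ′ p′ q′ pq′) (cong₂ _xor_ (δ-miss different) (δ-self pq′)))
      only : ∀ a b → adj G a b ≡ true → d ψ a b ≡ true → SameEdge G a b p q ⊎ SameEdge G a b p′ q′
      only a b ab cutting with xor-true (trans (≡-sym (dψ′ a b ab)) cutting)
      ... | inj₁ hit = inj₁ (SameEdge-sym G (δ-sound hit))
      ... | inj₂ hit = inj₂ (SameEdge-sym G (δ-sound hit))
    decide : Dec (SameEdge G p q p′ q′) → p ≡ p′ × q ≡ q′
    decide (yes (inj₁ same)) = same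
    decide (yes (inj₂ (refl , refl))) = contradiction e (two-sided pq)
    decide (no different) = ⊥-elim (no-separation pq (from-cut different (cut L (pq ∷ pq′ ∷ []) null root)))

  -- `other-edge` applied to the boundary of the single face `ℓ p q`. Through `ℓ-unique`, a second
  -- edge on this face means a second face across, and it is in this form that all later parity
  -- arguments use it.
  other-on-face : ∀ ψ {p q} → adj G p q ≡ true → d ψ p q ≡ true →
                  ∃₂ λ u v → adj G u v ≡ true × ℓ u v ≡ ℓ p q × d ψ u v ≡ true × ℓ v u ≢ ℓ q p
  other-on-face ψ {p} {q} pq cutting = orient (other-edge ψ (bd-cycle (_== f)) pq cutting on-f)
    where
    f : Fin F₀
    f = ℓ p q
    on-f : bd (_== f) p q ≡ true
    on-f = cong₂ _xor_ (==-refl f) (==-≢ (two-sided pq ∘ ≡-sym))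
    orient : (∃₂ λ u v → adj G u v ≡ true × ¬ SameEdge G u v p q × d ψ u v ≡ true × bd (_== f) u v ≡ true) →
             ∃₂ λ u v → adj G u v ≡ true × ℓ u v ≡ f × d ψ u v ≡ true × ℓ v u ≢ ℓ q p
    orient (u , v , uv , ne , cutting′ , on) = pick (xor-true on)
      where
      pick : (ℓ u v == f) ≡ true ⊎ (ℓ v u == f) ≡ true → _
      pick (inj₁ e) = u , v , uv , ==⇒≡ e , cutting′ , λ same → ne (inj₁ (ℓ-unique uv pq (==⇒≡ e) same))
      pick (inj₂ e) = v , u , adj-flip uv , ==⇒≡ e , trans (xor-comm (ψ v) (ψ u)) cutting′ ,
        λ same → ne (SameEdge-flip G (inj₁ (ℓ-unique (adj-flip uv) pq (==⇒≡ e) same)))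

  -- Twisted faces form a clique of the dual graph

  module Twisted (A : EdgeFn) (A-even : ∀ u v → A u v ≡ A v u) {F : ℕ} (k : Colouring A F) (euler₁ : n + F ≡ edgeCount G + 1) where

    CutBy : EdgeFn → Set
    CutBy z = ∃ λ ψ → ∀ u v → adj G u v ≡ true → d ψ u v ≡ A u v ∧ z u v

    -- Where a face colouring Φ of the twisted embedding jumps exactly as y does, their difference depends only on the vertex.
    twist-cut : ∀ y Φ → (∀ u v → adj G u v ≡ true → jump k Φ u v ≡ bd y u v) → CutBy (bd y)
    twist-cut y Φ agree = from-potential (potential ω turn level)
      where
      ω : Fin n → Fin n → Bool → Bool
      ω v u s = Φ (col k v u s) xor y (col c₀ v u s)
      turn : ∀ v u → adj G v u ≡ true → ω v u true ≡ ω v (rot σ₀ v u) false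
      turn v u vu = cong₂ (λ i j → Φ i xor y j) (corner k v u vu) (corner c₀ v u vu)
      level : ∀ v u → adj G v u ≡ true → ω v u true ≡ ω v u false
      level v u vu = xor≡false⇒≡ (trans
        (xor-interchange (Φ (col k v u true)) (y (ℓ v u)) (Φ (col k v u false)) (y (col c₀ v u false)))
        (≡⇒xor≡false (trans (agree v u vu) (≡-sym (jump≡bd y vu)))))
      from-potential : (∃ λ ψ → ∀ v u s → adj G v u ≡ true → ω v u s ≡ ψ v) → CutBy (bd y)
      from-potential (ψ , same) = ψ , coboundary
        where
        coboundary : ∀ u v → adj G u v ≡ true → d ψ u v ≡ A u v ∧ bd y u v
        coboundary u v uv = begin
          ψ u xor ψ v
            ≡⟨ cong₂ _xor_ (same u v true uv) (same v u s′ vu) ⟨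
          ω u v true xor ω v u s′
            ≡⟨ cong (λ i → ω u v true xor (Φ i xor y (col c₀ v u s′))) (cross k u v true uv) ⟩
          (Φ (col k u v true) xor y (ℓ u v)) xor (Φ (col k u v true) xor y (col c₀ v u s′))
            ≡⟨ xor-interchange (Φ (col k u v true)) (y (ℓ u v)) (Φ (col k u v true)) (y (col c₀ v u s′)) ⟩
          (Φ (col k u v true) xor Φ (col k u v true)) xor (y (ℓ u v) xor y (col c₀ v u s′))
            ≡⟨ cong (_xor (y (ℓ u v) xor y (col c₀ v u s′))) (xor-same (Φ (col k u v true))) ⟩
          y (ℓ u v) xor y (col c₀ v u s′)
            ≡⟨ across (A u v) refl ⟩
          A u v ∧ bd y u v ∎
          where
          open ≡-Reasoning
          vu : adj G v u ≡ true
          vu = adj-flip uv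
          s′ : Bool
          -- The side at `v` that `cross` joins to side `true` at `u`. Across a twisted edge it
          -- belongs to the other plane face, which is where `bd y` appears; otherwise it belongs to
          -- the same one.
          s′ = if A u v then true else false
          across : ∀ b → b ≡ A u v → y (ℓ u v) xor y (col c₀ v u (if b then true else false)) ≡ b ∧ bd y u v
          across true _ = refl
          across false _ = trans (cong (λ i → y (ℓ u v) xor y i) (ℓ-right vu)) (xor-same (y (ℓ u v)))

    -- The faces of the twisted embedding are one fewer, so boundaries whose A-part is a cut have codimension at most one.
    one-of-three : ∀ y₁ y₂ → CutBy (bd y₁) ⊎ CutBy (bd y₂) ⊎ CutBy (bd y₁ ⊕ bd y₂)
    one-of-three y₁ y₂ = from-combination (boundary-combination k D D-cycle bound)
      where
      D : Fin 2 → EdgeFn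
      D zero = bd y₁
      D (suc _) = bd y₂
      D-cycle : ∀ j → Cycle (D j)
      D-cycle zero = bd-cycle y₁
      D-cycle (suc _) = bd-cycle y₂
      bound : edgeCount G + 2 < F + (2 + n)
      bound = ℕ.≤-reflexive (begin
        suc (edgeCount G + 2) ≡⟨ ℕ.+-suc (edgeCount G) 2 ⟨
        edgeCount G + 3       ≡⟨ ℕ.+-assoc (edgeCount G) 1 2 ⟨
        edgeCount G + 1 + 2   ≡⟨ cong (_+ 2) euler₁ ⟨
        n + F + 2             ≡⟨ cong (_+ 2) (ℕ.+-comm n F) ⟩
        F + n + 2             ≡⟨ ℕ.+-assoc F n 2 ⟩
        F + (n + 2)           ≡⟨ cong (F +_) (ℕ.+-comm n 2) ⟩
        F + (2 + n)           ∎)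
        where open ≡-Reasoning
      from-combination : (∃₂ λ t Φ → (∃ λ j → t j ≡ true) × ∀ u v → adj G u v ≡ true → jump k Φ u v ≡ sum λ j → t j ∧ D j u v) → _
      from-combination (t , Φ , (j , tj) , e) = select (t zero) (t (suc zero)) refl refl
        where
        both : ∀ {u v} → bd y₁ u v xor bd y₂ u v ≡ bd (λ f → y₁ f xor y₂ f) u v
        both {u} {v} = xor-interchange (y₁ (ℓ u v)) (y₁ (ℓ v u)) (y₂ (ℓ u v)) (y₂ (ℓ v u))
        e′ : ∀ {b c} → t zero ≡ b → t (suc zero) ≡ c → ∀ u v → adj G u v ≡ true →
             jump k Φ u v ≡ (b ∧ bd y₁ u v) xor ((c ∧ bd y₂ u v) xor false)
        e′ refl refl u v uv = e u v uv
        select : ∀ b c → t zero ≡ b → t (suc zero) ≡ c → CutBy (bd y₁) ⊎ CutBy (bd y₂) ⊎ CutBy (bd y₁ ⊕ bd y₂)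
        select true false p q = inj₁ (twist-cut y₁ Φ (λ u v uv → trans (e′ p q u v uv) (xor-identityʳ (bd y₁ u v))))
        select false true p q = inj₂ (inj₁ (twist-cut y₂ Φ (λ u v uv → trans (e′ p q u v uv) (xor-identityʳ (bd y₂ u v)))))
        select true true p q = inj₂ (inj₂ (proj₁ twisted , λ u v uv → trans (proj₂ twisted u v uv) (cong (A u v ∧_) (≡-sym (both {u} {v})))))
          where
          twisted : CutBy (bd (λ f → y₁ f xor y₂ f))
          twisted = twist-cut (λ f → y₁ f xor y₂ f) Φ (λ u v uv → trans (e′ p q u v uv) (trans (cong (bd y₁ u v xor_) (xor-identityʳ (bd y₂ u v))) (both {u} {v})))
        select false false p q = ⊥-elim (none j tj)
          where
          none : ∀ j → t j ≢ true
          none zero e = true≢false (trans (≡-sym e) p)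
          none (suc zero) e = true≢false (trans (≡-sym e) q)

    Twist : Fin F₀ → Fin F₀ → Set
    Twist f g = ∃₂ λ p q → adj G p q ≡ true × A p q ≡ true × ℓ p q ≡ f × ℓ q p ≡ g

    Twist-sym : ∀ {f g} → Twist f g → Twist g f
    Twist-sym (p , q , pq , a , e , e′) = q , p , adj-flip pq , trans (A-even q p) a , e′ , e

    Twist-≢ : ∀ {f g} → Twist f g → f ≢ g
    Twist-≢ (p , q , pq , _ , refl , refl) = two-sided pq

    TwistedFace : Fin F₀ → Set
    TwistedFace f = ∃ λ g → Twist f g

    𝟙 : Fin F₀ → Fin F₀ → Bool
    𝟙 f i = i == f

    bd-on : ∀ {u v} → adj G u v ≡ true → bd (𝟙 (ℓ u v)) u v ≡ true
    bd-on {u} {v} uv = cong₂ _xor_ (==-refl (ℓ u v)) (==-≢ (two-sided uv ∘ ≡-sym))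

    bd-off : ∀ {f u v} → ℓ u v ≢ f → ℓ v u ≢ f → bd (𝟙 f) u v ≡ false
    bd-off p q = cong₂ _xor_ (==-≢ p) (==-≢ q)

    bd-on′ : ∀ {u v} → adj G u v ≡ true → bd (𝟙 (ℓ v u)) u v ≡ true
    bd-on′ {u} {v} uv = cong₂ _xor_ (==-≢ (two-sided uv)) (==-refl (ℓ v u))

    bd-hit : ∀ {f u v} → bd (𝟙 f) u v ≡ true → ℓ u v ≡ f ⊎ ℓ v u ≡ f
    bd-hit on = Sum.map ==⇒≡ ==⇒≡ (xor-true on)

    -- A companion, on `g`, of the twisted edge between `f` and `g` would also border `f`, because
    -- the cut lies in the boundary of `f`. It would then be a second edge between these faces.
    row-not-cut : ∀ {f g} → Twist f g → ¬ CutBy (bd (𝟙 f))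
    row-not-cut (p , q , pq , a , refl , refl) (ψ , dψ) =
      refute (other-on-face ψ (adj-flip pq) (trans (xor-comm (ψ q) (ψ p)) (trans (dψ p q pq) (cong₂ _∧_ a (bd-on pq)))))
      where
      refute : ¬ ∃₂ λ u v → adj G u v ≡ true × ℓ u v ≡ ℓ q p × d ψ u v ≡ true × ℓ v u ≢ ℓ p q
      refute (u , v , uv , e , cutting , ne) =
        Sum.[ (λ e′ → two-sided pq (trans (≡-sym e′) e)) , ne ]′ (bd-hit {u = u} {v} (proj₂ (∧≡true (trans (≡-sym (dψ u v uv)) cutting))))

    abstract
      -- Two vectors outside a subspace of codimension at most one have their sum inside it.
      rows-cut : ∀ {f g} → TwistedFace f → TwistedFace g → CutBy (bd (𝟙 f) ⊕ bd (𝟙 g))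
      rows-cut {f} {g} (_ , tf) (_ , tg) = pick (one-of-three (𝟙 f) (𝟙 g))
        where
        pick : CutBy (bd (𝟙 f)) ⊎ CutBy (bd (𝟙 g)) ⊎ CutBy (bd (𝟙 f) ⊕ bd (𝟙 g)) → CutBy (bd (𝟙 f) ⊕ bd (𝟙 g))
        pick (inj₁ c) = ⊥-elim (row-not-cut tf c)
        pick (inj₂ (inj₁ c)) = ⊥-elim (row-not-cut tg c)
        pick (inj₂ (inj₂ c)) = c

    module _ {f g h} (tf : Twist f h) (xg : TwistedFace g) (f≢g : f ≢ g) (h≢g : h ≢ g) where
      private
        rows : CutBy (bd (𝟙 f) ⊕ bd (𝟙 g))
        rows = rows-cut (_ , tf) xg
        ψ : Fin n → Bool
        ψ = proj₁ rows
        cutting : ∀ {p q} → adj G p q ≡ true → A p q ≡ true → ℓ p q ≡ f → ℓ q p ≡ h → d ψ p q ≡ true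
        cutting {p} {q} pq a refl refl = trans (proj₂ rows p q pq) (cong₂ _∧_ a (cong₂ _xor_ (bd-on pq) (bd-off {u = p} {q} f≢g h≢g)))

      -- The twisted edge between `f` and `h` lies in the cut for `f` + `g`. Its companion on `h`
      -- has a face other than `f` across, so it can be in this cut only by bordering `g`.
      transfer : Twist g h
      transfer = from tf
        where
        from : Twist f h → Twist g h
        from (p , q , pq , a , refl , refl) = on-h (other-on-face ψ (adj-flip pq) (trans (xor-comm (ψ q) (ψ p)) (cutting pq a refl refl)))
          where
          on-h : (∃₂ λ u v → adj G u v ≡ true × ℓ u v ≡ h × d ψ u v ≡ true × ℓ v u ≢ f) → Twist g h
          on-h (u , v , uv , e , cutting , ne) = Sum.[ (λ e′ → ⊥-elim (h≢g (trans (≡-sym e) e′))) , found ]′ (bd-hit {u = u} {v} on-g)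
            where
            both = ∧≡true {A u v} (trans (≡-sym (proj₂ rows u v uv)) cutting)
            off-f : bd (𝟙 f) u v ≡ false
            off-f = bd-off {u = u} {v} (λ e′ → two-sided pq (trans (≡-sym e′) e)) ne
            on-g : bd (𝟙 g) u v ≡ true
            on-g = trans (cong (_xor bd (𝟙 g) u v) (≡-sym off-f)) (proj₂ both)
            found : ℓ v u ≡ g → Twist g h
            found e′ = v , u , adj-flip uv , trans (A-even v u) (proj₁ both) , e′ , e

      -- Here the companion is taken on `f`. The face across it is not `g`, since an edge between
      -- `f` and `g` counts twice in the sum and drops out.
      fourth : ∃ λ k → k ≢ f × k ≢ g × k ≢ h × TwistedFace k
      fourth = from tf
        where
        from : Twist f h → ∃ λ k → k ≢ f × k ≢ g × k ≢ h × TwistedFace k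
        from (p , q , pq , a , refl , refl) = on-f (other-on-face ψ pq (cutting pq a refl refl))
          where
          on-f : (∃₂ λ u v → adj G u v ≡ true × ℓ u v ≡ f × d ψ u v ≡ true × ℓ v u ≢ h) →
                 ∃ λ k → k ≢ f × k ≢ g × k ≢ h × TwistedFace k
          on-f (u , v , uv , e , cutting , ne) = ℓ v u , (λ e′ → two-sided uv (trans e (≡-sym e′))) , off-g , ne ,
            ℓ u v , v , u , adj-flip uv , trans (A-even v u) (proj₁ both) , refl , refl
            where
            both = ∧≡true {A u v} (trans (≡-sym (proj₂ rows u v uv)) cutting)
            off-g : ℓ v u ≢ g
            off-g refl = true≢false (trans (≡-sym (proj₂ both))
              (cong₂ _xor_ (trans (cong (λ x → bd (𝟙 x) u v) (≡-sym e)) (bd-on uv)) (bd-on′ uv)))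

    -- Let `h` be across a twisted edge of `f`. If `h` is not `g`, one `transfer` gives a twisted
    -- edge between `g` and `h`, and a second, moving its end `h` to `f`, gives one between `f` and
    -- `g`.
    clique : ∀ {f g} → TwistedFace f → TwistedFace g → f ≢ g → Twist f g
    clique {f} {g} (h , tf) xg f≢g = decide (h ≟ g)
      where
      decide : Dec (h ≡ g) → Twist f g
      decide (yes refl) = tf
      decide (no h≢g) = transfer (Twist-sym (transfer tf xg f≢g h≢g)) (h , tf) (Twist-≢ tf ∘ ≡-sym) (f≢g ∘ ≡-sym)

  -- Triangles and 4-cliques of the dual graph

  record Dart (f g : Fin F₀) : Set where
    constructor dart
    field
      tail head : Fin n
      isDart : adj G tail head ≡ true
      left : ℓ tail head ≡ f
      right : ℓ head tail ≡ g
  open Dart public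

  Dart-sym : ∀ {f g} → Dart f g → Dart g f
  Dart-sym (dart p q pq e e′) = dart q p (adj-flip pq) e′ e

  Dart-≢ : ∀ {f g} → Dart f g → f ≢ g
  Dart-≢ (dart p q pq refl refl) = two-sided pq

  hits : ∀ {f g} → Dart f g → EdgeFn
  hits D u v = δ u v (tail D) (head D)

  hits-sound : ∀ {f g} (D : Dart f g) {u v} → hits D u v ≡ true → (ℓ u v ≡ f × ℓ v u ≡ g) ⊎ (ℓ u v ≡ g × ℓ v u ≡ f)
  hits-sound (dart p q pq e e′) {u} {v} hit = pick (δ-sound hit)
    where
    pick : SameEdge G p q u v → _
    pick (inj₁ (refl , refl)) = inj₁ (e , e′)
    pick (inj₂ (refl , refl)) = inj₂ (e′ , e)

  hits-complete : ∀ {f g} (D : Dart f g) {u v} → adj G u v ≡ true → ℓ u v ≡ f → ℓ v u ≡ g → hits D u v ≡ true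
  hits-complete (dart p q pq e e′) uv i j =
    δ-complete pq (inj₁ (ℓ-unique pq uv (trans e (≡-sym i)) (trans e′ (≡-sym j))))

  hits-miss : ∀ {f g} (D : Dart f g) {u v} → ℓ u v ≢ f → ℓ u v ≢ g → hits D u v ≡ false
  hits-miss D ne ne′ = ¬-not (λ hit → Sum.[ ne ∘ proj₁ , ne′ ∘ proj₁ ]′ (hits-sound D hit))

  hits-miss′ : ∀ {f g} (D : Dart f g) {u v} → ℓ v u ≢ f → ℓ v u ≢ g → hits D u v ≡ false
  hits-miss′ D ne ne′ = ¬-not (λ hit → Sum.[ ne′ ∘ proj₂ , ne ∘ proj₂ ]′ (hits-sound D hit))

  OneOf : (a b c f : Fin F₀) → Set
  OneOf a b c f = f ≡ a ⊎ f ≡ b ⊎ f ≡ c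

  OneOf? : ∀ a b c f → Dec (OneOf a b c f)
  OneOf? a b c f = f ≟ a ⊎-dec (f ≟ b ⊎-dec f ≟ c)

  not-OneOf : ∀ {a b c f} → f ≢ a → f ≢ b → f ≢ c → ¬ OneOf a b c f
  not-OneOf p q r = Sum.[ p , Sum.[ q , r ]′ ]′

  OneOf-full : ∀ {a b c x y z} → OneOf a b c x → OneOf a b c y → OneOf a b c z → x ≢ y → x ≢ z → y ≢ z →
               ∀ {f} → OneOf a b c f → OneOf x y z f
  OneOf-full {a} {b} {c} ix iy iz x≢y x≢z y≢z {f} i =
    Sum.map (same i ix) (Sum.map (same i iy) (same i iz))
      (four-in-three (x≢y ∘ same ix iy) (x≢z ∘ same ix iz) (y≢z ∘ same iy iz) (position i))
    where
    position : ∀ {f} → OneOf a b c f → Fin 3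
    position (inj₁ _) = zero
    position (inj₂ (inj₁ _)) = suc zero
    position (inj₂ (inj₂ _)) = suc (suc zero)
    face-at : Fin 3 → Fin F₀
    face-at zero = a
    face-at (suc zero) = b
    face-at (suc (suc zero)) = c
    face-at-position : ∀ {f} (i : OneOf a b c f) → f ≡ face-at (position i)
    face-at-position (inj₁ e) = e
    face-at-position (inj₂ (inj₁ e)) = e
    face-at-position (inj₂ (inj₂ e)) = e
    same : ∀ {f g} (i : OneOf a b c f) (j : OneOf a b c g) → position i ≡ position j → f ≡ g
    same i j e = trans (face-at-position i) (trans (cong face-at e) (≡-sym (face-at-position j)))

  -- The three edges shared by mutually adjacent faces a, b, c form a cut S.
  record Triangle (r : Fin n) (a b c : Fin F₀) : Set where
    field
      ab : Dart a b
      bc : Dart b c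
      ac : Dart a c
      S : Fin n → Bool
      S-root : S r ≡ false
      S-cut : ∀ {u v} → adj G u v ≡ true → d S u v ≡ hits ab u v xor (hits bc u v xor hits ac u v)

    cut-inside : ∀ {u v} → adj G u v ≡ true → d S u v ≡ true → OneOf a b c (ℓ u v) × OneOf a b c (ℓ v u)
    cut-inside {u} {v} uv cutting = pick (xor-true (trans (≡-sym (S-cut uv)) cutting))
      where
      is-a : ∀ {f} → f ≡ a → OneOf a b c f
      is-a = inj₁
      is-b : ∀ {f} → f ≡ b → OneOf a b c f
      is-b = inj₂ ∘ inj₁
      is-c : ∀ {f} → f ≡ c → OneOf a b c f
      is-c = inj₂ ∘ inj₂
      pick₂ : hits bc u v ≡ true ⊎ hits ac u v ≡ true → OneOf a b c (ℓ u v) × OneOf a b c (ℓ v u)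
      pick₂ (inj₁ h) = Sum.[ Prod.map is-b is-c , Prod.map is-c is-b ]′ (hits-sound bc h)
      pick₂ (inj₂ h) = Sum.[ Prod.map is-a is-c , Prod.map is-c is-a ]′ (hits-sound ac h)
      pick : hits ab u v ≡ true ⊎ hits bc u v xor hits ac u v ≡ true → OneOf a b c (ℓ u v) × OneOf a b c (ℓ v u)
      pick (inj₁ h) = Sum.[ Prod.map is-a is-b , Prod.map is-b is-a ]′ (hits-sound ab h)
      pick (inj₂ h) = pick₂ (xor-true h)

    cut-outside : ∀ {u v} → adj G u v ≡ true → OneOf a b c (ℓ u v) → OneOf a b c (ℓ v u) → d S u v ≡ true
    cut-outside {u} {v} uv = go uv
      where
      at-ab : ∀ {u v} → adj G u v ≡ true → ℓ u v ≡ a → ℓ v u ≡ b → d S u v ≡ true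
      at-ab uv refl refl = trans (S-cut uv) (cong₂ _xor_ (hits-complete ab uv refl refl)
        (cong₂ _xor_ (hits-miss bc (Dart-≢ ab) (Dart-≢ ac)) (hits-miss′ ac (Dart-≢ ab ∘ ≡-sym) (Dart-≢ bc))))
      at-bc : ∀ {u v} → adj G u v ≡ true → ℓ u v ≡ b → ℓ v u ≡ c → d S u v ≡ true
      at-bc uv refl refl = trans (S-cut uv) (cong₂ _xor_ (hits-miss′ ab (Dart-≢ ac ∘ ≡-sym) (Dart-≢ bc ∘ ≡-sym))
        (cong₂ _xor_ (hits-complete bc uv refl refl) (hits-miss ac (Dart-≢ ab ∘ ≡-sym) (Dart-≢ bc))))
      at-ac : ∀ {u v} → adj G u v ≡ true → ℓ u v ≡ a → ℓ v u ≡ c → d S u v ≡ true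
      at-ac uv refl refl = trans (S-cut uv) (cong₂ _xor_ (hits-miss′ ab (Dart-≢ ac ∘ ≡-sym) (Dart-≢ bc ∘ ≡-sym))
        (cong₂ _xor_ (hits-miss bc (Dart-≢ ab) (Dart-≢ ac)) (hits-complete ac uv refl refl)))
      flip : ∀ {u v} → d S v u ≡ true → d S u v ≡ true
      flip {u} {v} e = trans (xor-comm (S u) (S v)) e
      go : ∀ {u v} → adj G u v ≡ true → OneOf a b c (ℓ u v) → OneOf a b c (ℓ v u) → d S u v ≡ true
      go uv (inj₁ e) (inj₁ e′) = ⊥-elim (two-sided uv (trans e (≡-sym e′)))
      go uv (inj₂ (inj₁ e)) (inj₂ (inj₁ e′)) = ⊥-elim (two-sided uv (trans e (≡-sym e′)))
      go uv (inj₂ (inj₂ e)) (inj₂ (inj₂ e′)) = ⊥-elim (two-sided uv (trans e (≡-sym e′)))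
      go uv (inj₁ e) (inj₂ (inj₁ e′)) = at-ab uv e e′
      go uv (inj₁ e) (inj₂ (inj₂ e′)) = at-ac uv e e′
      go uv (inj₂ (inj₁ e)) (inj₁ e′) = flip (at-ab (adj-flip uv) e′ e)
      go uv (inj₂ (inj₁ e)) (inj₂ (inj₂ e′)) = at-bc uv e e′
      go uv (inj₂ (inj₂ e)) (inj₁ e′) = flip (at-ac (adj-flip uv) e′ e)
      go uv (inj₂ (inj₂ e)) (inj₂ (inj₁ e′)) = flip (at-bc (adj-flip uv) e′ e)

    flat-edge : ∀ {u v} → adj G u v ≡ true → ¬ OneOf a b c (ℓ u v) → S u ≡ S v
    flat-edge uv away = xor≡false⇒≡ (¬-not (away ∘ proj₁ ∘ cut-inside uv))

    -- Every cut edge has both sides among `a`, `b`, `c`. The boundary of any other face is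
    -- therefore uncut, and following its flags preserves `S`.
    flat-face : ∀ {u v u′ v′} → adj G u v ≡ true → adj G u′ v′ ≡ true → ℓ u v ≡ ℓ u′ v′ → ¬ OneOf a b c (ℓ u v) → S u ≡ S u′
    flat-face {u} {v} {u′} {v′} uv uv′ e away = along same-face on
      where
      f = ℓ u v
      face : Flag G → Fin F₀
      face = proj₁ faces
      start : Flag G
      start = flag u v true uv
      same-face : SameFace σ₀ start (flag u′ v′ true uv′)
      same-face = Equivalence.to (proj₁ (proj₂ faces) _ _) (trans (≡-sym (c₀-flag _)) (trans e (c₀-flag _)))
      on : face start ≡ f
      on = ≡-sym (c₀-flag start)
      step-flat : ∀ {x y} → FlagStep σ₀ x y → face x ≡ f → S (fv x) ≡ S (fv y)
      step-flat (τ₁ refl _ _ _) _ = refl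
      step-flat {flag p q true pq} {flag .q .p _ _} (τ₀ refl refl _) on-f =
        flat-edge pq (subst (¬_ ∘ OneOf a b c) (≡-sym (trans (c₀-flag (flag p q true pq)) on-f)) away)
      step-flat {flag p q false pq} {flag .q .p _ _} (τ₀ refl refl _) on-f =
        ≡-sym (flat-edge (adj-flip pq) (subst (¬_ ∘ OneOf a b c)
          (≡-sym (trans (≡-sym (ℓ-right pq)) (trans (c₀-flag (flag p q false pq)) on-f))) away))
      step-face : ∀ {x y} → FlagStep σ₀ x y → face x ≡ face y
      step-face s = Equivalence.from (proj₁ (proj₂ faces) _ _) (EqC.return s)
      along : ∀ {x y} → SameFace σ₀ x y → face x ≡ f → S (fv x) ≡ S (fv y)
      along ε _ = refl
      along (fwd s ◅ rest) on-f = trans (step-flat s on-f) (along rest (trans (≡-sym (step-face s)) on-f))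
      along (bwd s ◅ rest) on-f = trans (≡-sym (step-flat s (trans (step-face s) on-f))) (along rest (trans (step-face s) on-f))

  -- Each of `a`, `b`, `c` borders two of the three edges and every other face none, so the edges
  -- meet all boundaries evenly and `cut` applies.
  triangle : ∀ {a b c} → Dart a b → Dart b c → Dart a c → ∀ r → Triangle r a b c
  triangle {a} {b} {c} ab bc ac r = from-cut (cut L (isDart ab ∷ isDart bc ∷ isDart ac ∷ []) null r)
    where
    L : Darts
    L = (tail ab , head ab) ∷ (tail bc , head bc) ∷ (tail ac , head ac) ∷ []
    bd-dart : ∀ {f g} (D : Dart f g) y → bd y (tail D) (head D) ≡ y f xor y g
    bd-dart (dart _ _ _ refl refl) y = refl
    null : ∀ y → ev L (bd y) ≡ false
    null y = trans (cong₂ _xor_ (bd-dart ab y) (cong₂ _xor_ (bd-dart bc y) (cong (_xor false) (bd-dart ac y))))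
      (solve 3 (λ x y z → (x :+ y) :+ ((y :+ z) :+ ((x :+ z) :+ con false)) := con false) refl (y a) (y b) (y c))
      where open xor-∧-Solver
    from-cut : (∃ λ ψ → ψ r ≡ false × ∀ u v → adj G u v ≡ true → d ψ u v ≡ ev L (δ u v)) → Triangle r a b c
    from-cut (ψ , ψr , dψ) = record
      { ab = ab ; bc = bc ; ac = ac ; S = ψ ; S-root = ψr
      ; S-cut = λ {u} {v} uv → trans (dψ u v uv) (cong (λ x → hits ab u v xor (hits bc u v xor x)) (xor-identityʳ (hits ac u v))) }

  open Triangle public

  -- A clique X = {a, b, c, apex} of faces whose cut S at a, b, c separates the apex from the vertex r.
  record Apex (X : Fin F₀ → Set) (r : Fin n) (apex : Fin F₀) : Set where
    field
      {a b c} : Fin F₀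
      base△ : Triangle r a b c
      spoke-a : Dart apex a
      spoke-b : Dart apex b
      spoke-c : Dart apex c
      X-a : X a
      X-b : X b
      X-c : X c
      X-apex : X apex
      X-only : ∀ {f} → X f → OneOf a b c f ⊎ f ≡ apex
      separated : ∀ {u v} → adj G u v ≡ true → ℓ u v ≡ apex → S base△ u ≡ true

    apex-outside : ¬ OneOf a b c apex
    apex-outside = not-OneOf (Dart-≢ spoke-a) (Dart-≢ spoke-b) (Dart-≢ spoke-c)

    spoke : ∀ {f} → OneOf a b c f → Dart apex f
    spoke (inj₁ refl) = spoke-a
    spoke (inj₂ (inj₁ refl)) = spoke-b
    spoke (inj₂ (inj₂ refl)) = spoke-c

    X-base : ∀ {f} → OneOf a b c f → X f
    X-base (inj₁ refl) = X-a
    X-base (inj₂ (inj₁ refl)) = X-b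
    X-base (inj₂ (inj₂ refl)) = X-c

    apex-avoids-root : ∀ {u} → adj G r u ≡ true → ℓ r u ≢ apex
    apex-avoids-root ru e = true≢false (trans (≡-sym (separated ru e)) (S-root base△))

  -- `d` is outside the triangle, so by `flat-face` a single vertex of it decides the side of them
  -- all.
  apex-or-low : ∀ {X : Fin F₀ → Set} {r a b c d} → (da : Dart d a) → Dart d b → Dart d c →
                X a → X b → X c → X d → (∀ {f} → X f → OneOf a b c f ⊎ f ≡ d) →
                (T : Triangle r a b c) → Apex X r d ⊎ (∀ {u v} → adj G u v ≡ true → ℓ u v ≡ d → S T u ≡ false)
  apex-or-low {X} {r} {a} {b} {c} {d} da db dc xa xb xc xd only T = decide (S T (tail da)) refl
    where
    outside : ¬ OneOf a b c d
    outside = not-OneOf (Dart-≢ da) (Dart-≢ db) (Dart-≢ dc)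
    level : ∀ {u v} → adj G u v ≡ true → ℓ u v ≡ d → S T u ≡ S T (tail da)
    level uv e = flat-face T uv (isDart da) (trans e (≡-sym (left da))) (outside ∘ subst (OneOf a b c) e)
    decide : ∀ s → S T (tail da) ≡ s → Apex X r d ⊎ (∀ {u v} → adj G u v ≡ true → ℓ u v ≡ d → S T u ≡ false)
    decide true e = inj₁ (record { base△ = T ; spoke-a = da ; spoke-b = db ; spoke-c = dc ; X-a = xa ; X-b = xb ; X-c = xc
                                 ; X-apex = xd ; X-only = only ; separated = λ uv e′ → trans (level uv e′) e })
    decide false e = inj₂ (λ uv e′ → trans (level uv e′) e)

  -- If for each member of the clique the opposite triangle left it on the side of r, then Sa + Sb + Sc + Sd
  -- would vanish and Sc ∧ Sd would change across the edge ab only, which a cut cannot do.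
  apex-exists : ∀ {X : Fin F₀ → Set} {a b c d′} → Dart a b → Dart a c → Dart a d′ → Dart b c → Dart b d′ → Dart c d′ →
                X a → X b → X c → X d′ → (∀ {f} → X f → f ≡ a ⊎ f ≡ b ⊎ f ≡ c ⊎ f ≡ d′) → ∀ r → ∃ (Apex X r)
  apex-exists {X} {a} {b} {c} {d′} ab ac ad bc bd′ cd xa xb xc xd only r =
    pick (apex-or-low (Dart-sym ad) (Dart-sym bd′) (Dart-sym cd) xa xb xc xd (λ x → case-d (only x)) Td)
         (apex-or-low (Dart-sym ac) (Dart-sym bc) cd xa xb xd xc (λ x → case-c (only x)) Tc)
         (apex-or-low (Dart-sym ab) bc bd′ xa xc xd xb (λ x → case-b (only x)) Tb)
         (apex-or-low ab ac ad xb xc xd xa (λ x → case-a (only x)) Ta)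
    where
    Td : Triangle r a b c
    Td = triangle ab bc ac r
    Tc : Triangle r a b d′
    Tc = triangle ab bd′ ad r
    Tb : Triangle r a c d′
    Tb = triangle ac cd ad r
    Ta : Triangle r b c d′
    Ta = triangle bc cd bd′ r
    case-d : ∀ {f} → f ≡ a ⊎ f ≡ b ⊎ f ≡ c ⊎ f ≡ d′ → OneOf a b c f ⊎ f ≡ d′
    case-d (inj₁ e) = inj₁ (inj₁ e)
    case-d (inj₂ (inj₁ e)) = inj₁ (inj₂ (inj₁ e))
    case-d (inj₂ (inj₂ (inj₁ e))) = inj₁ (inj₂ (inj₂ e))
    case-d (inj₂ (inj₂ (inj₂ e))) = inj₂ e
    case-c : ∀ {f} → f ≡ a ⊎ f ≡ b ⊎ f ≡ c ⊎ f ≡ d′ → OneOf a b d′ f ⊎ f ≡ c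
    case-c (inj₁ e) = inj₁ (inj₁ e)
    case-c (inj₂ (inj₁ e)) = inj₁ (inj₂ (inj₁ e))
    case-c (inj₂ (inj₂ (inj₁ e))) = inj₂ e
    case-c (inj₂ (inj₂ (inj₂ e))) = inj₁ (inj₂ (inj₂ e))
    case-b : ∀ {f} → f ≡ a ⊎ f ≡ b ⊎ f ≡ c ⊎ f ≡ d′ → OneOf a c d′ f ⊎ f ≡ b
    case-b (inj₁ e) = inj₁ (inj₁ e)
    case-b (inj₂ (inj₁ e)) = inj₂ e
    case-b (inj₂ (inj₂ (inj₁ e))) = inj₁ (inj₂ (inj₁ e))
    case-b (inj₂ (inj₂ (inj₂ e))) = inj₁ (inj₂ (inj₂ e))
    case-a : ∀ {f} → f ≡ a ⊎ f ≡ b ⊎ f ≡ c ⊎ f ≡ d′ → OneOf b c d′ f ⊎ f ≡ a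
    case-a (inj₁ e) = inj₂ e
    case-a (inj₂ (inj₁ e)) = inj₁ (inj₁ e)
    case-a (inj₂ (inj₂ (inj₁ e))) = inj₁ (inj₂ (inj₁ e))
    case-a (inj₂ (inj₂ (inj₂ e))) = inj₁ (inj₂ (inj₂ e))
    Low : ∀ {x y z} → Triangle r x y z → Fin F₀ → Set
    Low T f = ∀ {u v} → adj G u v ≡ true → ℓ u v ≡ f → S T u ≡ false
    absurd : Low Td d′ → Low Tc c → Low Tb b → Low Ta a → ⊥
    absurd low-d low-c low-b low-a = at-ab ab
      where
      Sa = S Ta
      Sb = S Tb
      Sc = S Tc
      Sd = S Td
      W Y : Fin n → Bool
      W v = (Sd v xor Sc v) xor (Sb v xor Sa v)
      Y v = Sc v ∧ Sd v
      -- Each of the six edges of the clique belongs to exactly two of the four triangles, so the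
      -- four cuts cancel.
      W-level : ∀ u v → adj G u v ≡ true → W u ≡ W v
      W-level u v uv = xor≡false⇒≡ (begin
        d W u v
          ≡⟨ solve 8 (λ s t x y s′ t′ x′ y′ → ((s :+ t) :+ (x :+ y)) :+ ((s′ :+ t′) :+ (x′ :+ y′))
                     := ((s :+ s′) :+ (t :+ t′)) :+ ((x :+ x′) :+ (y :+ y′))) refl
               (Sd u) (Sc u) (Sb u) (Sa u) (Sd v) (Sc v) (Sb v) (Sa v) ⟩
        (d Sd u v xor d Sc u v) xor (d Sb u v xor d Sa u v)
          ≡⟨ cong₂ _xor_ (cong₂ _xor_ (S-cut Td uv) (S-cut Tc uv)) (cong₂ _xor_ (S-cut Tb uv) (S-cut Ta uv)) ⟩
        _
          ≡⟨ solve 6 (λ x y z s t w → ((x :+ (s :+ y)) :+ (x :+ (t :+ z))) :+ ((y :+ (w :+ z)) :+ (s :+ (w :+ t))) := con false) refl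
               (hits ab u v) (hits ac u v) (hits ad u v) (hits bc u v) (hits bd′ u v) (hits cd u v) ⟩
        false ∎)
        where
        open ≡-Reasoning
        open xor-∧-Solver
      W-root : W r ≡ false
      W-root = cong₂ _xor_ (cong₂ _xor_ (S-root Td) (S-root Tc)) (cong₂ _xor_ (S-root Tb) (S-root Ta))
      balance : ∀ v → Sa v ≡ false → Sb v ≡ false → Sd v ≡ Sc v
      balance v ea eb = xor≡false⇒≡ (trans (≡-sym (xor-identityʳ (Sd v xor Sc v)))
        (trans (cong ((Sd v xor Sc v) xor_) (≡-sym (cong₂ _xor_ eb ea))) (trans (constant W W-level v r) W-root)))
      at-ab : Dart a b → ⊥
      at-ab (dart p q pq ea eb) = no-other (other-on-face Y pq Y-cuts)
        where
        qp : adj G q p ≡ true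
        qp = adj-flip pq
        a-away : ¬ OneOf b c d′ (ℓ p q)
        a-away = not-OneOf (Dart-≢ ab) (Dart-≢ ac) (Dart-≢ ad) ∘ subst (OneOf b c d′) ea
        b-away : ¬ OneOf a c d′ (ℓ q p)
        b-away = not-OneOf (Dart-≢ ab ∘ ≡-sym) (Dart-≢ bc) (Dart-≢ bd′) ∘ subst (OneOf a c d′) eb
        Sa-p : Sa p ≡ false
        Sa-p = low-a pq ea
        Sa-q : Sa q ≡ false
        Sa-q = trans (≡-sym (flat-edge Ta pq a-away)) Sa-p
        Sb-q : Sb q ≡ false
        Sb-q = low-b qp eb
        Sb-p : Sb p ≡ false
        Sb-p = trans (≡-sym (flat-edge Tb qp b-away)) Sb-q
        -- `Sa` and `Sb` vanish at both ends of the edge between `a` and `b`: each of these faces is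
        -- low for the opposite triangle and flat in it. Hence `Y` agrees there with `Sc`, which the
        -- edge does cut.
        Y≡Sc : ∀ v → Sa v ≡ false → Sb v ≡ false → Y v ≡ Sc v
        Y≡Sc v ea eb = trans (cong (Sc v ∧_) (balance v ea eb)) (Bool.∧-idem (Sc v))
        Y-cuts : d Y p q ≡ true
        Y-cuts = trans (cong₂ _xor_ (Y≡Sc p Sa-p Sb-p) (Y≡Sc q Sa-q Sb-q)) (cut-outside Tc pq (inj₁ ea) (inj₂ (inj₁ eb)))
        no-other : ¬ ∃₂ λ u v → adj G u v ≡ true × ℓ u v ≡ ℓ p q × d Y u v ≡ true × ℓ v u ≢ ℓ q p
        no-other (u , v , uv , e , Yuv , ne) = split (d Sc u v) (d Sd u v) refl refl
          where
          vu : adj G v u ≡ true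
          vu = adj-flip uv
          Y-low : (Sc u ≡ false × Sc v ≡ false) ⊎ (Sd u ≡ false × Sd v ≡ false) → ⊥
          Y-low (inj₁ (i , j)) = true≢false (trans (≡-sym Yuv) (cong₂ (λ s t → (s ∧ Sd u) xor (t ∧ Sd v)) i j))
          Y-low (inj₂ (i , j)) = true≢false (trans (≡-sym Yuv)
            (cong₂ _xor_ (trans (cong (Sc u ∧_) i) (∧-zeroʳ (Sc u))) (trans (cong (Sc v ∧_) j) (∧-zeroʳ (Sc v)))))
          on-c : ℓ v u ≡ c → ⊥
          on-c e′ = Y-low (inj₁ (trans (≡-sym (flat-edge Tc vu away)) (low-c vu e′) , low-c vu e′))
            where
            away : ¬ OneOf a b d′ (ℓ v u)
            away = not-OneOf (Dart-≢ ac ∘ ≡-sym) (Dart-≢ bc ∘ ≡-sym) (Dart-≢ cd) ∘ subst (OneOf a b d′) e′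
          on-d : ℓ v u ≡ d′ → ⊥
          on-d e′ = Y-low (inj₂ (trans (≡-sym (flat-edge Td vu away)) (low-d vu e′) , low-d vu e′))
            where
            away : ¬ OneOf a b c (ℓ v u)
            away = not-OneOf (Dart-≢ ad ∘ ≡-sym) (Dart-≢ bd′ ∘ ≡-sym) (Dart-≢ cd ∘ ≡-sym) ∘ subst (OneOf a b c) e′
          not-a : ℓ v u ≢ a
          not-a e′ = two-sided uv (trans (trans e ea) (≡-sym e′))
          not-b : ℓ v u ≢ b
          not-b e′ = ne (trans e′ (≡-sym eb))
          -- A change of `Sc` puts `d′` across the edge, a change of `Sd` puts `c` there. Either
          -- face is low and flat for its opposite triangle, so one factor of `Y` is false at both
          -- ends and `Y` does not change.
          split : ∀ s t → d Sc u v ≡ s → d Sd u v ≡ t → ⊥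
          split true _ i _ = Sum.[ not-a , Sum.[ not-b , on-d ]′ ]′ (proj₂ (cut-inside Tc uv i))
          split false true _ j = Sum.[ not-a , Sum.[ not-b , on-c ]′ ]′ (proj₂ (cut-inside Td uv j))
          split false false i j = true≢false (trans (≡-sym Yuv)
            (≡⇒xor≡false (cong₂ _∧_ (xor≡false⇒≡ {Sc u} i) (xor≡false⇒≡ {Sd u} j))))
    pick : Apex X r d′ ⊎ Low Td d′ → Apex X r c ⊎ Low Tc c → Apex X r b ⊎ Low Tb b → Apex X r a ⊎ Low Ta a → ∃ (Apex X r)
    pick (inj₁ x) _ _ _ = d′ , x
    pick _ (inj₁ x) _ _ = c , x
    pick _ _ (inj₁ x) _ = b , x
    pick _ _ _ (inj₁ x) = a , x
    pick (inj₂ low-d) (inj₂ low-c) (inj₂ low-b) (inj₂ low-a) = ⊥-elim (absurd low-d low-c low-b low-a)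

  -- A fifth face adjacent to all of K₄ would touch both sides of a separating triangle without crossing it.
  no-K₅ : ∀ {a b c d e} → Dart a b → Dart a c → Dart a d → Dart b c → Dart b d → Dart c d →
          Dart e a → Dart e b → Dart e c → Dart e d → ⊥
  no-K₅ {a} {b} {c} {d} {e} ab ac ad bc bd′ cd ea eb ec ed =
    -- The vertex `r` is taken on `e`, so all of `e` is on its side; yet `e` shares an edge with the
    -- apex, which is on the other side.
    refute (apex-exists ab ac ad bc bd′ cd (inj₁ refl) (inj₂ (inj₁ refl)) (inj₂ (inj₂ (inj₁ refl))) (inj₂ (inj₂ (inj₂ refl))) (λ x → x) (tail ea))
    where
    X : Fin F₀ → Set
    X f = f ≡ a ⊎ f ≡ b ⊎ f ≡ c ⊎ f ≡ d
    ray : ∀ {f} → X f → Dart e f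
    ray (inj₁ refl) = ea
    ray (inj₂ (inj₁ refl)) = eb
    ray (inj₂ (inj₂ (inj₁ refl))) = ec
    ray (inj₂ (inj₂ (inj₂ refl))) = ed
    refute : ¬ ∃ (Apex X (tail ea))
    refute (t , x) = true≢false (trans (≡-sym at-head) (trans (≡-sym across) (trans along (S-root base△))))
      where
      open Apex x
      D : Dart e t
      D = ray X-apex
      away : ¬ OneOf (Apex.a x) (Apex.b x) (Apex.c x) (ℓ (tail D) (head D))
      away i = Dart-≢ (ray (X-base i)) (≡-sym (left D))
      along : S base△ (tail D) ≡ S base△ (tail ea)
      along = flat-face base△ (isDart D) (isDart ea) (trans (left D) (≡-sym (left ea))) away
      across : S base△ (tail D) ≡ S base△ (head D)
      across = flat-edge base△ (isDart D) away
      at-head : S base△ (head D) ≡ true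
      at-head = separated (adj-flip (isDart D)) (right D)

  -- Cliques with a common apex

  outer : (s s′ : Fin n → Bool) → Fin n → Bool
  outer s s′ v = not (s v) ∧ not (s′ v)

  -- Suppose the edge leaves the outer region without crossing the first triangle's cut. Then it
  -- crosses the second's, and both its faces are in the second base, hence adjacent to the common
  -- apex `t`. Such a face outside the first triangle would lie on the apex's side throughout, but
  -- it has an end of this edge on the side of `r`. So both faces are in the first triangle, and the
  -- edge crosses its cut after all.
  crosses : ∀ {X X′ : Fin F₀ → Set} {r t} (x : Apex X r t) (x′ : Apex X′ r t) {u v} → adj G u v ≡ true →
            d (outer (S (Apex.base△ x)) (S (Apex.base△ x′))) u v ≡ true →
            OneOf (Apex.a x) (Apex.b x) (Apex.c x) (ℓ u v) × OneOf (Apex.a x) (Apex.b x) (Apex.c x) (ℓ v u)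
  crosses {t = t} x x′ {u} {v} uv change = cut-inside A.base△ uv (decide (d s u v) refl)
    where
    module A = Apex x
    module A′ = Apex x′
    s = S A.base△
    s′ = S A′.base△
    sides : s u ≡ s v → s u ≡ false × d s′ u v ≡ true
    sides e = read (s u) (s v) (s′ u) (s′ v) e change
      where
      read : ∀ b c b′ c′ → b ≡ c → (not b ∧ not b′) xor (not c ∧ not c′) ≡ true → b ≡ false × b′ xor c′ ≡ true
      read false .false true false refl _ = refl , refl
      read false .false false true refl _ = refl , refl
    module _ (e : s u ≡ s v) where
      on-base : ∀ {p q} → adj G p q ≡ true → OneOf A′.a A′.b A′.c (ℓ p q) → s p ≡ false → OneOf A.a A.b A.c (ℓ p q)
      on-base {p} {q} pq i low = dec (OneOf? A.a A.b A.c (ℓ p q))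
        where
        dec : Dec (OneOf A.a A.b A.c (ℓ p q)) → OneOf A.a A.b A.c (ℓ p q)
        dec (yes j) = j
        dec (no away) = contradiction (trans (≡-sym high) low) true≢false
          where
          D : Dart t (ℓ p q)
          D = A′.spoke i
          high : s p ≡ true
          high = trans (flat-face A.base△ pq (adj-flip (isDart D)) (≡-sym (right D)) away)
            (trans (≡-sym (flat-edge A.base△ (isDart D) (A.apex-outside ∘ subst (OneOf A.a A.b A.c) (left D))))
                   (A.separated (isDart D) (left D)))
      impossible : d s u v ≡ true
      impossible = cut-outside A.base△ uv (on-base uv (proj₁ ends) low) (on-base (adj-flip uv) (proj₂ ends) (trans (≡-sym e) low))
        where
        low = proj₁ (sides e)
        ends = cut-inside A′.base△ uv (proj₂ (sides e))
    decide : ∀ b → d s u v ≡ b → d s u v ≡ true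
    decide true e = e
    decide false e = impossible (xor≡false⇒≡ e)

  -- The edges leaving the region outside both cuts belong to both triangles; if there is one such edge there are
  -- three, since each face boundary meets a cut evenly, and then the triangles coincide.
  apex-injective : ∀ {X X′ : Fin F₀ → Set} {r t} → Apex X r t → Apex X′ r t → ∀ {f} → X f → X′ f
  apex-injective {X} {X′} {r} {t} x x′ = include
    where
    module A = Apex x
    module A′ = Apex x′
    W : Fin n → Bool
    W = outer (S A.base△) (S A′.base△)
    crosses′ : ∀ {u v} → adj G u v ≡ true → d W u v ≡ true → OneOf A′.a A′.b A′.c (ℓ u v) × OneOf A′.a A′.b A′.c (ℓ v u)
    crosses′ {u} {v} uv cutting = crosses x′ x uv (trans (cong₂ _xor_ (Bool.∧-comm (not (S A′.base△ u)) _) (Bool.∧-comm (not (S A′.base△ v)) _)) cutting)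
    D : Dart t A.a
    D = A.spoke-a
    W-root : W r ≡ true
    W-root = cong₂ (λ b c → not b ∧ not c) (S-root A.base△) (S-root A′.base△)
    W-apex : W (tail D) ≡ false
    W-apex = cong (λ b → not b ∧ not (S A′.base△ (tail D))) (A.separated (isDart D) (left D))
    base-included : ∀ {f} → OneOf A.a A.b A.c f → OneOf A′.a A′.b A′.c f
    base-included = at-change (change W {r} {tail D} λ e → true≢false (trans (≡-sym W-root) (trans e W-apex)))
      where
      at-change : (∃₂ λ p q → adj G p q ≡ true × W p ≢ W q) → ∀ {f} → OneOf A.a A.b A.c f → OneOf A′.a A′.b A′.c f
      at-change (u , v , uv , ne) {f} = third (other-on-face W uv cutting)
        where
        cutting : d W u v ≡ true
        cutting = ≢⇒xor≡true ne
        third : (∃₂ λ u′ v′ → adj G u′ v′ ≡ true × ℓ u′ v′ ≡ ℓ u v × d W u′ v′ ≡ true × ℓ v′ u′ ≢ ℓ v u) →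
                OneOf A.a A.b A.c f → OneOf A′.a A′.b A′.c f
        third (u′ , v′ , uv′ , e , cutting′ , ne′) i = transport (OneOf-full (proj₁ T₁) (proj₂ T₁) (proj₂ T₂)
            (two-sided uv) (λ e′ → two-sided uv′ (trans e e′)) (ne′ ∘ ≡-sym) i)
          where
          T₁ = crosses x x′ uv cutting
          T₂ = crosses x x′ uv′ cutting′
          transport : OneOf (ℓ u v) (ℓ v u) (ℓ v′ u′) f → OneOf A′.a A′.b A′.c f
          transport (inj₁ refl) = proj₁ (crosses′ uv cutting)
          transport (inj₂ (inj₁ refl)) = proj₂ (crosses′ uv cutting)
          transport (inj₂ (inj₂ refl)) = proj₂ (crosses′ uv′ cutting′)
    include : ∀ {f} → X f → X′ f
    include xf = Sum.[ A′.X-base ∘ base-included , (λ { refl → A′.X-apex }) ]′ (A.X-only xf)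

  -- Normal forms of schemes and the classification of twisted sets

  lo hi : Fin (edgeCount G) → Fin n
  lo k = proj₁ (edge G k)
  hi k = proj₂ (edge G k)

  edge-adj : ∀ k → adj G (lo k) (hi k) ≡ true
  edge-adj k = proj₁ (below-sound G (edge-below G k))

  edge-cover : ∀ {u v} → adj G u v ≡ true → ∃ λ k → SameEdge G u v (lo k) (hi k)
  edge-cover {u} {v} uv = pick (below-total G uv)
    where
    pick : below G u v ≡ true ⊎ below G v u ≡ true → ∃ λ k → SameEdge G u v (lo k) (hi k)
    pick (inj₁ b) = let k , e = edge-onto G u v b in k , inj₁ (≡-sym (cong proj₁ e) , ≡-sym (cong proj₂ e))
    pick (inj₂ b) = let k , e = edge-onto G v u b in k , inj₂ (≡-sym (cong proj₂ e) , ≡-sym (cong proj₁ e))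

  edge-same : ∀ {k l} → SameEdge G (lo k) (hi k) (lo l) (hi l) → k ≡ l
  edge-same (inj₁ (e , e′)) = edge-injective G (cong₂ _,_ e e′)
  edge-same {k} {l} (inj₂ (e , e′)) = contradiction (proj₂ (below-sound G (edge-below G l)))
    (ℕ.<-asym (subst (Fin._< lo l) e (subst (lo k Fin.<_) e′ (proj₂ (below-sound G (edge-below G k))))))

  module _ (σ : Scheme G) where

    -- One neighbour is a sufficient test: two cyclic orders of three elements that differ anywhere
    -- are inverse to each other.
    reverse : Fin n → Bool
    reverse v = not (rot σ v (nbr v zero) == rot σ₀ v (nbr v zero))

    twist : EdgeFn
    twist u v = (sig σ u v xor reverse u) xor reverse v

    twist-even : ∀ u v → twist u v ≡ twist v u
    twist-even u v = trans (xor-assoc (sig σ u v) (reverse u) (reverse v))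
      (trans (cong₂ _xor_ (sig-sym σ u v) (xor-comm (reverse u) (reverse v))) (≡-sym (xor-assoc (sig σ v u) (reverse v) (reverse u))))

    normal-form : Switch twist σ
    normal-form = record
      { at = reverse
      ; same-rot = λ v u vu e → rot-agree σ σ₀ (nbr-adj v zero) (==⇒≡ (not-injective e)) vu
      ; reversed-rot = λ v u vu e → rot-reverse σ₀ σ (nbr-adj v zero) (==⇒≢ (not-injective {y = false} e) ∘ ≡-sym) vu
      ; signature = λ _ _ _ → refl }

  -- Both schemes switch to the same normal form. Following one switch by the inverse of the other
  -- switches exactly the vertices reversed in one of them only.
  equivalent : ∀ σ τ → (∀ u v → adj G u v ≡ true → twist σ u v ≡ twist τ u v) → Equivalent σ τ
  equivalent σ τ same = (λ v → reverse σ v xor reverse τ v) , rotations , signatures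
    where
    back : ∀ {v u} → adj G v u ≡ true → ∃ λ w → adj G v w ≡ true × rot σ₀ v w ≡ u
    back {v} {u} vu = _ , rot-adj σ₀ v _ (rot-adj σ₀ v u vu) , rot³ σ₀ vu
    module N (σ : Scheme G) = Switch (normal-form σ)
    inverse : ∀ σ {v u} (vu : adj G v u ≡ true) → reverse σ v ≡ true → rot σ v u ≡ proj₁ (back vu)
    inverse σ {v} vu e = let w , vw , f = back vu in trans (cong (rot σ v) (≡-sym f)) (N.reversed-rot σ v w vw e)
    rotations : ∀ v u → adj G v u ≡ true →
                if reverse σ v xor reverse τ v then rot τ v (rot σ v u) ≡ u else rot τ v u ≡ rot σ v u
    rotations v u vu = cases (reverse σ v) (reverse τ v) refl refl
      where
      vσu : adj G v (rot σ v u) ≡ true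
      vσu = rot-adj σ v u vu
      cases : ∀ b c → reverse σ v ≡ b → reverse τ v ≡ c → if b xor c then rot τ v (rot σ v u) ≡ u else rot τ v u ≡ rot σ v u
      cases false false e f = trans (N.same-rot τ v u vu f) (≡-sym (N.same-rot σ v u vu e))
      cases true true e f = trans (inverse τ vu f) (≡-sym (inverse σ vu e))
      cases true false e f = trans (N.same-rot τ v _ vσu f) (trans (cong (rot σ₀ v) (inverse σ vu e)) (rot³ σ₀ vu))
      cases false true e f = trans (cong (rot τ v) (N.same-rot σ v u vu e)) (N.reversed-rot τ v u vu f)
    signatures : ∀ u v → adj G u v ≡ true →
                 sig τ u v ≡ (sig σ u v xor (reverse σ u xor reverse τ u)) xor (reverse σ v xor reverse τ v)
    signatures u v uv = begin
      sig τ u v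
        ≡⟨ solve 3 (λ s a b → s := (((s :+ a) :+ b) :+ a) :+ b) refl (sig τ u v) (reverse τ u) (reverse τ v) ⟩
      (twist τ u v xor reverse τ u) xor reverse τ v
        ≡⟨ cong (λ t → (t xor reverse τ u) xor reverse τ v) (same u v uv) ⟨
      (twist σ u v xor reverse τ u) xor reverse τ v
        ≡⟨ solve 5 (λ s a b a′ b′ → (((s :+ a) :+ b) :+ a′) :+ b′ := (s :+ (a :+ a′)) :+ (b :+ b′)) refl
             (sig σ u v) (reverse σ u) (reverse σ v) (reverse τ u) (reverse τ v) ⟩
      (sig σ u v xor (reverse σ u xor reverse τ u)) xor (reverse σ v xor reverse τ v) ∎
      where
      open ≡-Reasoning
      open xor-∧-Solver

  -- A colouring is constant on each face of `σ`, so different colours sit on different faces.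
  faces-finest : ∀ {A σ F F′} → Switch A σ → HasFaces σ F → Colouring A F′ → F′ ≤ F
  faces-finest {A} {σ} {F} {F′} w (c , same , _) k = Fin.injective⇒≤ {f = face} injective
    where
    sample : Fin F′ → Flag G
    sample i = let v , u , s , vu , _ = onto k i in flag v u (s xor at w v) vu
    face : Fin F′ → Fin F
    face = c ∘ sample
    recolour : Flag G → Fin F′
    recolour x = col k (fv x) (fu x) (side x xor at w (fv x))
    recolour-sample : ∀ i → recolour (sample i) ≡ i
    recolour-sample i = let v , u , s , vu , e = onto k i in
      trans (cong (col k v u) (xor-cancelʳ s (at w v))) e
    injective : ∀ {i j} → face i ≡ face j → i ≡ j
    injective {i} {j} e = trans (≡-sym (recolour-sample i))
      (trans (colour-invariant w k (Equivalence.to (same (sample i) (sample j)) e)) (recolour-sample j))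

  data Shape (A : EdgeFn) (X : Fin F₀ → Set) : Set where
    single : ∀ k → A (lo k) (hi k) ≡ true → (∀ l → A (lo l) (hi l) ≡ true → l ≡ k) → Shape A X
    quad : ∀ t → Apex X root t → Shape A X

  module Shapes (A : EdgeFn) (A-even : ∀ u v → A u v ≡ A v u) {F : ℕ} (k : Colouring A F)
                (euler₁ : n + F ≡ edgeCount G + 1) (maximal : ∀ {F′} → Colouring A F′ → F′ ≤ F) where
    open Twisted A A-even k euler₁ public

    A-edge : ∀ {u v k} → SameEdge G u v (lo k) (hi k) → A u v ≡ A (lo k) (hi k)
    A-edge (inj₁ (refl , refl)) = refl
    A-edge (inj₂ (refl , refl)) = A-even _ _

    twisted-edge : ∃ λ k → A (lo k) (hi k) ≡ true
    twisted-edge = decide (any? (λ k → A (lo k) (hi k) Bool.≟ true))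
      where
      decide : Dec (∃ λ k → A (lo k) (hi k) ≡ true) → ∃ λ k → A (lo k) (hi k) ≡ true
      decide (yes found) = found
      -- Without a twisted edge the plane colouring would be a colouring for `A`, with one class
      -- more than there are faces.
      decide (no none) = contradiction (maximal untwisted-colouring) (ℕ.<⇒≱ F<F₀)
        where
        A≡false : ∀ u v → adj G u v ≡ true → A u v ≡ false
        A≡false u v uv = let l , same = edge-cover uv in ¬-not (λ e → none (l , trans (≡-sym (A-edge same)) e))
        untwisted-colouring : Colouring A F₀
        untwisted-colouring = record
          { col = col c₀
          ; corner = corner c₀
          ; cross = λ v u s vu → trans (cong (λ b → col c₀ u v (if b then s else not s)) (A≡false v u vu)) (cross c₀ v u s vu)
          ; onto = onto c₀ }
        F<F₀ : F < F₀
        F<F₀ = ℕ.+-cancelˡ-< n F F₀ (ℕ.≤-reflexive (trans (cong suc euler₁) (trans (≡-sym (ℕ.+-suc (edgeCount G) 1)) (≡-sym euler))))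

    Twist-dart : ∀ {f g} → Twist f g → Dart f g
    Twist-dart (p , q , pq , _ , e , e′) = dart p q pq e e′

    twisted-left : ∀ {u v} → adj G u v ≡ true → A u v ≡ true → TwistedFace (ℓ u v)
    twisted-left {u} {v} uv a = ℓ v u , u , v , uv , a , refl , refl

    twisted-right : ∀ {u v} → adj G u v ≡ true → A u v ≡ true → TwistedFace (ℓ v u)
    twisted-right {u} {v} uv a = twisted-left (adj-flip uv) (trans (A-even v u) a)

    -- `clique` provides a twisted edge between the two faces, and `ℓ-unique` identifies it with
    -- `uv`. Thus the set of twisted faces determines `A`.
    twisted-between : ∀ {u v} → adj G u v ≡ true → TwistedFace (ℓ u v) → TwistedFace (ℓ v u) → A u v ≡ true
    twisted-between {u} {v} uv xu xv = from (clique xu xv (two-sided uv))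
      where
      from : Twist (ℓ u v) (ℓ v u) → A u v ≡ true
      from (p , q , pq , a , e , e′) = identify (ℓ-unique pq uv e e′)
        where
        identify : p ≡ u × q ≡ v → A u v ≡ true
        identify (refl , refl) = a

    shape : Shape A TwistedFace
    shape = from twisted-edge
      where
      from : (∃ λ k → A (lo k) (hi k) ≡ true) → Shape A TwistedFace
      from (k , a) = decide (any? (λ l → ¬? (l ≟ k) ×-dec A (lo l) (hi l) Bool.≟ true))
        where
        p = lo k
        q = hi k
        pq : adj G p q ≡ true
        pq = edge-adj k
        f g : Fin F₀
        f = ℓ p q
        g = ℓ q p
        fg : Twist f g
        fg = p , q , pq , a , refl , refl
        xf : TwistedFace f
        xf = g , fg
        xg : TwistedFace g
        xg = f , Twist-sym fg
        -- `f` and `g` share only the edge `k`, so a further twisted edge has a side that is neither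
        -- of them.
        third-face : ∀ {l} → l ≢ k → A (lo l) (hi l) ≡ true → ∃ λ h → h ≢ f × h ≢ g × TwistedFace h
        third-face {l} l≢k b = pick (ℓ u v ≟ f) (ℓ u v ≟ g) (ℓ v u ≟ f) (ℓ v u ≟ g)
          where
          u = lo l
          v = hi l
          uv : adj G u v ≡ true
          uv = edge-adj l
          pick : Dec (ℓ u v ≡ f) → Dec (ℓ u v ≡ g) → Dec (ℓ v u ≡ f) → Dec (ℓ v u ≡ g) →
                 ∃ λ h → h ≢ f × h ≢ g × TwistedFace h
          pick (no ne) (no ne′) _ _ = ℓ u v , ne , ne′ , twisted-left uv b
          pick _ _ (no ne) (no ne′) = ℓ v u , ne , ne′ , twisted-right uv b
          pick (yes e) _ _ (yes e′) = contradiction (edge-same (inj₁ (ℓ-unique uv pq e e′))) l≢k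
          pick _ (yes e) (yes e′) _ = contradiction (edge-same (inj₂ (ℓ-unique uv (adj-flip pq) e e′))) l≢k
          pick (yes e) _ (yes e′) _ = contradiction (trans e (≡-sym e′)) (two-sided uv)
          pick _ (yes e) _ (yes e′) = contradiction (trans e (≡-sym e′)) (two-sided uv)
        decide : Dec (∃ λ l → l ≢ k × A (lo l) (hi l) ≡ true) → Shape A TwistedFace
        decide (no none) = single k a (λ l b → unique l b (l ≟ k))
          where
          unique : ∀ l → A (lo l) (hi l) ≡ true → Dec (l ≡ k) → l ≡ k
          unique l b (yes e) = e
          unique l b (no ne) = contradiction (l , ne , b) none
        decide (yes (l , l≢k , b)) = from-third (third-face l≢k b)
          where
          from-third : (∃ λ h → h ≢ f × h ≢ g × TwistedFace h) → Shape A TwistedFace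
          from-third (h , h≢f , h≢g , xh) = from-fourth (fourth fg xh (h≢f ∘ ≡-sym) (h≢g ∘ ≡-sym))
            where
            side-of : ∀ {x y} → TwistedFace x → TwistedFace y → x ≢ y → Dart x y
            side-of xx xy ne = Twist-dart (clique xx xy ne)
            from-fourth : (∃ λ k → k ≢ f × k ≢ h × k ≢ g × TwistedFace k) → Shape A TwistedFace
            from-fourth (i , i≢f , i≢h , i≢g , xi) = quad (proj₁ apex) (proj₂ apex)
              where
              fg′ = Twist-dart fg
              fh = side-of xf xh (h≢f ∘ ≡-sym)
              fi = side-of xf xi (i≢f ∘ ≡-sym)
              gh = side-of xg xh (h≢g ∘ ≡-sym)
              gi = side-of xg xi (i≢g ∘ ≡-sym)
              hi′ = side-of xh xi (i≢h ∘ ≡-sym)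
              only : ∀ {x} → TwistedFace x → x ≡ f ⊎ x ≡ g ⊎ x ≡ h ⊎ x ≡ i
              only {x} xx = which (x ≟ f) (x ≟ g) (x ≟ h) (x ≟ i)
                where
                which : Dec (x ≡ f) → Dec (x ≡ g) → Dec (x ≡ h) → Dec (x ≡ i) → x ≡ f ⊎ x ≡ g ⊎ x ≡ h ⊎ x ≡ i
                which (yes e) _ _ _ = inj₁ e
                which _ (yes e) _ _ = inj₂ (inj₁ e)
                which _ _ (yes e) _ = inj₂ (inj₂ (inj₁ e))
                which _ _ _ (yes e) = inj₂ (inj₂ (inj₂ e))
                -- By `clique`, a fifth twisted face would be adjacent to the other four.
                which (no x≢f) (no x≢g) (no x≢h) (no x≢i) =
                  ⊥-elim (no-K₅ fg′ fh fi gh gi hi′ (side-of xx xf x≢f) (side-of xx xg x≢g) (side-of xx xh x≢h) (side-of xx xi x≢i))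
              apex : ∃ (Apex TwistedFace root)
              apex = apex-exists fg′ fh fi gh gi hi′ xf xg xh xi only root

  shape-index : ∀ {A X} → Shape A X → Fin (edgeCount G + F₀)
  shape-index (single k _ _) = k ↑ˡ F₀
  shape-index (quad t _) = edgeCount G ↑ʳ t

  -- The three `X-` fields say that an edge is twisted exactly when both its faces lie in `X`. Hence
  -- two codes with the same apex are compared through `X` alone, by `apex-injective` in both
  -- directions.
  record Code (σ : Scheme G) : Set₁ where
    field
      X : Fin F₀ → Set
      X-left : ∀ {u v} → adj G u v ≡ true → twist σ u v ≡ true → X (ℓ u v)
      X-right : ∀ {u v} → adj G u v ≡ true → twist σ u v ≡ true → X (ℓ v u)
      X-between : ∀ {u v} → adj G u v ≡ true → X (ℓ u v) → X (ℓ v u) → twist σ u v ≡ true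
      form : Shape (twist σ) X

    index : Fin (edgeCount G + F₀)
    index = shape-index form

  abstract
    code : (e : ProjEmbedding G) → Code (proj₁ e)
    code (σ , F , has , euler₁) = record
      { X = TwistedFace ; X-left = twisted-left ; X-right = twisted-right ; X-between = twisted-between ; form = shape }
      where
      open Shapes (twist σ) (twist-even σ) (switched-colouring (normal-form σ) has) euler₁ (faces-finest (normal-form σ) has)

  ↑ˡ≢↑ʳ : ∀ {a b} {i : Fin a} {j : Fin b} → i ↑ˡ b ≢ a ↑ʳ j
  ↑ˡ≢↑ʳ {a} {b} {i} {j} e = clash (trans (≡-sym (Fin.splitAt-↑ˡ a i b)) (trans (cong (splitAt a) e) (Fin.splitAt-↑ʳ a b j)))
    where
    clash : ∀ {x : Fin a} {y : Fin b} → inj₁ x ≢ inj₂ y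
    clash ()

  same-index : ∀ {σ τ} (cσ : Code σ) (cτ : Code τ) → Code.index cσ ≡ Code.index cτ → Equivalent σ τ
  same-index {σ} {τ} cσ cτ e = equivalent σ τ (compare Cσ.form Cτ.form e)
    where
    module Cσ = Code cσ
    module Cτ = Code cτ
    bool-ext : ∀ {a b} → (a ≡ true → b ≡ true) → (b ≡ true → a ≡ true) → a ≡ b
    bool-ext {true} f g = ≡-sym (f refl)
    bool-ext {false} {true} f g = g refl
    bool-ext {false} {false} f g = refl
    compare : (s : Shape (twist σ) Cσ.X) (s′ : Shape (twist τ) Cτ.X) → shape-index s ≡ shape-index s′ →
              ∀ u v → adj G u v ≡ true → twist σ u v ≡ twist τ u v
    compare (single k a only) (single k′ a′ only′) i u v uv = on-edge (edge-cover uv)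
      where
      k≡k′ : k ≡ k′
      k≡k′ = Fin.↑ˡ-injective F₀ k k′ i
      twist-edge : ∀ σ {u v k} → SameEdge G u v (lo k) (hi k) → twist σ u v ≡ twist σ (lo k) (hi k)
      twist-edge σ (inj₁ (refl , refl)) = refl
      twist-edge σ (inj₂ (refl , refl)) = twist-even σ _ _
      on-edge : (∃ λ l → SameEdge G u v (lo l) (hi l)) → twist σ u v ≡ twist τ u v
      on-edge (l , same) = trans (twist-edge σ same) (trans (bool-ext
        (λ b → trans (cong (λ l → twist τ (lo l) (hi l)) (trans (only l b) k≡k′)) a′)
        (λ b → trans (cong (λ l → twist σ (lo l) (hi l)) (trans (only′ l b) (≡-sym k≡k′))) a)) (≡-sym (twist-edge τ same)))
    compare (single k _ _) (quad t _) i = ⊥-elim (↑ˡ≢↑ʳ i)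
    compare (quad t _) (single k _ _) i = ⊥-elim (↑ˡ≢↑ʳ (≡-sym i))
    compare (quad t x) (quad t′ x′) i u v uv = bool-ext
      (λ a → Cτ.X-between uv (apex-injective x x″ (Cσ.X-left uv a)) (apex-injective x x″ (Cσ.X-right uv a)))
      (λ a → Cσ.X-between uv (apex-injective x″ x (Cτ.X-left uv a)) (apex-injective x″ x (Cτ.X-right uv a)))
      where
      t′≡t : t′ ≡ t
      t′≡t = Fin.↑ʳ-injective (edgeCount G) t′ t (≡-sym i)
      x″ : Apex Cτ.X root t
      x″ = subst (Apex Cτ.X root) t′≡t x′

  -- The upper bound

  rootFace : Fin 3 → Fin F₀
  rootFace i = ℓ root (nbr root i)

  -- At a cubic vertex any two of the three faces are consecutive, hence the two sides of an edge,
  -- and `two-sided` separates them.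
  rootFace-injective : ∀ {i j} → rootFace i ≡ rootFace j → i ≡ j
  rootFace-injective {i} {j} e = cases (rot-cover σ₀ (nbr-adj root i) (nbr-adj root j))
    where
    consecutive : ∀ {u} → adj G root u ≡ true → ℓ root u ≢ ℓ root (rot σ₀ root u)
    consecutive {u} ru e = two-sided (rot-adj σ₀ root u ru) (trans (≡-sym e) (ℓ-corner ru))
    cases : nbr root j ≡ nbr root i ⊎ nbr root j ≡ rot σ₀ root (nbr root i) ⊎ nbr root j ≡ rot σ₀ root (rot σ₀ root (nbr root i)) → i ≡ j
    cases (inj₁ same) = ≡-sym (nbr-injective root same)
    cases (inj₂ (inj₁ next)) = contradiction (trans e (cong (ℓ root) next)) (consecutive (nbr-adj root i))
    cases (inj₂ (inj₂ previous)) = contradiction (trans (≡-sym e) (cong (ℓ root) wrap)) (consecutive (nbr-adj root j))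
      where
      wrap : nbr root i ≡ rot σ₀ root (nbr root j)
      wrap = ≡-sym (trans (cong (rot σ₀ root) previous) (rot³ σ₀ (nbr-adj root i)))

  index-avoids-root : ∀ {σ} (c : Code σ) i → Code.index c ≢ edgeCount G ↑ʳ rootFace i
  index-avoids-root c i e with Code.form c
  ... | single k _ _ = ↑ˡ≢↑ʳ e
  ... | quad t x = Apex.apex-avoids-root x (nbr-adj root i) (≡-sym (Fin.↑ʳ-injective (edgeCount G) _ _ e))

  -- The three faces at the root are never apices, which leaves E + F₀ − 3 = 2n − 1 codes.
  upper-bound : (e : Fin (2 * n) → ProjEmbedding G) → ∃ λ i → ∃ λ j → i ≢ j × EquivalentEmb (e i) (e j)
  upper-bound e = from (pigeonhole enough place)
    where
    place′ : Fin (2 * n) ⊎ Fin 3 → Fin (edgeCount G + F₀)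
    place′ (inj₁ i) = Code.index (code (e i))
    place′ (inj₂ j) = edgeCount G ↑ʳ rootFace j
    place : Fin (2 * n + 3) → Fin (edgeCount G + F₀)
    place x = place′ (splitAt (2 * n) x)
    -- From 2E = 3n and Euler's formula, E + F₀ = 2n + 2. The 2n embeddings and the three root faces
    -- are one too many for these places, and only two embeddings can collide.
    enough : edgeCount G + F₀ < 2 * n + 3
    enough = ℕ.≤-reflexive (trans (cong suc (ℕ.+-cancelʳ-≡ n (edgeCount G + F₀) (2 * n + 2) count)) (≡-sym (ℕ.+-suc (2 * n) 2)))
      where
      count : edgeCount G + F₀ + n ≡ 2 * n + 2 + n
      count = begin
        edgeCount G + F₀ + n              ≡⟨ ℕ.+-assoc (edgeCount G) F₀ n ⟩
        edgeCount G + (F₀ + n)            ≡⟨ cong (edgeCount G +_) (trans (ℕ.+-comm F₀ n) euler) ⟩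
        edgeCount G + (edgeCount G + 2)   ≡⟨ ℕ.+-assoc (edgeCount G) (edgeCount G) 2 ⟨
        edgeCount G + edgeCount G + 2     ≡⟨ cong (_+ 2) (cubic-edgeCount G cubic) ⟩
        3 * n + 2                         ≡⟨ cong (_+ 2) (ℕ.+-comm n (2 * n)) ⟩
        2 * n + n + 2                     ≡⟨ ℕ.+-assoc (2 * n) n 2 ⟩
        2 * n + (n + 2)                   ≡⟨ cong (2 * n +_) (ℕ.+-comm n 2) ⟩
        2 * n + (2 + n)                   ≡⟨ ℕ.+-assoc (2 * n) 2 n ⟨
        2 * n + 2 + n                     ∎
        where open ≡-Reasoning
    from : (∃₂ λ x y → x Fin.< y × place x ≡ place y) → ∃ λ i → ∃ λ j → i ≢ j × EquivalentEmb (e i) (e j)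
    from (x , y , x<y , same) = place-cases (splitAt (2 * n) x) (splitAt (2 * n) y) refl refl
      where
      distinct : ∀ {s} → splitAt (2 * n) x ≡ s → splitAt (2 * n) y ≡ s → ⊥
      distinct p q = Fin.<⇒≢ x<y (trans (≡-sym (Fin.join-splitAt (2 * n) 3 x))
        (trans (cong (Fin.join (2 * n) 3) (trans p (≡-sym q))) (Fin.join-splitAt (2 * n) 3 y)))
      place-cases : ∀ s t → splitAt (2 * n) x ≡ s → splitAt (2 * n) y ≡ t → ∃ λ i → ∃ λ j → i ≢ j × EquivalentEmb (e i) (e j)
      place-cases s t p q = both s t p q (trans (≡-sym (cong place′ p)) (trans same (cong place′ q)))
        where
        both : ∀ s t → splitAt (2 * n) x ≡ s → splitAt (2 * n) y ≡ t → place′ s ≡ place′ t →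
               ∃ λ i → ∃ λ j → i ≢ j × EquivalentEmb (e i) (e j)
        both (inj₁ i) (inj₁ j) p q eq = i , j , (λ i≡j → distinct (trans p (cong inj₁ i≡j)) q) , same-index (code (e i)) (code (e j)) eq
        both (inj₁ i) (inj₂ j) p q eq = ⊥-elim (index-avoids-root (code (e i)) j eq)
        both (inj₂ i) (inj₁ j) p q eq = ⊥-elim (index-avoids-root (code (e j)) i (≡-sym eq))
        both (inj₂ i) (inj₂ j) p q eq = ⊥-elim (distinct (trans p (cong inj₂ (rootFace-injective (Fin.↑ʳ-injective (edgeCount G) _ _ eq)))) q)

  -- The lower bound: twisting a single edge

  module _ (p₀ q₀ : Fin n) where

    twisted-scheme : Scheme G
    twisted-scheme = record
      { rot = rot σ₀ ; rot-adj = rot-adj σ₀ ; rot-inj = rot-inj σ₀ ; rot-cyc = rot-cyc σ₀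
      ; sig = δ p₀ q₀ ; sig-sym = δ-even p₀ q₀ }

  Arc : Set
  Arc = Σ (Fin n × Fin n) IsDart

  -- Face tracing: by `ℓ-corner` the new dart has the same face on its left.
  next : Arc → Arc
  next ((v , u) , vu) = (rot σ₀ v u , v) , adj-flip (rot-adj σ₀ v u vu)

  arc-≡ : ∀ {x y : Arc} → proj₁ x ≡ proj₁ y → x ≡ y
  arc-≡ {_ , a} {_ , b} refl = cong (_ ,_) (≡-irrelevant a b)

  next-injective : ∀ {x y} → next x ≡ next y → x ≡ y
  next-injective {(v , u) , vu} {(v′ , u′) , vu′} e = go (cong (proj₂ ∘ proj₁) e) (cong (proj₁ ∘ proj₁) e)
    where
    go : v ≡ v′ → rot σ₀ v u ≡ rot σ₀ v′ u′ → _≡_ {A = Arc} ((v , u) , vu) ((v′ , u′) , vu′)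
    go refl f = arc-≡ (cong (v ,_) (rot-inj σ₀ v u u′ vu vu′ f))

  period : ∀ x → ∃ λ k → iter next (suc k) x ≡ x
  period x = from (pigeonhole (ℕ.n<1+n (n * n)) (λ i → encode (iter next (toℕ i) x)))
    where
    encode : Arc → Fin (n * n)
    encode ((v , u) , _) = Fin.combine v u
    encode-injective : ∀ {x y} → encode x ≡ encode y → x ≡ y
    encode-injective {(v , u) , _} {(v′ , u′) , _} e = arc-≡ (let a , b = Fin.combine-injective v u v′ u′ e in cong₂ _,_ a b)
    unwind : ∀ i j → i < j → iter next i x ≡ iter next j x → ∃ λ k → iter next (suc k) x ≡ x
    unwind zero (suc j) _ e = j , ≡-sym e
    unwind (suc i) (suc j) (s≤s i<j) e = unwind i j i<j (next-injective e)
    from : (∃₂ λ i j → i Fin.< j × encode (iter next (toℕ i) x) ≡ encode (iter next (toℕ j) x)) → ∃ λ k → iter next (suc k) x ≡ x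
    from (i , j , i<j , e) = unwind (toℕ i) (toℕ j) i<j (encode-injective e)

  module _ {p₀ q₀ : Fin n} (pq₀ : adj G p₀ q₀ ≡ true) where
    private
      σ₁ : Scheme G
      σ₁ = twisted-scheme p₀ q₀
      _~_ : Flag G → Flag G → Set
      _~_ = SameFace σ₁
      infix 4 _~_
      ~-trans : ∀ {x y z} → x ~ y → y ~ z → x ~ z
      ~-trans = EqC.transitive _
      ~-sym : ∀ {x y} → x ~ y → y ~ x
      ~-sym = EqC.symmetric _

    turn-step : ∀ {v u} (vu : adj G v u ≡ true) → flag v u true vu ~ flag v (rot σ₀ v u) false (rot-adj σ₀ v u vu)
    turn-step vu = EqC.return (τ₁ refl refl refl refl)

    cross-step : ∀ {v u s} (vu : adj G v u ≡ true) (uv : adj G u v ≡ true) → δ p₀ q₀ v u ≡ false → flag v u s vu ~ flag u v (not s) uv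
    cross-step {s = s} vu uv miss = EqC.return (τ₀ refl refl (cong (λ b → if b then s else not s) (≡-sym miss)))

    twist-step : ∀ {v u s} (vu : adj G v u ≡ true) (uv : adj G u v ≡ true) → δ p₀ q₀ v u ≡ true → flag v u s vu ~ flag u v s uv
    twist-step {s = s} vu uv hit = EqC.return (τ₀ refl refl (cong (λ b → if b then s else not s) (≡-sym hit)))

    -- The old face through the twisted edge pq is cut open there; following it all the way around from
    -- (p , q) leads back to the other side of the gap.
    around : ∀ {p q} (pq : adj G p q ≡ true) → SameEdge G p q p₀ q₀ → flag p q true pq ~ flag q p false (adj-flip pq)
    around {p} {q} pq twisted = let k , e = period start in finish (suc k) (λ ()) (cong proj₁ e) (reach (suc k))
      where
      start : Arc
      start = (p , q) , pq
      gap : Flag G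
      gap = flag q p false (adj-flip pq)
      -- The last component records that the trace has not come back to its start. As it must do so
      -- after a full period, the gap has been reached by then.
      Reached : ℕ → Arc → Set
      Reached k ((v , u) , vu) = flag p q true pq ~ flag v u true vu × ℓ v u ≡ ℓ p q × (k ≡ 0 ⊎ (v , u) ≢ (p , q))
      Progress : ℕ → Arc → Set
      Progress k x = flag p q true pq ~ gap ⊎ Reached k x
      advance : ∀ k x → Progress k x → Progress (suc k) (next x)
      advance k x (inj₁ done) = inj₁ done
      advance k ((v , u) , vu) (inj₂ (reached , on-face , _)) = decide (w ≟ p) (v ≟ q)
        where
        w = rot σ₀ v u
        vw : adj G v w ≡ true
        vw = rot-adj σ₀ v u vu
        at-w : flag p q true pq ~ flag v w false vw
        at-w = ~-trans reached (turn-step vu)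
        next-face : ℓ w v ≡ ℓ p q
        next-face = trans (≡-sym (ℓ-corner vu)) on-face
        proceed : ¬ (w ≡ p × v ≡ q) → Progress (suc k) (next ((v , u) , vu))
        proceed ne = inj₂ (~-trans at-w (cross-step vw (adj-flip vw) miss) , next-face , inj₂ (λ e → ne (cong proj₁ e , cong proj₂ e)))
          where
          -- The trace keeps `ℓ p q` on its left, so meeting the twisted edge in the other direction
          -- would put this face on both sides of it.
          not-same : ¬ SameEdge G v w p q
          not-same (inj₂ (e , e′)) = ne (e′ , e)
          not-same (inj₁ (refl , e′)) = two-sided pq (trans (≡-sym next-face) (cong (λ x → ℓ x p) e′))
          back : SameEdge G v w p₀ q₀ → SameEdge G v w p q
          back s = compose s (SameEdge-sym G twisted)
            where
            compose : ∀ {a b c d e f} → SameEdge G a b c d → SameEdge G c d e f → SameEdge G a b e f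
            compose (inj₁ (refl , refl)) t = t
            compose (inj₂ (refl , refl)) t = SameEdge-flip G t
          miss : δ p₀ q₀ v w ≡ false
          miss = δ-miss (not-same ∘ back)
        decide : Dec (w ≡ p) → Dec (v ≡ q) → Progress (suc k) (next ((v , u) , vu))
        decide (yes e) (yes e′) = inj₁ (subst (flag p q true pq ~_) (relabel vw e e′) at-w)
          where
          relabel : ∀ {v w} (vw : adj G v w ≡ true) → w ≡ p → v ≡ q → flag v w false vw ≡ gap
          relabel vw refl refl = flag-cong refl
        decide (no ne) _ = proceed (ne ∘ proj₁)
        decide _ (no ne) = proceed (ne ∘ proj₂)
      reach : ∀ k → Progress k (iter next k start)
      reach zero = inj₂ (EqC.reflexive _ , refl , inj₁ refl)
      reach (suc k) = advance k (iter next k start) (reach k)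
      finish : ∀ k → k ≢ 0 → ∀ {x} → proj₁ x ≡ (p , q) → Progress k x → flag p q true pq ~ gap
      finish k k≢0 e (inj₁ done) = done
      finish k k≢0 e (inj₂ (_ , _ , inj₁ k≡0)) = contradiction k≡0 k≢0
      finish k k≢0 e (inj₂ (_ , _ , inj₂ ne)) = contradiction e ne

    private
      face : Flag G → Fin F₀
      face = proj₁ faces

    -- The only old move that is lost is the untwisted crossing of the twisted edge; `around`
    -- replaces it by the detour along the rest of the face.
    refines : ∀ {x y} → SameFace σ₀ x y → x ~ y
    refines = EqC.fold (EqC.isEquivalence _) step-refines
      where
      across : ∀ {v u} s (vu : adj G v u ≡ true) (uv : adj G u v ≡ true) → flag v u s vu ~ flag u v (not s) uv
      across {v} {u} s vu uv = decide (δ p₀ q₀ v u) refl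
        where
        side-of : ∀ s → SameEdge G v u p₀ q₀ → flag v u s vu ~ flag u v (not s) uv
        side-of true same = subst (flag v u true vu ~_) (flag-cong refl) (around vu same)
        side-of false same = ~-sym (subst (flag u v true uv ~_) (flag-cong refl) (around uv (SameEdge-flip G same)))
        decide : ∀ b → δ p₀ q₀ v u ≡ b → flag v u s vu ~ flag u v (not s) uv
        decide false miss = cross-step vu uv miss
        decide true hit = side-of s (δ-sound hit)
      step-refines : ∀ {x y} → FlagStep σ₀ x y → x ~ y
      step-refines (τ₁ a b c e) = EqC.return (τ₁ a b c e)
      step-refines {flag v u s vu} {flag .u .v s′ uv} (τ₀ refl refl e) =
        subst (λ s′ → flag v u s vu ~ flag u v s′ uv) (≡-sym (trans e (cong (λ b → if b then s else not s) (flat v u vu)))) (across s vu uv)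

    face-ℓ : ∀ {v u} (vu : adj G v u ≡ true) → face (flag v u true vu) ≡ ℓ v u
    face-ℓ vu = ≡-sym (c₀-flag (flag _ _ true vu))

    face-ℓ′ : ∀ {v u} (vu : adj G v u ≡ true) → face (flag v u false vu) ≡ ℓ u v
    face-ℓ′ vu = trans (≡-sym (c₀-flag (flag _ _ false vu))) (ℓ-right vu)

    -- Old faces stay connected by `refines`, and the twisted crossing links the two sides of the
    -- edge. Every other move stays within an old face, so nothing beyond these two is merged.
    twisted-faces : ∀ {F} → F₀ ≡ suc F → HasFaces σ₁ F
    twisted-faces {F} F₀≡ = from-merge (merge F₀≡ (two-sided pq₀))
      where
      f g : Fin F₀
      f = ℓ p₀ q₀
      g = ℓ q₀ p₀
      from-merge : (∃ λ (m : Fin F₀ → Fin F) → m f ≡ m g ×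
                     (∀ i j → m i ≡ m j → i ≡ j ⊎ (i ≡ f × j ≡ g) ⊎ (i ≡ g × j ≡ f)) × (∀ k → ∃ λ i → m i ≡ k)) → HasFaces σ₁ F
      from-merge (m , mf≡mg , fibres , m-onto) = m ∘ face , (λ x y → mk⇔ (joined x y) invariant) , onto′
        where
        onto′ : ∀ k → ∃ λ x → m (face x) ≡ k
        onto′ k = let i , e = m-onto k ; x , e′ = proj₂ (proj₂ faces) i in x , trans (cong m e′) e
        same-face : ∀ {x y} → face x ≡ face y → x ~ y
        same-face {x} {y} e = refines (Equivalence.to (proj₁ (proj₂ faces) x y) e)
        bridge : ∀ {x y} → face x ≡ f → face y ≡ g → x ~ y
        bridge e e′ = ~-trans (same-face (trans e (≡-sym (face-ℓ pq₀))))
          (~-trans (twist-step pq₀ (adj-flip pq₀) (δ-self pq₀)) (same-face (trans (face-ℓ (adj-flip pq₀)) (≡-sym e′))))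
        joined : ∀ x y → m (face x) ≡ m (face y) → x ~ y
        joined x y e = pick (fibres (face x) (face y) e)
          where
          pick : face x ≡ face y ⊎ (face x ≡ f × face y ≡ g) ⊎ (face x ≡ g × face y ≡ f) → x ~ y
          pick (inj₁ e) = same-face e
          pick (inj₂ (inj₁ (e , e′))) = bridge e e′
          pick (inj₂ (inj₂ (e , e′))) = ~-sym (bridge e′ e)
        σ₀-step : ∀ {x y} → FlagStep σ₀ x y → face x ≡ face y
        σ₀-step {x} {y} s = Equivalence.from (proj₁ (proj₂ faces) x y) (EqC.return s)
        twisted-sides : ∀ {v u} → SameEdge G v u p₀ q₀ → m (ℓ v u) ≡ m (ℓ u v)
        twisted-sides (inj₁ (refl , refl)) = mf≡mg
        twisted-sides (inj₂ (refl , refl)) = ≡-sym mf≡mg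
        step-invariant : ∀ {x y} → FlagStep σ₁ x y → m (face x) ≡ m (face y)
        step-invariant (τ₁ a b c e) = cong m (σ₀-step (τ₁ a b c e))
        step-invariant {flag v u s vu} {flag .u .v s′ uv} (τ₀ refl refl e) = decide (δ p₀ q₀ v u) refl
          where
          sides : ∀ s → SameEdge G v u p₀ q₀ → m (face (flag v u s vu)) ≡ m (face (flag u v s uv))
          sides true same = trans (cong m (face-ℓ vu)) (trans (twisted-sides same) (cong m (≡-sym (face-ℓ uv))))
          sides false same = trans (cong m (face-ℓ′ vu)) (trans (≡-sym (twisted-sides same)) (cong m (≡-sym (face-ℓ′ uv))))
          decide : ∀ b → δ p₀ q₀ v u ≡ b → m (face (flag v u s vu)) ≡ m (face (flag u v s′ uv))
          decide true hit = trans (sides s (δ-sound hit))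
            (cong (m ∘ face) (flag-cong (≡-sym (trans e (cong (λ b → if b then s else not s) hit)))))
          decide false miss = cong m (σ₀-step (τ₀ refl refl (trans e (trans (cong (λ b → if b then s else not s) miss)
            (≡-sym (cong (λ b → if b then s else not s) (flat v u vu)))))))
        invariant : ∀ {x y} → x ~ y → m (face x) ≡ m (face y)
        invariant = EqC.gfold ≡.isEquivalence (m ∘ face) step-invariant

  lower-bound : Σ (Fin (edgeCount G) → ProjEmbedding G) λ e → ∀ i j → EquivalentEmb (e i) (e j) → i ≡ j
  lower-bound = embedding , inequivalent
    where
    F₁ : ℕ
    F₁ = ℕ.pred F₀
    F₀≡ : F₀ ≡ suc F₁
    F₀≡ = positive F₀ (ℓ root (nbr root zero))
      where
      positive : ∀ N → Fin N → N ≡ suc (ℕ.pred N)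
      positive (suc N) _ = refl
    euler₁ : n + F₁ ≡ edgeCount G + 1
    euler₁ = ℕ.suc-injective (begin
      suc (n + F₁)          ≡⟨ ℕ.+-suc n F₁ ⟨
      n + suc F₁            ≡⟨ cong (n +_) F₀≡ ⟨
      n + F₀                ≡⟨ euler ⟩
      edgeCount G + 2       ≡⟨ ℕ.+-suc (edgeCount G) 1 ⟩
      suc (edgeCount G + 1) ∎)
      where open ≡-Reasoning
    embedding : Fin (edgeCount G) → ProjEmbedding G
    embedding k = twisted-scheme (lo k) (hi k) , F₁ , twisted-faces (edge-adj k) F₀≡ , euler₁
    inequivalent : ∀ i j → EquivalentEmb (embedding i) (embedding j) → i ≡ j
    inequivalent i j (S , rotations , signatures) = edge-same (δ-sound same-edge)
      where
      -- All these embeddings share the rotations of `σ₀`. A switch at `v` would make that rotation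
      -- its own inverse, which three neighbours do not allow; with no switches, the signatures must
      -- coincide.
      unswitched : ∀ v → S v ≡ false
      unswitched v = from (S v) (rotations v (nbr v zero) (nbr-adj v zero))
        where
        from : ∀ b → (if b then rot σ₀ v (rot σ₀ v (nbr v zero)) ≡ nbr v zero else rot σ₀ v (nbr v zero) ≡ rot σ₀ v (nbr v zero)) → b ≡ false
        from true e = contradiction e (rot²-≢ σ₀ (nbr-adj v zero))
        from false _ = refl
      same-edge : δ (lo j) (hi j) (lo i) (hi i) ≡ true
      same-edge = trans (signatures (lo i) (hi i) (edge-adj i))
        (cong₂ _xor_ (cong₂ _xor_ (δ-self (edge-adj i)) (unswitched (lo i))) (unswitched (hi i)))

theorem12 : ∀ (n : ℕ) (G : Graph n) → KConnected 3 G → Cubic G → Planar G →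
    (Σ ℕ λ k → (3 * n ≤ 2 * k) ×
    Σ (Fin k → ProjEmbedding G) λ e → ∀ i j → EquivalentEmb (e i) (e j) → i ≡ j)
    × (∀ (e : Fin (2 * n) → ProjEmbedding G) →
    ∃ λ i → ∃ λ j → (i ≢ j) × EquivalentEmb (e i) (e j))
theorem12 n G conn cubic (σ₀ , flat , F₀ , faces , euler) =
  (edgeCount G , ℕ.≤-reflexive size , lower-bound) , upper-bound
  where
  open Plane {G = G} conn cubic σ₀ flat faces euler
  size : 3 * n ≡ 2 * edgeCount G
  size = trans (≡-sym (cubic-edgeCount G cubic)) (cong (edgeCount G +_) (≡-sym (ℕ.+-identityʳ (edgeCount G))))
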